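{- Fix an integer $r>0$ and partitions $\alpha,\beta_1,\beta_2$. Then in $\Lambda_1\otimes_{\mathbb Z}\Lambda_2$, \[ \tau^r_{\alpha,\emptyset}\,\tau^r_{\beta_1,\beta_2}=\sum_{\lambda}\sum_{T_1\in \mathrm{RW}_{\lambda/\beta_1}(\alpha)}\Big(\tau^r_{\lambda,\beta_2}+\sum_{a_{T_2}}\tau^r_{t(a_{T_2})}\Big), \] where $\lambda$ runs over partitions containing $\beta_1$, and the inner sum runs over arrows $a_{T_2}:(\lambda,\beta_2)\to(\gamma_1,\gamma_2)$ of the Remmel–Whitney quiver (so $T_2\in\mathrm{RW}_{\gamma_1/\lambda}(\beta_2/\gamma_2)$) that satisfy the $r$-th row rule and such that the tableau $S=\mathrm{Slide}_{T_1}(T_2)$ (of shape $\delta/\beta_1$ for some $\delta$, defining the arrow $a_S:(\beta_1,\beta_2)\to(\delta,\gamma_2)$) satisfies the reverse $r$-th row rule, i.e. $R_r(i)>\mathrm{row}_S(i)$ for all $i$, where $R_r$ is computed from $\beta_2/\gamma_2$.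
   Context: Partitions are Young diagrams in English notation (rows numbered $1,2,\dots$ top to bottom, columns left to right); $\alpha/\beta$ is a skew shape; standard tableaux of shape $\alpha/\beta$ are fillings by $1,\dots,|\alpha|-|\beta|$ increasing along rows and down columns; the row of an entry is the row index of its box. $\mathrm{rl}(\alpha/\beta)$: write $1,\dots,|\alpha|-|\beta|$ into $\alpha/\beta$ right to left along each row, rows top to bottom. $\mathrm{RW}_{\gamma/\delta}(\alpha/\beta)$: standard tableaux $T$ of shape $\gamma/\delta$ such that (i) if $i,i+1$ are in the same row of $\mathrm{rl}(\alpha/\beta)$ then $i+1$ is strictly right of and weakly above $i$ in $T$; (ii) if $i$ is directly above $j$ in a column of $\mathrm{rl}(\alpha/\beta)$ then $j$ is strictly below and weakly left of $i$ in $T$. $\Lambda_1,\Lambda_2$: symmetric functions in $x$'s and $y$'s; $s_{\alpha_1,\alpha_2}=s_{\alpha_1}(x)s_{\alpha_2}(y)$. Remmel–Whitney quiver: vertices are pairs of partitions; for distinct pairs with $\alpha_1\subseteq\beta_1$, $\beta_2\subseteq\alpha_2$, one arrow $a_T:(\alpha_1,\alpha_2)\to(\beta_1,\beta_2)$ per $T\in\mathrm{RW}_{\beta_1/\alpha_1}(\alpha_2/\beta_2)$; $t(a)$ is the target. Row rule: the $r$-th row rule filling of a partition $\alpha$ puts $r+i-j$ in the box in row $i$, column $j$. For an arrow $a_T:(\alpha_1,\alpha_2)\to(\beta_1,\beta_2)$ and $i\in\{1,\dots,|\beta_1|-|\alpha_1|\}$, let $R_r(i)$ be the entry of the $r$-th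 row rule filling of $\alpha_2$ at the box of $\alpha_2/\beta_2$ labelled $i$ in $\mathrm{rl}(\alpha_2/\beta_2)$, and $\mathrm{row}_T(i)$ the row of $i$ in $T$. $a_T$ satisfies the $r$-th row rule if $R_r(i)\le\mathrm{row}_T(i)$ for all $i$, and the reverse $r$-th row rule if $R_r(i)>\mathrm{row}_T(i)$ for all $i$. The basis $\tau^r$ is defined recursively on $|\alpha_2|$ by $\tau^r_{\alpha_1,\alpha_2}=s_{\alpha_1,\alpha_2}-\sum_a\tau^r_{t(a)}$, the sum over arrows $a$ with source $(\alpha_1,\alpha_2)$ satisfying the $r$-th row rule. Infusion: for partitions $\alpha\subseteq\beta\subseteq\gamma$ and standard tableaux $T_1$ of shape $\beta/\alpha$, $T_2$ of shape $\gamma/\beta$, go through the boxes of $T_1$ in decreasing order of their labels and for each such box (label $i$) perform a jeu-de-taquin slide of the current $T_2$ into it (repeatedly moving the smaller of the entries to the right and below the empty box into it until the empty box reaches the outside); the box vacated at the outside is labelled $i$. The resulting tableau from $T_2$ is $\mathrm{Slide}_{T_1}(T_2)$, and the labelled vacated boxes form $\mathrm{Slide}^{T_2}(T_1)$. -}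

module Defs where

open import Data.Bool using (Bool; true; false; _∧_; _∨_; not; if_then_else_; T)
open import Data.Nat as ℕ using (ℕ; zero; suc; _+_; _∸_; _<_; _≤_; _≡ᵇ_; _≤ᵇ_; _<ᵇ_)
open import Data.Integer as ℤ using (ℤ; +_)
open import Data.List using (List; []; _∷_; _++_; map; concatMap; filter; length; foldr; upTo; zip; reverse)
open import Data.List.Relation.Unary.All using (All)
open import Data.List.Relation.Unary.Linked using (Linked)
open import Data.Vec as Vec using (Vec)
open import Data.Vec.Properties as VecP using ()
open import Data.Product using (_×_; _,_; proj₁; proj₂)
open import Data.Maybe using (Maybe; just; nothing)
open import Relation.Nullary using (does)
open import Relation.Binary.PropositionalEquality using (_≡_)
import Data.List.Properties as LP
import Data.Nat.Properties as NP
open import Data.Nat.ListAction using (sum)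

range1 : ℕ → List ℕ
range1 n = map suc (upTo n)

allB : {A : Set} → (A → Bool) → List A → Bool
allB p []       = true
allB p (x ∷ xs) = p x ∧ allB p xs

filterB : {A : Set} → (A → Bool) → List A → List A
filterB p []       = []
filterB p (x ∷ xs) = if p x then x ∷ filterB p xs else filterB p xs

_⇒B_ : Bool → Bool → Bool
a ⇒B b = not a ∨ b

eqListℕ : List ℕ → List ℕ → Bool
eqListℕ xs ys = does (LP.≡-dec NP._≟_ xs ys)

-- 1-indexed lookup with default
at : {A : Set} → A → List A → ℕ → A
at d []       _             = d
at d (x ∷ xs) zero          = d
at d (x ∷ xs) (suc zero)    = x
at d (x ∷ xs) (suc (suc k)) = at d xs (suc k)

insertions : {A : Set} → A → List A → List (List A)
insertions x []       = (x ∷ []) ∷ []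
insertions x (y ∷ ys) = (x ∷ y ∷ ys) ∷ map (y ∷_) (insertions x ys)

perms : {A : Set} → List A → List (List A)
perms []       = [] ∷ []
perms (x ∷ xs) = concatMap (insertions x) (perms xs)

words : ℕ → ℕ → List (List ℕ)
words m zero    = [] ∷ []
words m (suc n) = concatMap (λ v → map (v ∷_) (words m n)) (range1 m)

-- Partitions (as lists of parts, English notation, rows/columns 1-indexed)

Partition : Set
Partition = List ℕ

IsPartition : List ℕ → Set
IsPartition λ′ = All (λ p → 0 < p) λ′ × Linked ℕ._≥_ λ′

size : List ℕ → ℕ
size = sum

part : List ℕ → ℕ → ℕ
part = at 0

containedB : List ℕ → List ℕ → Bool
containedB μ λ′ = allB (λ i → part μ i ≤ᵇ part λ′ i) (range1 (length μ))

-- partitions of n with all parts ≤ m (fuel f ≥ n)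
partsBounded : ℕ → ℕ → ℕ → List (List ℕ)
partsBounded f       zero    m = [] ∷ []
partsBounded zero    (suc n) m = []
partsBounded (suc f) (suc n) m =
  concatMap (λ k → map (k ∷_) (partsBounded f (suc n ∸ k) k))
            (filterB (λ k → k ≤ᵇ m) (range1 (suc n)))

partitionsOf : ℕ → List (List ℕ)
partitionsOf n = partsBounded n n n

subPartitions : List ℕ → List (List ℕ)
subPartitions λ′ =
  concatMap (λ k → filterB (λ μ → containedB μ λ′) (partitionsOf k))
            (0 ∷ range1 (size λ′))

Box : Set
Box = ℕ × ℕ   -- (row, column), both 1-indexed

row col : Box → ℕ
row = proj₁
col = proj₂

eqBox : Box → Box → Bool
eqBox (a , b) (c , d) = (a ≡ᵇ c) ∧ (b ≡ᵇ d)

skewBoxes : List ℕ → List ℕ → List Box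
skewBoxes λ′ μ = concatMap (λ i → map (λ j → (i , j))
                     (filterB (λ j → part μ i <ᵇ j) (range1 (part λ′ i))))
                   (range1 (length λ′))

-- A tableau with entries 1..n is represented by the list of the boxes
-- containing 1, 2, ..., n (in this order).
Tableau : Set
Tableau = List Box

boxOf : Tableau → ℕ → Box
boxOf = at (0 , 0)

isStandardB : Tableau → Bool
isStandardB t =
  allB (λ k → allB (λ l → (k <ᵇ l) ⇒B
            ( ((row (boxOf t k) ≡ᵇ row (boxOf t l)) ⇒B (col (boxOf t k) <ᵇ col (boxOf t l)))
            ∧ ((col (boxOf t k) ≡ᵇ col (boxOf t l)) ⇒B (row (boxOf t k) <ᵇ row (boxOf t l)))))
         (range1 (length t))) (range1 (length t))

stdTableaux : List ℕ → List ℕ → List Tableau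
stdTableaux λ′ μ = filterB isStandardB (perms (skewBoxes λ′ μ))

rl : List ℕ → List ℕ → Tableau
rl α β = concatMap (λ i → map (λ j → (i , j))
            (reverse (filterB (λ j → part β i <ᵇ j) (range1 (part α i)))))
          (range1 (length α))

rwCondB : List ℕ → List ℕ → Tableau → Bool
rwCondB α β t =
  let r = rl α β ; n = length r in
  (length t ≡ᵇ n) ∧
  allB (λ i → (row (boxOf r i) ≡ᵇ row (boxOf r (suc i))) ⇒B
               ((col (boxOf t i) <ᵇ col (boxOf t (suc i)))
                ∧ (row (boxOf t (suc i)) ≤ᵇ row (boxOf t i))))
       (range1 (n ∸ 1))
  ∧ allB (λ i → allB (λ j →
        ((col (boxOf r i) ≡ᵇ col (boxOf r j)) ∧ (row (boxOf r j) ≡ᵇ suc (row (boxOf r i)))) ⇒B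
        ((row (boxOf t i) <ᵇ row (boxOf t j)) ∧ (col (boxOf t j) ≤ᵇ col (boxOf t i))))
      (range1 n)) (range1 n)

RW : List ℕ → List ℕ → List ℕ → List ℕ → List Tableau
RW γ δ α β = filterB (rwCondB α β) (stdTableaux γ δ)

Pair : Set
Pair = List ℕ × List ℕ

-- an arrow a_T : (α₁,α₂) → (β₁,β₂) is recorded as (β₁ , β₂ , T)
Arrow : Set
Arrow = List ℕ × List ℕ × Tableau

target : Arrow → Pair
target (b₁ , b₂ , _) = (b₁ , b₂)

arrowsFrom : Pair → List Arrow
arrowsFrom (a₁ , a₂) =
  concatMap (λ b₂ →
    concatMap (λ b₁ →
      map (λ t → (b₁ , b₂ , t)) (RW b₁ a₁ a₂ b₂))
      (filterB (λ b₁ → containedB a₁ b₁ ∧ not (eqListℕ a₁ b₁ ∧ eqListℕ a₂ b₂))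
               (partitionsOf (size a₁ + (size a₂ ∸ size b₂)))))
    (subPartitions a₂)

rowRuleEntry : ℕ → Box → ℤ
rowRuleEntry r (i , j) = (+ r ℤ.+ + i) ℤ.- + j

rowRuleB : ℕ → List ℕ → List ℕ → Tableau → Bool
rowRuleB r a₂ b₂ t =
  let ρ = rl a₂ b₂ in
  allB (λ i → rowRuleEntry r (boxOf ρ i) ℤ.≤ᵇ + row (boxOf t i)) (range1 (length ρ))

revRowRuleB : ℕ → List ℕ → List ℕ → Tableau → Bool
revRowRuleB r a₂ b₂ t =
  let ρ = rl a₂ b₂ in
  allB (λ i → not (rowRuleEntry r (boxOf ρ i) ℤ.≤ᵇ + row (boxOf t i))) (range1 (length ρ))

satRowRule : ℕ → Pair → Arrow → Bool
satRowRule r (a₁ , a₂) (b₁ , b₂ , t) = rowRuleB r a₂ b₂ t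

labelAt : Tableau → Box → Maybe ℕ
labelAt []       b = nothing
labelAt (c ∷ cs) b = if eqBox c b then just 1 else Data.Maybe.map suc (labelAt cs b)
  where import Data.Maybe

setAt : Tableau → ℕ → Box → Tableau
setAt []       _             b = []
setAt (c ∷ cs) zero          b = c ∷ cs
setAt (c ∷ cs) (suc zero)    b = b ∷ cs
setAt (c ∷ cs) (suc (suc k)) b = c ∷ setAt cs (suc k) b

-- jeu-de-taquin slide of t into the empty box e; returns the new tableau
-- and the vacated box.  The fuel (first argument) is only a termination
-- device; `slide` below always supplies enough of it (each entry moves
-- at most once in one slide).
slideFuel : ℕ → Tableau → Box → Tableau × Box
slideFuel zero    t e = (t , e)
slideFuel (suc f) t (i , j) with labelAt t (i , suc j) | labelAt t (suc i , j)
... | nothing | nothing = (t , (i , j))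
... | just k  | nothing = slideFuel f (setAt t k (i , j)) (i , suc j)
... | nothing | just l  = slideFuel f (setAt t l (i , j)) (suc i , j)
... | just k  | just l  = if k <ᵇ l
                          then slideFuel f (setAt t k (i , j)) (i , suc j)
                          else slideFuel f (setAt t l (i , j)) (suc i , j)

slide : Tableau → Box → Tableau × Box
slide t e = slideFuel (suc (length t)) t e

Slide : Tableau → Tableau → Tableau
Slide t₁ t₂ = foldr (λ b t → proj₁ (slide t b)) t₂ t₁

-- Λ₁ ⊗ Λ₂ realised in ℤ[x₁..x_N, y₁..y_N] (for every N)

Monomial : ℕ → Set
Monomial N = Vec ℕ N × Vec ℕ N

eqMono : {N : ℕ} → Monomial N → Monomial N → Bool
eqMono (a , b) (c , d) = does (VecP.≡-dec NP._≟_ a c) ∧ does (VecP.≡-dec NP._≟_ b d)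

Poly : ℕ → Set
Poly N = List (ℤ × Monomial N)

coeff : {N : ℕ} → Poly N → Monomial N → ℤ
coeff []             m = + 0
coeff ((c , m′) ∷ p) m = (if eqMono m′ m then c else + 0) ℤ.+ coeff p m

_≋_ : {N : ℕ} → Poly N → Poly N → Set
P ≋ Q = ∀ m → coeff P m ≡ coeff Q m

infix 4 _≋_

_⊕_ : {N : ℕ} → Poly N → Poly N → Poly N
_⊕_ = _++_

⊖_ : {N : ℕ} → Poly N → Poly N
⊖ P = map (λ { (c , m) → (ℤ.- c , m) }) P

_⊗_ : {N : ℕ} → Poly N → Poly N → Poly N
P ⊗ Q = concatMap (λ { (c , (a , b)) →
          map (λ { (d , (a′ , b′)) → (c ℤ.* d , (Vec.zipWith _+_ a a′ , Vec.zipWith _+_ b b′)) }) Q }) P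

infixl 6 _⊕_
infixl 7 _⊗_

Σ[_]_ : {A : Set} {N : ℕ} → List A → (A → Poly N) → Poly N
Σ[ xs ] f = concatMap f xs

-- semistandard tableaux of shape λ with entries in 1..N, as the list of
-- entries of the boxes of λ (in the order of skewBoxes λ [])
isSSYTB : List ℕ → List ℕ → Bool
isSSYTB λ′ w =
  let bs = skewBoxes λ′ [] ; n = length bs in
  allB (λ p → allB (λ q →
      ( ((row (boxOf bs p) ≡ᵇ row (boxOf bs q)) ∧ (col (boxOf bs q) ≡ᵇ suc (col (boxOf bs p))))
          ⇒B (at 0 w p ≤ᵇ at 0 w q))
    ∧ ( ((col (boxOf bs p) ≡ᵇ col (boxOf bs q)) ∧ (row (boxOf bs q) ≡ᵇ suc (row (boxOf bs p))))
          ⇒B (at 0 w p <ᵇ at 0 w q)))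
    (range1 n)) (range1 n)

weight : (N : ℕ) → List ℕ → Vec ℕ N
weight N w = Vec.tabulate (λ v → length (filterB (λ e → e ≡ᵇ suc (Data.Fin.toℕ v)) w))
  where import Data.Fin

schurMonomials : (N : ℕ) → List ℕ → List (Vec ℕ N)
schurMonomials N λ′ = map (weight N) (filterB (isSSYTB λ′) (words N (size λ′)))

s : (N : ℕ) → Pair → Poly N
s N (a₁ , a₂) = concatMap (λ mx → map (λ my → (+ 1 , (mx , my))) (schurMonomials N a₂))
                          (schurMonomials N a₁)

-- τ^r, by recursion on |α₂| (fuel; τ below supplies |α₂|+1, which suffices
-- since every arrow strictly decreases |α₂|)
τFuel : (N r : ℕ) → ℕ → Pair → Poly N
τFuel N r zero    p = []
τFuel N r (suc f) p =
  s N p ⊕ (⊖ (Σ[ filterB (satRowRule r p) (arrowsFrom p) ] (λ a → τFuel N r f (target a))))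

τ : (N r : ℕ) → Pair → Poly N
τ N r p = τFuel N r (suc (size (proj₂ p))) p

slideRevRowRule : ℕ → List ℕ → Tableau → Arrow → Bool
slideRevRowRule r β₂ t₁ (γ₁ , γ₂ , t₂) = revRowRuleB r β₂ γ₂ (Slide t₁ t₂)

-- By definition, s(β₁,β₂) is the sum of τ over all arrows out of (β₁,β₂), the identity included, that satisfy the
-- row rule. By induction on |β₂| and the Littlewood-Richardson rule s(α) s(β₁) = Σ |RW_{λ/β₁}(α)| s(λ), the theorem
-- amounts to a bijection between the pairs (T₁, T₂) with T₂ satisfying the row rule and the triples (S, U, T′) with
-- S and T′ satisfying the row rule and Slide_U(T′) the reverse row rule. Infusion turns (T₁, T₂) into (S′, V). The
-- entries of S′ that satisfy the row rule form S, the others form a tableau S″ with the reverse row rule, and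
-- infusing (S″, V) back gives (U, T′). The point is that pulling S′ or only S″ through V produces the same violating
-- entries, so T₂ satisfies the row rule if and only if T′ does.
--
-- A slide is one pass of a hole through the word of boxes of a tableau: the entry next to the hole takes its place.
-- Being a Remmel-Whitney tableau is invariant under such passes in both directions, which makes infusion a bijection
-- and shows that the operators L_α : β ↦ Σ |RW_{λ/β}(α)| λ commute; also L_α ∅ = α. The coefficient of x^w in s(κ) is
-- |RW_{W₁/W₀}(κ)| when W₁/W₀ consists of disconnected rows of lengths w, so that the product of two Schur polynomials
-- is a matrix entry of L_α L_β, and the Littlewood-Richardson rule follows from commutativity.

module Submission where

open import Defs
open import Data.Bool using (Bool; true; false; _∧_; not; if_then_else_; T)
open import Data.Empty using (⊥; ⊥-elim)
open import Data.Fin using (toℕ)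
open import Data.Integer as ℤ using (ℤ)
import Data.Integer.Properties as ℤₚ
open import Data.List using (List; []; _∷_; _++_; map; _ʳ++_; reverse; length; concatMap; upTo; applyUpTo; zip)
open import Data.List.Membership.Propositional using (_∈_; _∉_)
open import Data.List.Membership.Propositional.Properties
  using (∈-map⁺; ∈-map⁻; ∈-++⁺ˡ; ∈-++⁺ʳ; ∈-++⁻; ∈-applyUpTo⁺; ∈-applyUpTo⁻; ∈-∃++)
open import Data.List.Membership.Propositional.Properties.WithK using (unique∧set⇒bag)
import Data.List.Properties as Listₚ
open import Data.List.Relation.Binary.BagAndSetEquality using (∼bag⇒↭)
open import Data.List.Relation.Binary.Permutation.Propositional as ↭
  using (_↭_; ↭-refl; ↭-reflexive; ↭-sym; ↭-trans; ↭-prep; ↭-swap)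
import Data.List.Relation.Binary.Permutation.Propositional.Properties as ↭ₚ
open import Data.List.Relation.Unary.All as All using ([]; _∷_)
open import Data.List.Relation.Unary.AllPairs as AllPairs using (AllPairs; []; _∷_)
import Data.List.Relation.Unary.AllPairs.Properties as AllPairsₚ
open import Data.List.Relation.Unary.Any using (here; there)
open import Data.List.Relation.Unary.Linked as Linked using (Linked; []; [-]; _∷_)
import Data.List.Relation.Unary.Linked.Properties as Linkedₚ
open import Data.List.Relation.Unary.Unique.Propositional using (Unique)
import Data.List.Relation.Unary.Unique.Propositional.Properties as Uniqueₚ
open import Data.Maybe using (just; nothing)
open import Data.Nat as ℕ using (ℕ; zero; suc; _+_; _∸_; _<_; _≤_; _≡ᵇ_; _≤ᵇ_; _<ᵇ_; z≤n; s≤s)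
open import Data.Nat.ListAction using (sum)
import Data.Nat.Properties as ℕₚ
open import Data.Product using (_×_; _,_; proj₁; proj₂; Σ; ∃-syntax)
open import Data.Product.Properties using (≡-dec)
open import Data.Sum using (_⊎_; inj₁; inj₂; [_,_]′)
open import Data.Unit using (tt)
open import Data.Vec as Vec using (Vec; []; _∷_; toList; tabulate)
import Data.Vec.Properties as Vecₚ
open import Function using (flip; _∘_; id)
open import Function.Bundles using (mk⇔)
open import Relation.Binary.Definitions using (tri<; tri≈; tri>)
open import Relation.Binary.PropositionalEquality
  using (_≡_; _≢_; refl; sym; trans; cong; cong₂; subst; subst₂; setoid)
open import Relation.Nullary using (Dec; yes; no; ¬_; does)
open import Relation.Nullary.Decidable as Dec using (_×-dec_; _⊎-dec_)

-- Lists

-- A tableau is kept as a picture, the list of pairs of a cell of α/β and the box with its label. A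
-- half-turn of cells and boxes that reverses the reading order preserves (i) and (ii), so one
-- analysis of a moving hole, over an abstract discrete order, serves slides and reverse slides. An
-- infusion is a rectangular array of elementary moves, one for each box of the first and entry of
-- the second tableau. Its rows are slides of the second tableau, its columns reverse slides of the
-- first, so invariance under one slide in each direction settles both outputs. Cutting S′ by the
-- row rule gives tableaux because satisfying entries fill an order ideal of boxes and violating
-- ones an order ideal of cells. The obstacle is that the hole may take different paths through S′
-- and through S″. A satisfying entry read after a violating one lies strictly south-west of it.
-- Hence, once a satisfying entry has led one hole away, neither hole touches a violating entry
-- still to be passed: from then on no violating entry moves in either run.

∈-ʳ++⁻ : {A : Set} (xs : List A) {ys : List A} {e : A} → e ∈ xs ʳ++ ys → e ∈ xs ⊎ e ∈ ys
∈-ʳ++⁻ [] i = inj₂ i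
∈-ʳ++⁻ (x ∷ xs) i with ∈-ʳ++⁻ xs i
... | inj₁ j = inj₁ (there j)
... | inj₂ (here p) = inj₁ (here p)
... | inj₂ (there j) = inj₂ j

∈-ʳ++⁺ʳ : {A : Set} (xs : List A) {ys : List A} {e : A} → e ∈ ys → e ∈ xs ʳ++ ys
∈-ʳ++⁺ʳ [] i = i
∈-ʳ++⁺ʳ (x ∷ xs) i = ∈-ʳ++⁺ʳ xs (there i)

∈-ʳ++⁺ˡ : {A : Set} (xs : List A) {ys : List A} {e : A} → e ∈ xs → e ∈ xs ʳ++ ys
∈-ʳ++⁺ˡ (x ∷ xs) (here p) = ∈-ʳ++⁺ʳ xs (here p)
∈-ʳ++⁺ˡ (x ∷ xs) (there i) = ∈-ʳ++⁺ˡ xs i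

module _ {A : Set} {R : A → A → Set} where

  AllPairs-ʳ++⁻ : ∀ xs {ys} → AllPairs R (xs ʳ++ ys) →
    AllPairs (flip R) xs × AllPairs R ys × (∀ {x y} → x ∈ xs → y ∈ ys → R x y)
  AllPairs-ʳ++⁻ [] p = [] , p , λ ()
  AllPairs-ʳ++⁻ (x ∷ xs) p with AllPairs-ʳ++⁻ xs p
  ... | q , (r ∷ rs) , s = (All.tabulate (λ i → s i (here refl)) ∷ q) , rs
      , λ { (here refl) j → All.lookup r j ; (there i) j → s i (there j) }

  AllPairs-ʳ++⁺ : ∀ xs {ys} → AllPairs (flip R) xs → AllPairs R ys →
    (∀ {x y} → x ∈ xs → y ∈ ys → R x y) → AllPairs R (xs ʳ++ ys)
  AllPairs-ʳ++⁺ [] p q s = q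
  AllPairs-ʳ++⁺ (x ∷ xs) (r ∷ p) q s = AllPairs-ʳ++⁺ xs p
    (All.tabulate (s (here refl)) ∷ q)
    λ { i (here refl) → All.lookup r i ; i (there j) → s (there i) j }

  AllPairs-cross : ∀ xs {ys x y} → AllPairs R (xs ++ ys) → x ∈ xs → y ∈ ys → R x y
  AllPairs-cross (x ∷ xs) (r ∷ a) (here refl) j = All.lookup r (∈-++⁺ʳ xs j)
  AllPairs-cross (x ∷ xs) (r ∷ a) (there i) j = AllPairs-cross xs a i j

  AllPairs-compare : ∀ {xs x y} → AllPairs R xs → x ∈ xs → y ∈ xs → x ≡ y ⊎ R x y ⊎ R y x
  AllPairs-compare (r ∷ p) (here refl) (here refl) = inj₁ refl
  AllPairs-compare (r ∷ p) (here refl) (there j) = inj₂ (inj₁ (All.lookup r j))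
  AllPairs-compare (r ∷ p) (there i) (here refl) = inj₂ (inj₂ (All.lookup r i))
  AllPairs-compare (r ∷ p) (there i) (there j) = AllPairs-compare p i j

-- Ordered coordinates

-- Every axiom has its mirror image among the axioms, so that `op` is again an instance. `S` is the
-- covering relation, and `up` and `down` say that the order is discrete; the least element of the
-- natural numbers must not be visible.
record Order : Set₁ where
  field
    _⊏_ _⊑_ S : ℕ → ℕ → Set
    S? : ∀ x y → Dec (S x y)
    ≤-refl : ∀ {x} → x ⊑ x
    ≤-trans : ∀ {x y z} → x ⊑ y → y ⊑ z → x ⊑ z
    <⇒≤ : ∀ {x y} → x ⊏ y → x ⊑ y
    <-≤-trans : ∀ {x y z} → x ⊏ y → y ⊑ z → x ⊏ z
    ≤-<-trans : ∀ {x y z} → x ⊑ y → y ⊏ z → x ⊏ z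
    <-irr : ∀ {x} → ¬ x ⊏ x
    antisym : ∀ {x y} → x ⊑ y → y ⊑ x → x ≡ y
    cmp : ∀ x y → x ⊏ y ⊎ y ⊑ x
    S⇒< : ∀ {x y} → S x y → x ⊏ y
    S-up : ∀ {x y z} → S x y → x ⊏ z → y ⊑ z
    S-down : ∀ {x y z} → S x y → z ⊏ y → z ⊑ x
    up : ∀ {x y} → x ⊏ y → ∃[ z ] (S x z × z ⊑ y)
    down : ∀ {x y} → x ⊏ y → ∃[ z ] (S z y × x ⊑ z)

  <-trans : ∀ {x y z} → x ⊏ y → y ⊏ z → x ⊏ z
  <-trans p q = <-≤-trans p (<⇒≤ q)

  ≡⇒≤ : ∀ {x y} → x ≡ y → x ⊑ y
  ≡⇒≤ refl = ≤-refl

  <⇒≢ : ∀ {x y} → x ⊏ y → x ≢ y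
  <⇒≢ p refl = <-irr p

  <⇒≱ : ∀ {x y} → x ⊏ y → ¬ y ⊑ x
  <⇒≱ p q = <-irr (<-≤-trans p q)

  cmp₃ : ∀ x y → x ⊏ y ⊎ x ≡ y ⊎ y ⊏ x
  cmp₃ x y with cmp x y
  ... | inj₁ p = inj₁ p
  ... | inj₂ p with cmp y x
  ...   | inj₁ q = inj₂ (inj₂ q)
  ...   | inj₂ q = inj₂ (inj₁ (antisym q p))

op : Order → Order
op O = record
  { _⊏_ = flip _⊏_ ; _⊑_ = flip _⊑_ ; S = flip S ; S? = flip S?
  ; ≤-refl = ≤-refl ; ≤-trans = flip ≤-trans ; <⇒≤ = <⇒≤
  ; <-≤-trans = flip ≤-<-trans ; ≤-<-trans = flip <-≤-trans
  ; <-irr = <-irr ; antisym = flip antisym ; cmp = flip cmp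
  ; S⇒< = S⇒< ; S-up = S-down ; S-down = S-up ; up = down ; down = up }
  where open Order O

ℕ-order : Order
ℕ-order = record
  { _⊏_ = ℕ._<_ ; _⊑_ = ℕ._≤_ ; S = λ x y → y ≡ suc x ; S? = λ x y → y ℕₚ.≟ suc x
  ; ≤-refl = ℕₚ.≤-refl ; ≤-trans = ℕₚ.≤-trans ; <⇒≤ = ℕₚ.<⇒≤
  ; <-≤-trans = ℕₚ.<-≤-trans ; ≤-<-trans = ℕₚ.≤-<-trans
  ; <-irr = ℕₚ.<-irrefl refl ; antisym = ℕₚ.≤-antisym ; cmp = λ x y → ℕₚ.<-≤-connex x y
  ; S⇒< = λ { refl → ℕₚ.≤-refl } ; S-up = λ { refl p → p } ; S-down = λ { refl p → ℕₚ.≤-pred p }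
  ; up = λ {x} p → suc x , refl , p
  ; down = λ { {x} {suc y} p → y , refl , ℕₚ.≤-pred p } }

-- A cell together with the box it is mapped to.
Entry : Set
Entry = Box × Box

cell box : Entry → Box
cell = proj₁
box = proj₂

-- A hole passing through the word of a picture

module Slides (O : Order) where
  open Order O

  _≼_ Asc Desc Adj : Box → Box → Set
  x ≼ y = row x ⊑ row y × col x ⊑ col y
  Asc x y = col x ⊏ col y × row y ⊑ row x
  Desc x y = row x ⊏ row y × col y ⊑ col x
  Adj h b = (row h ≡ row b × S (col h) (col b)) ⊎ (col h ≡ col b × S (row h) (row b))

  adj? : ∀ h b → Dec (Adj h b)
  adj? h b = (row h ℕₚ.≟ row b ×-dec S? (col h) (col b)) ⊎-dec (col h ℕₚ.≟ col b ×-dec S? (row h) (row b))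

  ≼-refl : ∀ {x} → x ≼ x
  ≼-refl = ≤-refl , ≤-refl

  Adj⇒≼ : ∀ {h b} → Adj h b → h ≼ b
  Adj⇒≼ (inj₁ (p , q)) = ≡⇒≤ p , <⇒≤ (S⇒< q)
  Adj⇒≼ (inj₂ (p , q)) = <⇒≤ (S⇒< q) , ≡⇒≤ p

  Asc-trans : ∀ {x y z} → Asc x y → Asc y z → Asc x z
  Asc-trans (a , b) (c , d) = <-trans a c , ≤-trans d b

  -- The relation of an earlier box `x` to a later box `y` of a standard filling. Since `≼` is
  -- reflexive, holding for all pairs of a list also excludes repeated boxes.
  _⋠_ : Box → Box → Set
  x ⋠ y = ¬ y ≼ x

  Convex : List Box → Set
  Convex w = ∀ {x y e} → x ∈ w → y ∈ w → x ≼ e → e ≼ y → e ∈ w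

  -- A contiguous piece of a standard filling, read in the order of its labels.
  Valid : List Box → Set
  Valid w = AllPairs _⋠_ w × Convex w

  -- The order in which rl reads cells.
  RL : Box → Box → Set
  RL x y = row x ⊏ row y ⊎ (row x ≡ row y × col y ⊏ col x)

  Ordered : Entry → Entry → Set
  Ordered e f = RL (cell e) (cell f) × (row (cell e) ≡ row (cell f) → Asc (box e) (box f))

  RL-irr : ∀ {x} → ¬ RL x x
  RL-irr (inj₁ p) = <-irr p
  RL-irr (inj₂ (_ , p)) = <-irr p

  RL-trans : ∀ {x y z} → RL x y → RL y z → RL x z
  RL-trans (inj₁ p) (inj₁ q) = inj₁ (<-trans p q)
  RL-trans (inj₁ p) (inj₂ (refl , _)) = inj₁ p
  RL-trans (inj₂ (refl , _)) (inj₁ q) = inj₁ q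
  RL-trans (inj₂ (refl , p)) (inj₂ (refl , q)) = inj₂ (refl , <-trans q p)

  RL-asym : ∀ {x y} → RL x y → ¬ RL y x
  RL-asym p q = RL-irr (RL-trans p q)

  Ordered-trans : ∀ {x y z} → Ordered x y → Ordered y z → Ordered x z
  Ordered-trans {x} {y} {z} (p , f) (q , g) = RL-trans p q , λ e → Asc-trans (f (h₁ p q e)) (g (trans (sym (h₁ p q e)) e))
    where
    h₁ : RL (cell x) (cell y) → RL (cell y) (cell z) → row (cell x) ≡ row (cell z) → row (cell x) ≡ row (cell y)
    h₁ (inj₁ a) (inj₁ b) e = ⊥-elim (<⇒≢ (<-trans a b) e)
    h₁ (inj₁ a) (inj₂ (b , _)) e = ⊥-elim (<⇒≢ a (trans e (sym b)))
    h₁ (inj₂ (a , _)) _ e = a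

  Below : Box → Box → Set
  Below z y = col z ≡ col y × S (row z) (row y)

  -- The list runs against the reading order because a `Run` keeps the entry processed last at its
  -- head.
  record RPic (w : List Entry) : Set where
    field
      ordered : AllPairs (flip Ordered) w
      convex : Convex (map cell w)
      desc : ∀ {e f} → e ∈ w → f ∈ w → Below (cell e) (cell f) → Desc (box e) (box f)

  ≼-above : ∀ {zs g r a} → Valid (zs ʳ++ (g ∷ r)) → a ∈ zs → ¬ g ≼ a
  ≼-above {zs} (v , _) i = proj₂ (proj₂ (AllPairs-ʳ++⁻ zs v)) i (here refl)

  interval : ∀ zs {g r y e} → Valid (zs ʳ++ (g ∷ r)) → y ∈ g ∷ r → g ≼ e → e ≼ y → e ∈ g ∷ r
  interval zs v@(_ , c) j p q with ∈-ʳ++⁻ zs (c (∈-ʳ++⁺ʳ zs (here refl)) (∈-ʳ++⁺ʳ zs j) p q)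
  ... | inj₁ k = ⊥-elim (≼-above {zs} v k p)
  ... | inj₂ k = k

  suffix-order : ∀ zs {r} → Valid (zs ʳ++ r) → AllPairs _⋠_ r
  suffix-order zs (v , _) = proj₁ (proj₂ (AllPairs-ʳ++⁻ zs v))

  -- The neighbour of `g` in the direction of `b` lies in the interval from `g` to `b`. By convexity
  -- it occurs in the word, neither before `g` nor after `b`, and nothing stands between the two; so
  -- it is `b`.
  consecutive : ∀ zs {g b r} → Valid (zs ʳ++ (g ∷ b ∷ r)) → g ≼ b → Adj g b
  consecutive zs {g} {b} {r} v (p , q) with cmp (row g) (row b)
  ... | inj₁ l with up l
  ...   | r' , s , t with interval zs {e = r' , col g} v (there (here refl)) (<⇒≤ (S⇒< s) , ≤-refl) (t , q)
  ...     | here e = ⊥-elim (<⇒≢ (S⇒< s) (sym (cong row e)))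
  ...     | there (here refl) = inj₂ (refl , s)
  ...     | there (there i) with suffix-order zs v
  ...       | _ ∷ (h ∷ _) = ⊥-elim (All.lookup h i (t , q))
  consecutive zs {g} {b} {r} v (p , q) | inj₂ l with antisym p l
  ... | refl with cmp (col g) (col b)
  ...   | inj₂ m with antisym q m
  ...     | refl with suffix-order zs v
  ...       | (h ∷ _) ∷ _ = ⊥-elim (h ≼-refl)
  consecutive zs {g} {b} {r} v (p , q) | inj₂ l | refl | inj₁ m with up m
  ... | c , s , t with interval zs {e = row g , c} v (there (here refl)) (≤-refl , <⇒≤ (S⇒< s)) (≤-refl , t)
  ...     | here e = ⊥-elim (<⇒≢ (S⇒< s) (sym (cong col e)))
  ...     | there (here refl) = inj₁ (refl , s)
  ...     | there (there i) with suffix-order zs v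
  ...       | _ ∷ (h ∷ _) = ⊥-elim (All.lookup h i (≤-refl , t))

  -- By `consecutive`, neighbours in the word that are not adjacent boxes are incomparable, so their
  -- order in the word is free.
  swap : ∀ zs {g b r} → Valid (zs ʳ++ (g ∷ b ∷ r)) → ¬ Adj g b → Valid (zs ʳ++ (b ∷ g ∷ r))
  swap zs {g} {b} {r} v@(a , c) na with AllPairs-ʳ++⁻ zs a
  ... | p , ((_ ∷ x) ∷ (y ∷ q)) , s = AllPairs-ʳ++⁺ zs p (((na ∘ consecutive zs v) ∷ y) ∷ (x ∷ q)) (λ i j → s i (tw j))
      , λ i j k l → tw' (c (tw' i) (tw' j) k l)
    where
    tw : ∀ {e x y r} → e ∈ x ∷ y ∷ r → e ∈ y ∷ x ∷ r
    tw (here p) = there (here p)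
    tw (there (here p)) = here p
    tw (there (there i)) = there (there i)
    tw' : ∀ {e x y r} → e ∈ zs ʳ++ (x ∷ y ∷ r) → e ∈ zs ʳ++ (y ∷ x ∷ r)
    tw' i with ∈-ʳ++⁻ zs i
    ... | inj₁ j = ∈-ʳ++⁺ˡ zs j
    ... | inj₂ j = ∈-ʳ++⁺ʳ zs (tw j)

  boxes : List Entry → List Box
  boxes = map box

  -- Run h w w′ g: a hole entering at h passes the entries of w (last processed entry first),
  -- changes them to w′ and leaves at g.
  data Run (h : Box) : List Entry → List Entry → Box → Set where
    start : Run h [] [] h
    keep : ∀ {w w' g c b} → Run h w w' g → ¬ Adj g b → Run h ((c , b) ∷ w) ((c , b) ∷ w') g
    move : ∀ {w w' g c b} → Run h w w' g → Adj g b → Run h ((c , b) ∷ w) ((c , g) ∷ w') b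

  Run-cells : ∀ {h w w' g} → Run h w w' g → map cell w' ≡ map cell w
  Run-cells start = refl
  Run-cells (keep R _) = cong (_ ∷_) (Run-cells R)
  Run-cells (move R _) = cong (_ ∷_) (Run-cells R)

  -- The hole counts as a box of the word. Passing a box exchanges the two; when an entry moves, the
  -- sequence of positions stays the same and only the role of the hole goes to the next one.
  Run-valid : ∀ {h w w' g} rp r → Run h w w' g → Valid (rp ʳ++ (h ∷ (boxes w ʳ++ r))) → Valid ((boxes w' ++ rp) ʳ++ (g ∷ r))
  Run-valid rp r start v = v
  Run-valid rp r (keep {w' = w'} R na) v = swap (boxes w' ++ rp) (Run-valid rp _ R v) na
  Run-valid rp r (move R _) v = Run-valid rp _ R v

  module _ {h : Box} (rp q : List Box) where

    -- Neighbours in the reading order suffice, as `Ordered` is transitive. If one or both of their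
    -- boxes move, `Asc` can fail only if the hole had passed an adjacent box or if a corner of a
    -- small rectangle of boxes were missing from the word.
    Ordered-step : ∀ {w w' g} r → Run h w w' g → Valid (rp ʳ++ (h ∷ (boxes w ʳ++ r))) →
      Linked (flip Ordered) w → Linked (flip Ordered) w'
    Ordered-step r start v l = []
    Ordered-step r (keep start na) v l = [-]
    Ordered-step r (move start na) v l = [-]
    Ordered-step r (keep R@(keep _ _) na) v ((p , f) ∷ l) = (p , f) ∷ Ordered-step _ R v l
    Ordered-step r (move {g = g} {b = b} R@(keep {w' = w'} {b = b₁} R₀ nb) ad) v ((p , f) ∷ l) = (p , λ e → k ad (f e)) ∷ Ordered-step _ R v l
      where
      k : Adj g b → Asc b₁ b → Asc b₁ g
      k (inj₂ (refl , s)) (x , y) = x , <⇒≤ (<-≤-trans (S⇒< s) y)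
      k (inj₁ (refl , s)) (x , y) with cmp (col b₁) (col g)
      ... | inj₁ m = m , y
      -- Otherwise `g ≼ b₁`; the hole stood directly before `b₁` in the word, so the two were
      -- adjacent and `b₁` would have moved.
      ... | inj₂ m = ⊥-elim (nb (consecutive (boxes w' ++ rp) (Run-valid rp _ R₀ v) (y , m)))
    Ordered-step r (keep {b = b} R@(move {w' = w'} {g = g₀} {b = b₁} R₀ ad) na) v ((p , f) ∷ l) = (p , λ e → k ad (f e)) ∷ Ordered-step _ R v l
      where
      k : Adj g₀ b₁ → Asc b₁ b → Asc g₀ b
      k (inj₁ (refl , s)) (x , y) = <-trans (S⇒< s) x , y
      k (inj₂ (refl , s)) (x , y) with cmp (row g₀) (row b)
      ... | inj₂ m = x , m
      -- The box in the row of `g₀` and the column of `b` lies between `g₀` and `b`, so it occurs in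
      -- the word. It is none of `g₀`, `b₁`, `b`, and being `≼ b` it cannot come after `b`.
      ... | inj₁ m with interval (boxes w' ++ rp) {e = row g₀ , col b} (Run-valid rp _ R₀ v) (there (there (here refl))) (≤-refl , <⇒≤ x) (<⇒≤ m , ≤-refl)
      ...   | here i = ⊥-elim (<⇒≢ x (sym (cong col i)))
      ...   | there (here i) = ⊥-elim (<⇒≢ x (sym (cong col i)))
      ...   | there (there (here i)) = ⊥-elim (<⇒≢ m (cong row i))
      ...   | there (there (there i)) with suffix-order (boxes w' ++ rp) (Run-valid rp _ R₀ v)
      ...     | _ ∷ (_ ∷ (z ∷ _)) = ⊥-elim (All.lookup z i (<⇒≤ m , ≤-refl))
    Ordered-step r (move {b = b} R@(move {w' = w'} {g = g₀} {b = b₁} R₀ ad) ad') v ((p , f) ∷ l) = (p , λ e → k ad ad' (f e)) ∷ Ordered-step _ R v l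
      where
      k : Adj g₀ b₁ → Adj b₁ b → Asc b₁ b → Asc g₀ b₁
      k (inj₁ (refl , s)) _ (x , y) = S⇒< s , ≤-refl
      k (inj₂ (refl , s)) (inj₂ (refl , _)) (x , y) = ⊥-elim (<-irr x)
      k (inj₂ (refl , s)) (inj₁ (refl , _)) (x , y) with interval (boxes w' ++ rp) {e = row g₀ , col b} (Run-valid rp _ R₀ v) (there (there (here refl))) (≤-refl , <⇒≤ x) (<⇒≤ (S⇒< s) , ≤-refl)
      ...   | here i = ⊥-elim (<⇒≢ x (sym (cong col i)))
      ...   | there (here i) = ⊥-elim (<⇒≢ x (sym (cong col i)))
      ...   | there (there (here i)) = ⊥-elim (<⇒≢ (S⇒< s) (cong row i))
      ...   | there (there (there i)) with suffix-order (boxes w' ++ rp) (Run-valid rp _ R₀ v)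
      ...     | _ ∷ (_ ∷ (z ∷ _)) = ⊥-elim (All.lookup z i (<⇒≤ (S⇒< s) , ≤-refl))

    -- The whole picture in reading order with its boxes from before the run. It is used at
    -- `w ʳ++ w₁`, where the hole has passed the entries of `w` and those of `w₁` are still ahead.
    record Stage (W : List Entry) : Set where
      field
        ordered : AllPairs Ordered (W)
        convex : ∀ {x y c} → x ∈ W → y ∈ W → cell x ≼ c → c ≼ cell y → ∃[ b ] (c , b) ∈ W
        desc : ∀ {e f} → e ∈ W → f ∈ W → Below (cell e) (cell f) → Desc (box e) (box f)

      same-cell : ∀ {c b b'} → (c , b) ∈ W → (c , b') ∈ W → b ≡ b'
      same-cell i j with AllPairs-compare ordered i j
      ... | inj₁ refl = refl
      ... | inj₂ (inj₁ (p , _)) = ⊥-elim (RL-irr p)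
      ... | inj₂ (inj₂ (p , _)) = ⊥-elim (RL-irr p)

      sorted : ∀ {e f} → e ∈ W → f ∈ W → RL (cell e) (cell f) → Ordered e f
      sorted i j p with AllPairs-compare ordered i j
      ... | inj₁ refl = ⊥-elim (RL-irr p)
      ... | inj₂ (inj₁ k) = k
      ... | inj₂ (inj₂ (k , _)) = ⊥-elim (RL-asym p k)

      asc : ∀ {e f} → e ∈ W → f ∈ W → row (cell e) ≡ row (cell f) → col (cell f) ⊏ col (cell e) → Asc (box e) (box f)
      asc i j p l = proj₂ (sorted i j (inj₂ (p , l))) p

    later : ∀ {w e w₁ f} → Stage (w ʳ++ (e ∷ w₁)) → f ∈ w ʳ++ (e ∷ w₁) → RL (cell e) (cell f) → f ∈ w₁
    later {w} {e} {w₁} st i p with ∈-ʳ++⁻ w i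
    ... | inj₂ (here refl) = ⊥-elim (RL-irr p)
    ... | inj₂ (there j) = j
    ... | inj₁ j = ⊥-elim (RL-asym p (proj₁ (proj₂ (proj₂ (AllPairs-ʳ++⁻ w (Stage.ordered st))) j (here refl))))

    earlier : ∀ {w e w₁ f} → Stage (w ʳ++ (e ∷ w₁)) → f ∈ w ʳ++ (e ∷ w₁) → RL (cell f) (cell e) → f ∈ w
    earlier {w} {e} {w₁} st i p with ∈-ʳ++⁻ w i
    ... | inj₁ j = j
    ... | inj₂ (here refl) = ⊥-elim (RL-irr p)
    ... | inj₂ (there j) with proj₁ (proj₂ (AllPairs-ʳ++⁻ w (Stage.ordered st)))
    ...   | x ∷ _ = ⊥-elim (RL-asym p (proj₁ (All.lookup x j)))

    -- A processed box lies strictly above, and weakly right of, the old box of the cell below it: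
    -- a violation would need the cells to the right of both to be a violation already.
    mid : ∀ {w w' g} w₁ → Run h w w' g → Stage (w ʳ++ w₁) → Valid (rp ʳ++ (h ∷ (boxes w ʳ++ (boxes w₁ ++ q)))) →
      ∀ {z b' y d} → (z , b') ∈ w' → (y , d) ∈ w ʳ++ w₁ → Below z y → Desc b' d
    mid w₁ (keep {w = w} R na) st v (here refl) j bl = Stage.desc st (∈-ʳ++⁺ʳ w (here refl)) j bl
    mid w₁ (keep R na) st v (there i) j bl = mid (_ ∷ w₁) R st v i j bl
    mid w₁ (move R ad) st v (there i) j bl = mid (_ ∷ w₁) R st v i j bl
    mid w₁ (move {w = w} {w' = w'} {g = g} {c = z} {b = b} R ad) st v {y = y} {d = d} (here refl) j (cz , sz) = go ad (desc (∈-ʳ++⁺ʳ w (here refl)) j (cz , sz))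
      where
      open Stage st
      ih : ∀ {z₁ b'} → (z₁ , b') ∈ w' → ∀ {y d} → (y , d) ∈ w ʳ++ ((z , b) ∷ w₁) → Below z₁ y → Desc b' d
      ih i = mid ((z , b) ∷ w₁) R st v i
      v₁ : Valid ((boxes w' ++ rp) ʳ++ (g ∷ b ∷ (boxes w₁ ++ q)))
      v₁ = Run-valid rp _ R v
      j₁ : (y , d) ∈ w₁
      j₁ = later {w} st j (inj₁ (S⇒< sz))
      go : Adj g b → Desc b d → Desc g d
      go (inj₂ (refl , s)) (x , k) = <-trans (S⇒< s) x , k
      go (inj₁ (refl , s)) (x , k) with cmp (col g) (col d)
      ... | inj₂ m = x , m
      -- Now `g` and `b` are horizontal neighbours and `d` lies in the column of `b`. The box `e`
      -- next to `g` in its column lies between `g` and `d`, hence belongs to the word; the rest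
      -- hunts down its cell `ce`.
      ... | inj₁ m with up x
      ...   | r₁ , s₁ , t₁ = ⊥-elim (contra (interval (boxes w' ++ rp) {e = e} v₁ (there (there (∈-++⁺ˡ (∈-map⁺ box j₁)))) (<⇒≤ (S⇒< s₁) , ≤-refl) (t₁ , <⇒≤ m)))
        where
        e = r₁ , col g
        cd : col d ≡ col b
        cd = antisym k (S-up s m)
        contra : ¬ e ∈ g ∷ b ∷ (boxes w₁ ++ q)
        contra (here i) = <⇒≢ (S⇒< s₁) (sym (cong row i))
        contra (there (here i)) = <⇒≢ (S⇒< s₁) (sym (cong row i))
        contra (there (there i)) with ∈-++⁻ (boxes w₁) i
        ... | inj₂ i₂ with suffix-order (boxes w' ++ rp) v₁
        ...   | _ ∷ (_ ∷ a) = AllPairs-cross (boxes w₁) a (∈-map⁺ box j₁) i₂ (t₁ , <⇒≤ m)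
        contra (there (there i)) | inj₁ i₁ with ∈-map⁻ box i₁
        ... | (ce , _) , i₂ , refl = in-row
          where
          i₃ : (ce , e) ∈ w ʳ++ ((z , b) ∷ w₁)
          i₃ = ∈-ʳ++⁺ʳ w (there i₂)
          before : ∀ {xs} → AllPairs Ordered xs → AllPairs _⋠_ (boxes xs ++ q) → (ce , e) ∈ xs → (y , d) ∈ xs → RL ce y
          before (r ∷ _) (_ ∷ _) (here refl) (here refl) = ⊥-elim (<-irr m)
          before (r ∷ _) _ (here refl) (there l) = proj₁ (All.lookup r l)
          before _ (r ∷ _) (there l) (here refl) = ⊥-elim (All.lookup r (∈-++⁺ˡ (∈-map⁺ box l)) (t₁ , <⇒≤ m))
          before (_ ∷ p) (_ ∷ p') (there l) (there l') = before p p' l l'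
          ce-y : RL ce y
          ce-y with proj₁ (proj₂ (AllPairs-ʳ++⁻ w ordered)) | suffix-order (boxes w' ++ rp) v₁
          ... | _ ∷ p | _ ∷ (_ ∷ p') = before p p' i₂ j₁
          z-ce : Ordered (z , b) (ce , e)
          z-ce with proj₁ (proj₂ (AllPairs-ʳ++⁻ w ordered))
          ... | p ∷ _ = All.lookup p i₂
          in-row : ⊥
          in-row with z-ce
          ... | inj₂ (p , _) , f = <-irr (<-trans (proj₁ (f p)) (S⇒< s))
          ... | inj₁ p , _ with ce-y
          ...   | inj₁ p' = <⇒≱ p' (S-up sz p)
          ...   | inj₂ (refl , l) with up l
          -- The cell `ce` has turned out to lie in the row of `y`, beyond `y`. Convexity then
          -- supplies the cell next to `y` in this row and the cell `z₁` next to `z` above it.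
          ...     | c₁ , sc , tc with convex j i₃ (≤-refl , <⇒≤ (S⇒< sc)) (≤-refl , tc)
          ...       | d₁ , jd with convex (∈-ʳ++⁺ʳ w (here refl)) jd (≤-refl , ≤-trans (≡⇒≤ cz) (<⇒≤ (S⇒< sc))) (<⇒≤ (S⇒< sz) , ≤-refl)
          ...         | b₁ , jb = last-step R st v (λ i → ih i jd (refl , sz)) (earlier {w} st jb z₁-z)
            where
            z₁ = row z , c₁
            z₁-z : RL z₁ z
            z₁-z = inj₂ (refl , ≤-<-trans (≡⇒≤ cz) (S⇒< sc))
            asc-d : Asc d₁ d
            asc-d = asc jd j refl (S⇒< sc)
            cd₁ : col d₁ ⊑ col g
            cd₁ = S-down s (<-≤-trans (proj₁ asc-d) (≡⇒≤ cd))
            e≡d₁ : e ≡ d₁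
            e≡d₁ with cmp₃ c₁ (col ce)
            ... | inj₁ l' = ⊥-elim (<-irr (<-≤-trans (proj₁ (asc i₃ jd refl l')) cd₁))
            ... | inj₂ (inj₁ refl) = same-cell i₃ jd
            ... | inj₂ (inj₂ l') = ⊥-elim (<⇒≱ l' tc)
            -- (i) against `b` and (ii) against `d₁` leave a single place for the old box of `z₁`:
            -- the current position of the hole.
            b₁≡g : b₁ ≡ g
            b₁≡g with desc jb jd (refl , sz) | asc jb (∈-ʳ++⁺ʳ w (here refl)) refl (≤-<-trans (≡⇒≤ cz) (S⇒< sc))
            ... | x₁ , x₂ | x₃ , x₄ = cong₂ _,_ (antisym (S-down s₁ (subst (row b₁ ⊏_) (sym (cong row e≡d₁)) x₁)) x₄)
                                      (antisym (S-down s x₃) (≤-trans (≡⇒≤ (cong col e≡d₁)) x₂))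
            -- z₁ is the entry processed immediately before z.
            last-step : ∀ {w₀ w₀'} → Run h w₀ w₀' g → Stage (w₀ ʳ++ ((z , b) ∷ w₁)) →
              Valid (rp ʳ++ (h ∷ (boxes w₀ ʳ++ (b ∷ (boxes w₁ ++ q))))) →
              (∀ {b'} → (z₁ , b') ∈ w₀' → Desc b' d₁) → (z₁ , b₁) ∈ w₀ → ⊥
            last-step {x ∷ w₀} R st v _ (there i) = gap (proj₁ (proj₁ st')) (proj₁ (proj₂ st'))
              where
              st' : Ordered (z₁ , b₁) x × Ordered x (z , b)
              st' with AllPairs-ʳ++⁻ (x ∷ w₀) (Stage.ordered st)
              ... | (p ∷ _) , _ , f = All.lookup p i , f (here refl) (here refl)
              gap : RL z₁ (cell x) → RL (cell x) z → ⊥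
              gap (inj₁ p) (inj₁ p') = <-irr (<-trans p p')
              gap (inj₁ p) (inj₂ (refl , _)) = <-irr p
              gap (inj₂ (refl , _)) (inj₁ p') = <-irr p'
              gap (inj₂ (refl , k₁)) (inj₂ (_ , k₂)) = <⇒≱ k₁ (S-up sc (≤-<-trans (≡⇒≤ (sym cz)) k₂))
            -- If the hole passed `z₁` without moving it, the box of `z₁` and the hole would
            -- coincide.
            last-step R₁@(keep {w' = w''} R₀ na) st v _ (here refl) = ≼-above {(b₁ ∷ boxes w'') ++ rp} {g} (Run-valid rp _ R₁ v) (here refl) (subst (g ≼_) (sym b₁≡g) ≼-refl)
            last-step (move {w = w₀} {w' = w''} {g = g₀} R₀ ad₀) st v ih₀ (here refl) = side (subst (Adj g₀) b₁≡g ad₀)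
              where
              v₂ : Valid ((boxes w'' ++ rp) ʳ++ (g₀ ∷ b₁ ∷ b ∷ (boxes w₁ ++ q)))
              v₂ = Run-valid rp _ R₀ v
              side : Adj g₀ g → ⊥
              -- A horizontal move of `z₁` contradicts the induction hypothesis for `z₁` and the
              -- cell below it. After a vertical move, the box in the row of `g₀` and the column of
              -- `b` would have to be in the word, where there is no place for it.
              side (inj₁ (_ , s₀)) = <⇒≱ (S⇒< s₀) (≤-trans (≡⇒≤ (cong col e≡d₁)) (proj₂ (ih₀ (here refl))))
              side (inj₂ (refl , s₀)) with interval (boxes w'' ++ rp) {e = row g₀ , col b} v₂ (there (there (here refl))) (≤-refl , <⇒≤ (S⇒< s)) (<⇒≤ (S⇒< s₀) , ≤-refl)
              ... | here i = ⊥-elim (<⇒≢ (S⇒< s) (sym (cong col i)))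
              ... | there (here i) = ⊥-elim (<⇒≢ (S⇒< s) (sym (trans (cong col i) (cong col b₁≡g))))
              ... | there (there (here i)) = ⊥-elim (<⇒≢ (S⇒< s₀) (cong row i))
              ... | there (there (there i)) with suffix-order (boxes w'' ++ rp) v₂
              ...   | _ ∷ (_ ∷ (u ∷ _)) = ⊥-elim (All.lookup u i (<⇒≤ (S⇒< s₀) , ≤-refl))

    below-later : ∀ w {w' g e f w₁} → Run h w w' g → Stage (w ʳ++ (e ∷ w₁)) → f ∈ w' → ¬ row (cell e) ⊏ row (cell f)
    below-later w R st j l with ∈-map⁻ cell (subst (_ ∈_) (Run-cells R) (∈-map⁺ cell j))
    ... | f' , i , refl = RL-asym (inj₁ l) (proj₁ (proj₂ (proj₂ (AllPairs-ʳ++⁻ w (Stage.ordered st))) i (here refl)))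

    -- `mid` compares the new upper box with the old lower one. If the lower entry then moves in its
    -- column, the comparison of rows can fail only with the hole `≼` the upper box, which precedes
    -- the hole in the word.
    desc-step : ∀ {w w' g} w₁ → Run h w w' g → Stage (w ʳ++ w₁) → Valid (rp ʳ++ (h ∷ (boxes w ʳ++ (boxes w₁ ++ q)))) →
      ∀ {e f} → e ∈ w' → f ∈ w' → Below (cell e) (cell f) → Desc (box e) (box f)
    desc-step w₁ (keep R na) st v (there i) (there j) bl = desc-step (_ ∷ w₁) R st v i j bl
    desc-step w₁ (move R ad) st v (there i) (there j) bl = desc-step (_ ∷ w₁) R st v i j bl
    desc-step w₁ (keep R na) st v (here refl) (here refl) (_ , s) = ⊥-elim (<-irr (S⇒< s))
    desc-step w₁ (move R ad) st v (here refl) (here refl) (_ , s) = ⊥-elim (<-irr (S⇒< s))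
    desc-step w₁ (keep {w = w} R na) st v (there i) (here refl) bl = mid (_ ∷ w₁) R st v i (∈-ʳ++⁺ʳ w (here refl)) bl
    desc-step w₁ (move {w = w} {w' = w'} {g = g} {b = b} R ad) st v {e = _ , b'} (there i) (here refl) bl = go ad (mid (_ ∷ w₁) R st v i (∈-ʳ++⁺ʳ w (here refl)) bl)
      where
      go : Adj g b → Desc b' b → Desc b' g
      go (inj₁ (refl , s)) (x , y) = x , ≤-trans (<⇒≤ (S⇒< s)) y
      go (inj₂ (refl , s)) (x , y) with cmp (row b') (row g)
      ... | inj₁ m = m , y
      ... | inj₂ m = ⊥-elim (≼-above {boxes w' ++ rp} (Run-valid rp _ R v) (∈-++⁺ˡ (∈-map⁺ box i)) (m , y))
    desc-step w₁ (keep {w = w} R na) st v (here refl) (there j) (_ , s) = ⊥-elim (below-later w R st j (S⇒< s))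
    desc-step w₁ (move {w = w} R ad) st v (here refl) (there j) (_ , s) = ⊥-elim (below-later w R st j (S⇒< s))

    stage : ∀ {w} → RPic w → Stage (w ʳ++ [])
    stage {w} P = record
      { ordered = AllPairs-ʳ++⁺ w (RPic.ordered P) [] λ _ ()
      ; convex = λ {x} {y} i j p p' → find (∈-map⁻ cell (RPic.convex P (∈-map⁺ cell (back i)) (∈-map⁺ cell (back j)) p p'))
      ; desc = λ i j → RPic.desc P (back i) (back j) }
      where
      back : ∀ {x} → x ∈ w ʳ++ [] → x ∈ w
      back i with ∈-ʳ++⁻ w i
      ... | inj₁ j = j
      find : ∀ {c} → ∃[ x ] (x ∈ w × c ≡ cell x) → ∃[ b ] (c , b) ∈ w ʳ++ []
      find ((_ , b) , i , refl) = b , ∈-ʳ++⁺ˡ w i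

    RPic-mid : ∀ {w w' g} → Run h w w' g → RPic w → Valid (rp ʳ++ (h ∷ (boxes w ʳ++ q))) →
      ∀ {z b' y d} → (z , b') ∈ w' → (y , d) ∈ w → Below z y → Desc b' d
    RPic-mid {w} R P v i j = mid [] R (stage P) v i (∈-ʳ++⁺ˡ w j)

    RPic-step : ∀ {w w' g} → Run h w w' g → RPic w → Valid (rp ʳ++ (h ∷ (boxes w ʳ++ q))) → RPic w'
    RPic-step {w} {w'} R P v = record
      { ordered = ordered'
      ; convex = subst Convex (sym (Run-cells R)) (RPic.convex P)
      ; desc = desc-step [] R (stage P) v }
      where
      ordered' : AllPairs (flip Ordered) w'
      ordered' = Linkedₚ.Linked⇒AllPairs (λ {x} {y} {z} p p' → Ordered-trans {z} {y} {x} p' p)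
                   (Ordered-step _ R v (Linkedₚ.AllPairs⇒Linked (RPic.ordered P)))

-- Slides and reverse slides of pictures

module Fwd = Slides ℕ-order
module Bwd = Slides (op ℕ-order)
open Fwd using (_≼_; _⋠_; Adj; adj?; Asc; Desc; RL; Ordered; Below; Valid; boxes; Convex)

-- Its two readings are `Bwd.RPic` of the list itself and `Fwd.RPic` of the reversed list. They
-- agree because the half-turn exchanges the arguments of `Asc`, `Desc`, `Below` and `RL`.
record Pic (w : List Entry) : Set where
  field
    ordered : AllPairs Ordered w
    convex : Convex (map cell w)
    desc : ∀ {e f} → e ∈ w → f ∈ w → Below (cell e) (cell f) → Desc (box e) (box f)

reverse-AllPairs : {A : Set} {R : A → A → Set} {xs : List A} → AllPairs R xs → AllPairs (flip R) (xs ʳ++ [])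
reverse-AllPairs {xs = xs} p = AllPairs-ʳ++⁺ xs p [] λ _ ()

∈-reverse⁻ : {A : Set} (xs : List A) {x : A} → x ∈ xs ʳ++ [] → x ∈ xs
∈-reverse⁻ xs i with ∈-ʳ++⁻ xs i
... | inj₁ j = j

∈-cells-reverse⁻ : ∀ w {x} → x ∈ map cell (w ʳ++ []) → x ∈ map cell w
∈-cells-reverse⁻ w i = ∈-reverse⁻ (map cell w) (subst (_ ∈_) (Listₚ.map-ʳ++ cell w) i)

∈-cells-reverse⁺ : ∀ w {x} → x ∈ map cell w → x ∈ map cell (w ʳ++ [])
∈-cells-reverse⁺ w i = subst (_ ∈_) (sym (Listₚ.map-ʳ++ cell w)) (∈-ʳ++⁺ˡ (map cell w) i)

reverse-reverse : {A : Set} (xs : List A) → (xs ʳ++ []) ʳ++ [] ≡ xs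
reverse-reverse xs = trans (Listₚ.ʳ++-ʳ++ xs) (Listₚ.++-identityʳ xs)

RL-op : ∀ {x y} → RL x y → Bwd.RL y x
RL-op (inj₁ p) = inj₁ p
RL-op (inj₂ (p , q)) = inj₂ (sym p , q)

RL-op⁻ : ∀ {x y} → Bwd.RL y x → RL x y
RL-op⁻ (inj₁ p) = inj₁ p
RL-op⁻ (inj₂ (p , q)) = inj₂ (sym p , q)

Pic⇒Bwd : ∀ {w} → Pic w → Bwd.RPic w
Pic⇒Bwd P = record
  { ordered = AllPairs.map (λ (p , f) → RL-op p , f ∘ sym) (Pic.ordered P)
  ; convex = λ i j p q → Pic.convex P j i q p
  ; desc = λ i j (p , q) → Pic.desc P j i (sym p , q) }

Bwd⇒Pic : ∀ {w} → Bwd.RPic w → Pic w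
Bwd⇒Pic P = record
  { ordered = AllPairs.map (λ (p , f) → RL-op⁻ p , f ∘ sym) (Bwd.RPic.ordered P)
  ; convex = λ i j p q → Bwd.RPic.convex P j i q p
  ; desc = λ i j (p , q) → Bwd.RPic.desc P j i (sym p , q) }

Pic⇒Fwd : ∀ {w} → Pic w → Fwd.RPic (w ʳ++ [])
Pic⇒Fwd {w} P = record
  { ordered = reverse-AllPairs (Pic.ordered P)
  ; convex = λ i j p q → ∈-cells-reverse⁺ w (Pic.convex P (∈-cells-reverse⁻ w i) (∈-cells-reverse⁻ w j) p q)
  ; desc = λ i j → Pic.desc P (∈-reverse⁻ w i) (∈-reverse⁻ w j) }

Fwd⇒Pic : ∀ {w} → Fwd.RPic (w ʳ++ []) → Pic w
Fwd⇒Pic {w} P = record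
  { ordered = subst (AllPairs Ordered) (reverse-reverse w) (reverse-AllPairs (Fwd.RPic.ordered P))
  ; convex = λ i j p q → ∈-cells-reverse⁻ w (Fwd.RPic.convex P (∈-cells-reverse⁺ w i) (∈-cells-reverse⁺ w j) p q)
  ; desc = λ i j → Fwd.RPic.desc P (∈-ʳ++⁺ˡ w i) (∈-ʳ++⁺ˡ w j) }

-- The same run as Fwd.Run, with the entries in reading order.
data Pass : Box → List Entry → List Entry → Box → Set where
  done : ∀ {h} → Pass h [] [] h
  hop : ∀ {h c b w w' g} → Adj h b → Pass b w w' g → Pass h ((c , b) ∷ w) ((c , h) ∷ w') g
  skip : ∀ {h c b w w' g} → ¬ Adj h b → Pass h w w' g → Pass h ((c , b) ∷ w) ((c , b) ∷ w') g

pass : Box → List Entry → List Entry × Box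
pass h [] = [] , h
pass h ((c , b) ∷ w) with adj? h b
... | yes _ = (c , h) ∷ proj₁ (pass b w) , proj₂ (pass b w)
... | no _ = (c , b) ∷ proj₁ (pass h w) , proj₂ (pass h w)

pass-Pass : ∀ h w → Pass h w (proj₁ (pass h w)) (proj₂ (pass h w))
pass-Pass h [] = done
pass-Pass h ((c , b) ∷ w) with adj? h b
... | yes a = hop a (pass-Pass b w)
... | no a = skip a (pass-Pass h w)

Pass-pass : ∀ {h w w' g} → Pass h w w' g → pass h w ≡ (w' , g)
Pass-pass done = refl
Pass-pass {h} (hop {b = b} a P) with adj? h b
... | yes _ rewrite Pass-pass P = refl
... | no na = ⊥-elim (na a)
Pass-pass {h} (skip {b = b} na P) with adj? h b
... | yes a = ⊥-elim (na a)
... | no _ rewrite Pass-pass P = refl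

pull : Box → Box → Box × List Entry → Box × List Entry
pull c b (g , t) with Bwd.adj? g b
... | yes _ = b , (c , g) ∷ t
... | no _ = g , (c , b) ∷ t

rpass : List Entry → Box → Box × List Entry
rpass [] v = v , []
rpass ((c , b) ∷ t) v = pull c b (rpass t v)

rpass-Run : ∀ t v → Bwd.Run v t (proj₂ (rpass t v)) (proj₁ (rpass t v))
rpass-Run [] v = Bwd.start
rpass-Run ((c , b) ∷ t) v with rpass t v | rpass-Run t v
... | g , t' | R with Bwd.adj? g b
...   | yes a = Bwd.move R a
...   | no a = Bwd.keep R a

Run-rpass : ∀ {t v t' g} → Bwd.Run v t t' g → rpass t v ≡ (g , t')
Run-rpass Bwd.start = refl
Run-rpass (Bwd.keep {g = g} {c = c} {b = b} R na) = trans (cong (pull c b) (Run-rpass R)) h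
  where
  h : pull c b (g , _) ≡ (g , _)
  h with Bwd.adj? g b
  ... | yes a = ⊥-elim (na a)
  ... | no _ = refl
Run-rpass (Bwd.move {g = g} {c = c} {b = b} R a) = trans (cong (pull c b) (Run-rpass R)) h
  where
  h : pull c b (g , _) ≡ (b , _)
  h with Bwd.adj? g b
  ... | yes _ = refl
  ... | no na = ⊥-elim (na a)

Adj-op : ∀ {x y} → Adj x y → Bwd.Adj y x
Adj-op (inj₁ (p , q)) = inj₁ (sym p , q)
Adj-op (inj₂ (p , q)) = inj₂ (sym p , q)

Adj-op⁻ : ∀ {x y} → Bwd.Adj y x → Adj x y
Adj-op⁻ (inj₁ (p , q)) = inj₁ (sym p , q)
Adj-op⁻ (inj₂ (p , q)) = inj₂ (sym p , q)

-- The reverse hole retraces the path. A box skipped on the way stands after the hole in the word,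
-- so it is not weakly north-west of the hole and cannot fill it on the way back.
Pass⇒Run : ∀ {h w w' g} → Pass h w w' g → AllPairs _⋠_ (h ∷ boxes w) → Bwd.Run g w' w h
Pass⇒Run done _ = Bwd.start
Pass⇒Run (hop a P) (_ ∷ p) = Bwd.move (Pass⇒Run P p) (Adj-op a)
Pass⇒Run (skip na P) ((x ∷ xs) ∷ (_ ∷ p)) = Bwd.keep (Pass⇒Run P (xs ∷ p)) (x ∘ Fwd.Adj⇒≼ ∘ Adj-op⁻)

Run-hole : ∀ {g t t' h} → Bwd.Run g t t' h → h ∈ boxes t ++ (g ∷ [])
Run-hole Bwd.start = here refl
Run-hole (Bwd.keep R _) = there (Run-hole R)
Run-hole (Bwd.move R _) = here refl

Run⇒Pass : ∀ {h w w' g} → Bwd.Run g w' w h → AllPairs _⋠_ (boxes w' ++ (g ∷ [])) → Pass h w w' g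
Run⇒Pass Bwd.start _ = done
Run⇒Pass (Bwd.move R a) (x ∷ p) = hop (Adj-op⁻ a) (Run⇒Pass R p)
Run⇒Pass (Bwd.keep R na) (x ∷ p) = skip (All.lookup x (Run-hole R) ∘ Fwd.Adj⇒≼) (Run⇒Pass R p)

Pass-valid : ∀ rp {h w w' g r} → Pass h w w' g → Valid (rp ʳ++ (h ∷ (boxes w ++ r))) → Valid (rp ʳ++ (boxes w' ++ (g ∷ r)))
Pass-valid rp done v = v
Pass-valid rp (hop {h} a P) v = Pass-valid (h ∷ rp) P v
Pass-valid rp (skip {b = b} na P) v = Pass-valid (b ∷ rp) P (Fwd.swap rp v na)

Pass-↭ : ∀ {h w w' g} → Pass h w w' g → h ∷ boxes w ↭ boxes w' ++ (g ∷ [])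
Pass-↭ done = ↭-refl
Pass-↭ (hop a P) = ↭-prep _ (Pass-↭ P)
Pass-↭ (skip na P) = ↭-trans (↭-swap _ _ ↭-refl) (↭-prep _ (Pass-↭ P))

Pass⇒Fwd : ∀ {h₀ h w w' g a a'} → Pass h w w' g → Fwd.Run h₀ a a' h → Fwd.Run h₀ (w ʳ++ a) (w' ʳ++ a') g
Pass⇒Fwd done R = R
Pass⇒Fwd (hop a P) R = Pass⇒Fwd P (Fwd.move R a)
Pass⇒Fwd (skip na P) R = Pass⇒Fwd P (Fwd.keep R na)

Pass-Pic : ∀ rp {h w w' g r} → Pass h w w' g → Pic w → Valid (rp ʳ++ (h ∷ (boxes w ++ r))) → Pic w'
Pass-Pic rp {h} {w} {w'} {r = r} P p v = Fwd⇒Pic {w'} (Fwd.RPic-step rp r (Pass⇒Fwd P Fwd.start) (Pic⇒Fwd p)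
  (subst (λ x → Valid (rp ʳ++ (h ∷ x))) eq v))
  where
  eq : boxes w ++ r ≡ boxes (w ʳ++ []) ʳ++ r
  eq = sym (trans (cong (_ʳ++ r) (Listₚ.map-ʳ++ box w)) (Listₚ.ʳ++-ʳ++ (boxes w)))

Valid-op : ∀ rp xs {g q} → Valid (rp ʳ++ (xs ++ (g ∷ q))) → Bwd.Valid (q ʳ++ (g ∷ (xs ʳ++ rp)))
Valid-op rp xs {g} {q} (a , c) = subst Bwd.Valid eq (reverse-AllPairs a , λ i j p q → ∈-ʳ++⁺ˡ W (c (∈-reverse⁻ W j) (∈-reverse⁻ W i) q p))
  where
  W = rp ʳ++ (xs ++ (g ∷ q))
  eq : W ʳ++ [] ≡ q ʳ++ (g ∷ (xs ʳ++ rp))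
  eq = trans (Listₚ.ʳ++-ʳ++ rp) (trans (Listₚ.++-ʳ++ xs) (cong (λ y → q ʳ++ (g ∷ (xs ʳ++ y))) (Listₚ.++-identityʳ rp)))

Run-Pic : ∀ rp {g w w' h q} → Bwd.Run g w w' h → Pic w → Valid (rp ʳ++ (boxes w ++ (g ∷ q))) → Pic w'
Run-Pic rp {w = w} {q = q} R p v = Bwd⇒Pic (Bwd.RPic-step q rp R (Pic⇒Bwd p) (Valid-op rp (boxes w) v))

-- Infusion

infuse : List Entry → List Entry → List Entry × List Entry
infuse [] t₂ = t₂ , []
infuse ((c , e) ∷ t₁) t₂ with infuse t₁ t₂
... | s , u = proj₁ (pass e s) , (c , proj₂ (pass e s)) ∷ u

uninfuse : List Entry → List Entry → List Entry × List Entry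
uninfuse s [] = [] , s
uninfuse s ((c , v) ∷ u) = (c , proj₁ (rpass s v)) ∷ proj₁ (uninfuse (proj₂ (rpass s v)) u) , proj₂ (uninfuse (proj₂ (rpass s v)) u)

-- The array of elementary moves of an infusion, built row by row: `cons` slides the tableau into
-- one more box of `t₁`. As a relation it can be taken apart by columns as well.
data Grid : List Entry → List Entry → List Entry → List Entry → Set where
  nil : ∀ {t₂} → Grid [] t₂ t₂ []
  cons : ∀ {c e e' t₁ t₂ s₀ s u} → Grid t₁ t₂ s₀ u → Pass e s₀ s e' → Grid ((c , e) ∷ t₁) t₂ s ((c , e') ∷ u)

infuse-Grid : ∀ t₁ t₂ → Grid t₁ t₂ (proj₁ (infuse t₁ t₂)) (proj₂ (infuse t₁ t₂))
infuse-Grid [] t₂ = nil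
infuse-Grid ((c , e) ∷ t₁) t₂ with infuse t₁ t₂ | infuse-Grid t₁ t₂
... | s , u | G = cons G (pass-Pass e s)

Grid-infuse : ∀ {t₁ t₂ s u} → Grid t₁ t₂ s u → infuse t₁ t₂ ≡ (s , u)
Grid-infuse nil = refl
Grid-infuse (cons {e = e} {t₁ = t₁} {t₂ = t₂} G P) rewrite Grid-infuse G | Pass-pass P = refl

Grid-valid : ∀ rp {t₁ t₂ s u q} → Grid t₁ t₂ s u → Valid (rp ʳ++ (boxes t₁ ++ (boxes t₂ ++ q))) → Valid (rp ʳ++ (boxes s ++ (boxes u ++ q)))
Grid-valid rp nil v = v
Grid-valid rp (cons {e = e} G P) v = Pass-valid rp P (Grid-valid (e ∷ rp) G v)

Grid-↭ : ∀ {t₁ t₂ s u} → Grid t₁ t₂ s u → boxes t₁ ++ boxes t₂ ↭ boxes s ++ boxes u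
Grid-↭ nil = ↭-sym (↭ₚ.++-identityʳ _)
Grid-↭ {u = _ ∷ u} (cons {e' = e'} {s = s} G P) = ↭-trans (↭-prep _ (Grid-↭ G)) (↭-trans (↭ₚ.++⁺ʳ (boxes u) (Pass-↭ P))
  (↭-reflexive (Listₚ.++-assoc (boxes s) (e' ∷ []) (boxes u))))

prefix-order : ∀ rp xs {ys} → Valid (rp ʳ++ (xs ++ ys)) → AllPairs _⋠_ xs
prefix-order rp xs v = go xs (Fwd.suffix-order rp v)
  where
  go : ∀ xs {ys} → AllPairs _⋠_ (xs ++ ys) → AllPairs _⋠_ xs
  go [] p = []
  go (x ∷ xs) (r ∷ p) = All.tabulate (λ i → All.lookup r (∈-++⁺ˡ i)) ∷ go xs p

prefix-valid : ∀ rp xs {ys} → Valid (rp ʳ++ (xs ++ ys)) → Valid xs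
prefix-valid rp xs v = prefix-order rp xs v , convex
  where
  convex : Convex xs
  convex i j p q with ∈-ʳ++⁻ rp (proj₂ v (∈-ʳ++⁺ʳ rp (∈-++⁺ˡ i)) (∈-ʳ++⁺ʳ rp (∈-++⁺ˡ j)) p q)
  ... | inj₁ k = ⊥-elim (proj₂ (proj₂ (AllPairs-ʳ++⁻ rp (proj₁ v))) k (∈-++⁺ˡ i) p)
  ... | inj₂ k with ∈-++⁻ xs k
  ...   | inj₁ l = l
  ...   | inj₂ l = ⊥-elim (AllPairs-cross xs (Fwd.suffix-order rp v) j l q)

Grid-uninfuse : ∀ rp {t₁ t₂ s u q} → Grid t₁ t₂ s u → Valid (rp ʳ++ (boxes t₁ ++ (boxes t₂ ++ q))) → uninfuse s u ≡ (t₁ , t₂)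
Grid-uninfuse rp nil v = refl
Grid-uninfuse rp (cons {e = e} {s₀ = s₀} G P) v
  rewrite Run-rpass (Pass⇒Run P (prefix-order rp (e ∷ boxes s₀) (Grid-valid (e ∷ rp) G v))) | Grid-uninfuse (e ∷ rp) G v = refl

run-valid : ∀ rp {w t t' h r} → Bwd.Run w t t' h → Valid (rp ʳ++ (boxes t ++ (w ∷ r))) → Valid (rp ʳ++ (h ∷ (boxes t' ++ r)))
run-valid rp Bwd.start v = v
run-valid rp (Bwd.move {b = b} R a) v = run-valid (b ∷ rp) R v
run-valid rp (Bwd.keep {b = b} R na) v = Fwd.swap rp (run-valid (b ∷ rp) R v) (na ∘ Adj-op)

uninfuse-Grid : ∀ rp s u {q} → Valid (rp ʳ++ (boxes s ++ (boxes u ++ q))) → Grid (proj₁ (uninfuse s u)) (proj₂ (uninfuse s u)) s u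
  × Valid (rp ʳ++ (boxes (proj₁ (uninfuse s u)) ++ (boxes (proj₂ (uninfuse s u)) ++ q)))
uninfuse-Grid rp s [] v = nil , v
uninfuse-Grid rp s ((c , w) ∷ u) {q} v = cons (proj₁ ih) (Run⇒Pass R ord) , proj₂ ih
  where
  R : Bwd.Run w s (proj₂ (rpass s w)) (proj₁ (rpass s w))
  R = rpass-Run s w
  ord : AllPairs _⋠_ (boxes s ++ (w ∷ []))
  ord = prefix-order rp (boxes s ++ (w ∷ [])) (subst (λ x → Valid (rp ʳ++ x)) (sym (Listₚ.++-assoc (boxes s) (w ∷ []) _)) v)
  ih = uninfuse-Grid (proj₁ (rpass s w) ∷ rp) (proj₂ (rpass s w)) u (run-valid rp R v)

-- The first column of the array: the first entry of `t₂` meets every box of `t₁`, and for `t₁` its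
-- box is the hole of a reverse slide. So facts about reverse slides carry over to the second output
-- of an infusion.
Grid-split : ∀ {t₁ d b t₂ s u} → Grid t₁ ((d , b) ∷ t₂) s u →
  ∃[ b₀ ] ∃[ t₁' ] ∃[ s' ] (s ≡ (d , b₀) ∷ s' × Bwd.Run b t₁ t₁' b₀ × Grid t₁' t₂ s' u)
Grid-split nil = _ , _ , _ , refl , Bwd.start , nil
Grid-split (cons G P) with Grid-split G
Grid-split (cons G (hop a P)) | b₀ , t₁' , s' , refl , R , G' = _ , _ , _ , refl , Bwd.move R (Adj-op a) , cons G' P
Grid-split (cons G (skip na P)) | b₀ , t₁' , s' , refl , R , G' = _ , _ , _ , refl , Bwd.keep R (na ∘ Adj-op⁻) , cons G' P

Grid-[] : ∀ {t₁ s u} → Grid t₁ [] s u → s ≡ [] × u ≡ t₁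
Grid-[] nil = refl , refl
Grid-[] (cons G P) with Grid-[] G
Grid-[] (cons G done) | refl , refl = refl , refl

Grid-Pic₁ : ∀ rp {t₁ t₂ s u q} → Grid t₁ t₂ s u → Valid (rp ʳ++ (boxes t₁ ++ (boxes t₂ ++ q))) → Pic t₂ → Pic s
Grid-Pic₁ rp nil v p = p
Grid-Pic₁ rp (cons {e = e} G P) v p = Pass-Pic rp P (Grid-Pic₁ (e ∷ rp) G v p) (Grid-valid (e ∷ rp) G v)

Grid-Pic₂ : ∀ rp t₂ {t₁ s u q} → Grid t₁ t₂ s u → Valid (rp ʳ++ (boxes t₁ ++ (boxes t₂ ++ q))) → Pic t₁ → Pic u
Grid-Pic₂ rp [] G v p with Grid-[] G
... | refl , refl = p
Grid-Pic₂ rp ((d , b) ∷ t₂) G v p with Grid-split G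
... | b₀ , t₁' , s' , refl , R , G' = Grid-Pic₂ (b₀ ∷ rp) t₂ G' (run-valid rp R v) (Run-Pic rp R p v)

Grid-Pic₂⁻ : ∀ rp t₂ {t₁ s u q} → Grid t₁ t₂ s u → Valid (rp ʳ++ (boxes t₁ ++ (boxes t₂ ++ q))) → Pic u → Pic t₁
Grid-Pic₂⁻ rp [] G v p with Grid-[] G
... | refl , refl = p
Grid-Pic₂⁻ rp ((d , b) ∷ t₂) {t₁ = t₁} G v p with Grid-split G
... | b₀ , t₁' , s' , refl , R , G' = Pass-Pic rp (Run⇒Pass R ord) (Grid-Pic₂⁻ (b₀ ∷ rp) t₂ G' (run-valid rp R v) p) (run-valid rp R v)
  where
  ord : AllPairs _⋠_ (boxes t₁ ++ (b ∷ []))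
  ord = prefix-order rp (boxes t₁ ++ (b ∷ [])) (subst (λ x → Valid (rp ʳ++ x)) (sym (Listₚ.++-assoc (boxes t₁) (b ∷ []) _)) v)

Grid-Pic₁⁻ : ∀ rp {t₁ t₂ s u q} → Grid t₁ t₂ s u → Valid (rp ʳ++ (boxes t₁ ++ (boxes t₂ ++ q))) → Pic s → Pic t₂
Grid-Pic₁⁻ rp nil v p = p
Grid-Pic₁⁻ rp (cons {e = e} {s₀ = s₀} G P) v p = Grid-Pic₁⁻ (e ∷ rp) G v
  (Run-Pic rp (Pass⇒Run P (prefix-order rp (e ∷ boxes s₀) (Grid-valid (e ∷ rp) G v))) p (Pass-valid rp P (Grid-valid (e ∷ rp) G v)))

Run-cells : ∀ {g t t' h} → Bwd.Run g t t' h → map cell t' ≡ map cell t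
Run-cells = Bwd.Run-cells

Pass-cells : ∀ {h w w' g} → Pass h w w' g → map cell w' ≡ map cell w
Pass-cells done = refl
Pass-cells (hop _ P) = cong (_ ∷_) (Pass-cells P)
Pass-cells (skip _ P) = cong (_ ∷_) (Pass-cells P)

Grid-cells : ∀ {t₁ t₂ s u} → Grid t₁ t₂ s u → map cell s ≡ map cell t₂ × map cell u ≡ map cell t₁
Grid-cells nil = refl , refl
Grid-cells (cons G P) with Grid-cells G
... | p , q = trans (Pass-cells P) p , cong (_ ∷_) q

-- Booleans

∧-elim : ∀ {a b} → a ∧ b ≡ true → a ≡ true × b ≡ true
∧-elim {true} {true} _ = refl , refl

∧-intro : ∀ {a b} → a ≡ true → b ≡ true → a ∧ b ≡ true
∧-intro refl refl = refl

⇒B-elim : ∀ {a b} → (a ⇒B b) ≡ true → a ≡ true → b ≡ true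
⇒B-elim p refl = p

⇒B-intro : ∀ {a b} → (a ≡ true → b ≡ true) → (a ⇒B b) ≡ true
⇒B-intro {true} f = f refl
⇒B-intro {false} f = refl

T⁺ : ∀ {b} → b ≡ true → T b
T⁺ refl = tt

T⁻ : ∀ {b} → T b → b ≡ true
T⁻ {true} _ = refl

≡ᵇ-elim : ∀ {m n} → (m ≡ᵇ n) ≡ true → m ≡ n
≡ᵇ-elim {m} {n} p = ℕₚ.≡ᵇ⇒≡ m n (T⁺ p)

≡ᵇ-intro : ∀ {m n} → m ≡ n → (m ≡ᵇ n) ≡ true
≡ᵇ-intro {m} {n} p = T⁻ (ℕₚ.≡⇒≡ᵇ m n p)

≤ᵇ-elim : ∀ {m n} → (m ≤ᵇ n) ≡ true → m ≤ n
≤ᵇ-elim {m} {n} p = ℕₚ.≤ᵇ⇒≤ m n (T⁺ p)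

≤ᵇ-intro : ∀ {m n} → m ≤ n → (m ≤ᵇ n) ≡ true
≤ᵇ-intro p = T⁻ (ℕₚ.≤⇒≤ᵇ p)

<ᵇ-elim : ∀ {m n} → (m <ᵇ n) ≡ true → m < n
<ᵇ-elim {m} {n} p = ℕₚ.<ᵇ⇒< m n (T⁺ p)

<ᵇ-intro : ∀ {m n} → m < n → (m <ᵇ n) ≡ true
<ᵇ-intro p = T⁻ (ℕₚ.<⇒<ᵇ p)

allB-elim : {A : Set} {p : A → Bool} {xs : List A} → allB p xs ≡ true → ∀ {x} → x ∈ xs → p x ≡ true
allB-elim {p = p} {y ∷ xs} e i with ∧-elim {p y} e
allB-elim e (here refl) | a , b = a
allB-elim e (there i) | a , b = allB-elim b i

allB-intro : {A : Set} {p : A → Bool} (xs : List A) → (∀ {x} → x ∈ xs → p x ≡ true) → allB p xs ≡ true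
allB-intro [] f = refl
allB-intro (x ∷ xs) f = ∧-intro (f (here refl)) (allB-intro xs (f ∘ there))

∈-filterB⁻ : {A : Set} {p : A → Bool} (xs : List A) {x : A} → x ∈ filterB p xs → x ∈ xs × p x ≡ true
∈-filterB⁻ {p = p} (y ∷ xs) i with p y in e
∈-filterB⁻ (y ∷ xs) (here refl) | true = here refl , e
∈-filterB⁻ (y ∷ xs) (there i) | true with ∈-filterB⁻ xs i
... | j , q = there j , q
∈-filterB⁻ (y ∷ xs) i | false with ∈-filterB⁻ xs i
... | j , q = there j , q

∈-filterB⁺ : {A : Set} {p : A → Bool} {xs : List A} {x : A} → x ∈ xs → p x ≡ true → x ∈ filterB p xs
∈-filterB⁺ {p = p} {y ∷ xs} (here refl) e rewrite e = here refl
∈-filterB⁺ {p = p} {y ∷ xs} (there i) e with p y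
... | true = there (∈-filterB⁺ i e)
... | false = ∈-filterB⁺ i e

AllPairs-filterB : {A : Set} {R : A → A → Set} (p : A → Bool) {xs : List A} → AllPairs R xs → AllPairs R (filterB p xs)
AllPairs-filterB p [] = []
AllPairs-filterB p {x ∷ xs} (r ∷ rs) with p x
... | true = All.tabulate (λ i → All.lookup r (proj₁ (∈-filterB⁻ xs i))) ∷ AllPairs-filterB p rs
... | false = AllPairs-filterB p rs

∈-concatMap⁺ : {A B : Set} {f : A → List B} {xs : List A} {x : A} {b : B} → x ∈ xs → b ∈ f x → b ∈ concatMap f xs
∈-concatMap⁺ (here refl) j = ∈-++⁺ˡ j
∈-concatMap⁺ {f = f} {y ∷ xs} (there i) j = ∈-++⁺ʳ (f y) (∈-concatMap⁺ i j)

∈-concatMap⁻ : {A B : Set} {f : A → List B} (xs : List A) {b : B} → b ∈ concatMap f xs → ∃[ x ] (x ∈ xs × b ∈ f x)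
∈-concatMap⁻ {f = f} (y ∷ xs) i with ∈-++⁻ (f y) i
... | inj₁ j = y , here refl , j
... | inj₂ j with ∈-concatMap⁻ xs j
...   | x , k , l = x , there k , l

AllPairs-concatMap : {A B : Set} {R : B → B → Set} {Q : A → A → Set} {f : A → List B} {xs : List A} →
  AllPairs Q xs → (∀ {x} → x ∈ xs → AllPairs R (f x)) → (∀ {x y a b} → Q x y → a ∈ f x → b ∈ f y → R a b) → AllPairs R (concatMap f xs)
AllPairs-concatMap [] _ _ = []
AllPairs-concatMap {f = f} {x ∷ xs} (q ∷ qs) g h = AllPairsₚ.++⁺ (g (here refl)) (AllPairs-concatMap qs (g ∘ there) h)
  (All.tabulate λ i → All.tabulate λ j → let (y , k , l) = ∈-concatMap⁻ xs j in h (All.lookup q k) i l)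

AllPairs-map : {A B : Set} {R : B → B → Set} {f : A → B} {xs : List A} → AllPairs (λ x y → R (f x) (f y)) xs → AllPairs R (map f xs)
AllPairs-map = AllPairsₚ.map⁺

sorted-unique : {A : Set} {R : A → A → Set} → (∀ {x} → ¬ R x x) → (∀ {x y z} → R x y → R y z → R x z) →
  ∀ {xs ys} → AllPairs R xs → AllPairs R ys → (∀ {x} → x ∈ xs → x ∈ ys) → (∀ {x} → x ∈ ys → x ∈ xs) → xs ≡ ys
sorted-unique irr tr {[]} {[]} p q f g = refl
sorted-unique irr tr {[]} {y ∷ ys} p q f g with g (here refl)
... | ()
sorted-unique irr tr {x ∷ xs} {[]} p q f g with f (here refl)
... | ()
sorted-unique irr tr {x ∷ xs} {y ∷ ys} (p ∷ ps) (q ∷ qs) f g with f (here refl) | g (here refl)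
... | there i | there j = ⊥-elim (irr (tr (All.lookup p j) (All.lookup q i)))
... | here refl | _ = cong (x ∷_) (sorted-unique irr tr ps qs (λ i → drop (All.lookup p i) (f (there i))) (λ i → drop (All.lookup q i) (g (there i))))
  where
  drop : ∀ {z zs} → _ → z ∈ x ∷ zs → z ∈ zs
  drop r (here refl) = ⊥-elim (irr r)
  drop r (there i) = i
... | there i | here refl = ⊥-elim (irr (All.lookup q i))

-- 1-indexed ranges and lookup

∈-range1⁺ : ∀ {n i} → 0 < i → i ≤ n → i ∈ range1 n
∈-range1⁺ {n} {suc i} _ p = ∈-map⁺ suc (∈-applyUpTo⁺ id p)

∈-range1⁻ : ∀ {n i} → i ∈ range1 n → 0 < i × i ≤ n
∈-range1⁻ {n} i with ∈-map⁻ suc i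
... | j , k , refl with ∈-applyUpTo⁻ id k
...   | _ , p , refl = s≤s z≤n , p

range1-< : ∀ n → AllPairs _<_ (range1 n)
range1-< n = AllPairsₚ.map⁺ (AllPairsₚ.applyUpTo⁺₁ id n λ i<j _ → s≤s i<j)

module _ {A : Set} (d : A) where

  at-∈ : ∀ xs {i} → 0 < i → i ≤ length xs → at d xs i ∈ xs
  at-∈ (x ∷ xs) {suc zero} _ _ = here refl
  at-∈ (x ∷ xs) {suc (suc i)} _ (s≤s p) = there (at-∈ xs (s≤s z≤n) p)
  at-∈ [] {suc i} _ ()

  ∈-at : ∀ {xs x} → x ∈ xs → ∃[ i ] (0 < i × i ≤ length xs × at d xs i ≡ x)
  ∈-at (here refl) = 1 , s≤s z≤n , s≤s z≤n , refl
  ∈-at (there i) with ∈-at i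
  ... | suc k , _ , p , e = suc (suc k) , s≤s z≤n , s≤s p , e

  AllPairs-at⁺ : ∀ {R : A → A → Set} xs → (∀ {k l} → 0 < k → k < l → l ≤ length xs → R (at d xs k) (at d xs l)) → AllPairs R xs
  AllPairs-at⁺ [] f = []
  AllPairs-at⁺ {R} (x ∷ xs) f = All.tabulate h ∷ AllPairs-at⁺ xs λ { {suc k} {suc l} _ p q → f (s≤s z≤n) (s≤s p) (s≤s q) }
    where
    h : ∀ {y} → y ∈ xs → R x y
    h i with ∈-at i
    ... | suc k , _ , q , refl = f (s≤s z≤n) (s≤s (s≤s z≤n)) (s≤s q)

  AllPairs-at⁻ : ∀ {R : A → A → Set} {xs} → AllPairs R xs → ∀ {k l} → 0 < k → k < l → l ≤ length xs → R (at d xs k) (at d xs l)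
  AllPairs-at⁻ {xs = x ∷ xs} (r ∷ _) {suc zero} {suc (suc l)} _ _ (s≤s q) = All.lookup r (at-∈ xs (s≤s z≤n) q)
  AllPairs-at⁻ {xs = x ∷ xs} (_ ∷ p) {suc (suc k)} {suc (suc l)} _ (s≤s a) (s≤s q) = AllPairs-at⁻ p (s≤s z≤n) a q
  AllPairs-at⁻ {xs = x ∷ xs} _ {suc k} {suc zero} _ (s≤s ()) _
  AllPairs-at⁻ [] {l = zero} _ () _
  AllPairs-at⁻ [] {l = suc l} _ _ ()

  Linked-at⁺ : ∀ {R : A → A → Set} xs → (∀ {k} → 0 < k → k ≤ length xs ∸ 1 → R (at d xs k) (at d xs (suc k))) → Linked R xs
  Linked-at⁺ [] f = []
  Linked-at⁺ (x ∷ []) f = [-]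
  Linked-at⁺ (x ∷ y ∷ xs) f = f (s≤s z≤n) (s≤s z≤n) ∷ Linked-at⁺ (y ∷ xs) λ { {suc k} _ q → f (s≤s z≤n) (s≤s q) }

at-zip : {A B : Set} (a : A) (b : B) → ∀ xs ys → length xs ≡ length ys → ∀ i → at (a , b) (zip xs ys) i ≡ (at a xs i , at b ys i)
at-zip a b [] [] _ i = refl
at-zip a b (x ∷ xs) (y ∷ ys) e zero = refl
at-zip a b (x ∷ xs) (y ∷ ys) e (suc zero) = refl
at-zip a b (x ∷ xs) (y ∷ ys) e (suc (suc i)) = at-zip a b xs ys (ℕₚ.suc-injective e) (suc i)

length-zip : {A B : Set} (xs : List A) (ys : List B) → length xs ≡ length ys → length (zip xs ys) ≡ length ys
length-zip [] [] _ = refl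
length-zip (x ∷ xs) (y ∷ ys) e = cong suc (length-zip xs ys (ℕₚ.suc-injective e))

map₁-zip : {A B : Set} (xs : List A) (ys : List B) → length xs ≡ length ys → map proj₁ (zip xs ys) ≡ xs
map₁-zip [] [] _ = refl
map₁-zip (x ∷ xs) (y ∷ ys) e = cong (x ∷_) (map₁-zip xs ys (ℕₚ.suc-injective e))

map₂-zip : {A B : Set} (xs : List A) (ys : List B) → length xs ≡ length ys → map proj₂ (zip xs ys) ≡ ys
map₂-zip [] [] _ = refl
map₂-zip (x ∷ xs) (y ∷ ys) e = cong (y ∷_) (map₂-zip xs ys (ℕₚ.suc-injective e))

zip-map : {A B : Set} (ps : List (A × B)) → zip (map proj₁ ps) (map proj₂ ps) ≡ ps
zip-map [] = refl
zip-map (p ∷ ps) = cong (p ∷_) (zip-map ps)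

-- Partitions

Positive : Box → Set
Positive b = 0 < row b × 0 < col b

record _∈ₚ_ (b : Box) (κ : Partition) : Set where
  constructor _,_
  field
    positive : Positive b
    fits : col b ≤ part κ (row b)
open _∈ₚ_ public

_⊆ₚ_ : Partition → Partition → Set
κ ⊆ₚ κ' = ∀ {b} → b ∈ₚ κ → b ∈ₚ κ'

InSkew : Partition → Partition → Box → Set
InSkew γ δ b = b ∈ₚ γ × ¬ b ∈ₚ δ

_∈ₚ?_ : ∀ b κ → Dec (b ∈ₚ κ)
b ∈ₚ? κ = Dec.map′ (λ (p , q) → p , q) (λ (p , q) → p , q) ((0 ℕₚ.<? row b ×-dec 0 ℕₚ.<? col b) ×-dec (col b ℕₚ.≤? part κ (row b)))

part-suc : ∀ {κ} → IsPartition κ → ∀ {i} → 0 < i → part κ (suc i) ≤ part κ i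
part-suc {[]} p _ = z≤n
part-suc {x ∷ []} p {suc i} _ = z≤n
part-suc {x ∷ y ∷ κ} (_ , l ∷ _) {suc zero} _ = l
part-suc {x ∷ y ∷ κ} (_ ∷ p , _ ∷ q) {suc (suc i)} _ = part-suc {y ∷ κ} (p , q) (s≤s z≤n)

part-anti : ∀ {κ} → IsPartition κ → ∀ {i j} → 0 < i → i ≤ j → part κ j ≤ part κ i
part-anti {κ} P {i} {j} p q = subst (λ x → part κ x ≤ part κ i) (ℕₚ.m+[n∸m]≡n q) (go (j ∸ i))
  where
  go : ∀ k → part κ (i + k) ≤ part κ i
  go zero = ℕₚ.≤-reflexive (cong (part κ) (ℕₚ.+-identityʳ i))
  go (suc k) = ℕₚ.≤-trans (subst (λ x → part κ x ≤ part κ (i + k)) (sym (ℕₚ.+-suc i k)) (part-suc {κ} P (ℕₚ.<-≤-trans p (ℕₚ.m≤m+n i k)))) (go k)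

∈ₚ-≼ : ∀ {κ b c} → IsPartition κ → b ∈ₚ κ → c ≼ b → Positive c → c ∈ₚ κ
∈ₚ-≼ {κ} P (_ , l) (p , q) c⁺ = c⁺ , ℕₚ.≤-trans q (ℕₚ.≤-trans l (part-anti {κ} P (proj₁ c⁺) p))

part-pos : ∀ {κ i} → IsPartition κ → 0 < i → i ≤ length κ → 0 < part κ i
part-pos {κ} (p , _) a b = All.lookup p (at-∈ 0 κ a b)

part-beyond : ∀ κ {i} → length κ < i → part κ i ≡ 0
part-beyond [] _ = refl
part-beyond (x ∷ κ) {suc (suc i)} (s≤s p) = part-beyond κ p
part-beyond (x ∷ κ) {suc zero} (s≤s ())

part-ext : ∀ {κ κ'} → IsPartition κ → IsPartition κ' → (∀ {i} → 0 < i → part κ i ≡ part κ' i) → κ ≡ κ'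
part-ext {[]} {[]} P Q f = refl
part-ext {[]} {y ∷ κ'} P (q ∷ _ , _) f = ⊥-elim (ℕₚ.<-irrefl (f {1} (s≤s z≤n)) q)
part-ext {x ∷ κ} {[]} (q ∷ _ , _) Q f = ⊥-elim (ℕₚ.<-irrefl (sym (f {1} (s≤s z≤n))) q)
part-ext {x ∷ κ} {y ∷ κ'} (_ ∷ p , l) (_ ∷ q , l') f =
  cong₂ _∷_ (f {1} (s≤s z≤n)) (part-ext (p , Linked.tail l) (q , Linked.tail l') λ { {suc i} _ → f {suc (suc i)} (s≤s z≤n) })

⊆ₚ-part : ∀ {κ κ' i} → κ ⊆ₚ κ' → 0 < i → part κ i ≤ part κ' i
⊆ₚ-part {κ} {i = i} s p with part κ i in e
... | zero = z≤n
... | suc k = fits (s {i , suc k} ((p , s≤s z≤n) , ℕₚ.≤-reflexive (sym e)))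

part-⊆ₚ : ∀ {κ κ'} → (∀ {i} → 0 < i → part κ i ≤ part κ' i) → κ ⊆ₚ κ'
part-⊆ₚ f (p , l) = p , ℕₚ.≤-trans l (f (proj₁ p))

⊆ₚ-antisym : ∀ {κ κ'} → IsPartition κ → IsPartition κ' → κ ⊆ₚ κ' → κ' ⊆ₚ κ → κ ≡ κ'
⊆ₚ-antisym {κ} {κ'} P Q s t = part-ext P Q λ p → ℕₚ.≤-antisym (⊆ₚ-part {κ} {κ'} s p) (⊆ₚ-part {κ'} {κ} t p)

-- Stops at the first empty row, since the list of a partition has positive parts only.
fromRows : ℕ → (ℕ → ℕ) → List ℕ
fromRows zero f = []
fromRows (suc n) f with f 1
... | zero = []
... | suc k = suc k ∷ fromRows n (f ∘ suc)

module _ where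
  private
    Anti : (ℕ → ℕ) → Set
    Anti f = ∀ {i} → 0 < i → f (suc i) ≤ f i

    anti-zero : ∀ {f} → Anti f → f 1 ≡ 0 → ∀ {i} → 0 < i → f i ≡ 0
    anti-zero a e {suc zero} _ = e
    anti-zero a e {suc (suc i)} _ = ℕₚ.n≤0⇒n≡0 (ℕₚ.≤-trans (a (s≤s z≤n)) (ℕₚ.≤-reflexive (anti-zero a e {suc i} (s≤s z≤n))))

  fromRows-part : ∀ n f → Anti f → f (suc n) ≡ 0 → ∀ {i} → 0 < i → part (fromRows n f) i ≡ f i
  fromRows-part zero f a e p = sym (anti-zero a e p)
  fromRows-part (suc n) f a e {i} p with f 1 in e₁
  ... | zero = sym (anti-zero a e₁ p)
  fromRows-part (suc n) f a e {suc zero} p | suc k = sym e₁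
  fromRows-part (suc n) f a e {suc (suc i)} p | suc k = fromRows-part n (f ∘ suc) (λ _ → a (s≤s z≤n)) e (s≤s z≤n)

  fromRows-partition : ∀ n f → Anti f → f (suc n) ≡ 0 → IsPartition (fromRows n f)
  fromRows-partition zero f a e = [] , []
  fromRows-partition (suc n) f a e with f 1 in e₁
  ... | zero = [] , []
  ... | suc k with fromRows-partition n (f ∘ suc) (λ _ → a (s≤s z≤n)) e | fromRows-part n (f ∘ suc) (λ _ → a (s≤s z≤n)) e {1} (s≤s z≤n)
  ...   | p , q | h = (s≤s z≤n ∷ p) , link (fromRows n (f ∘ suc)) q h
    where
    link : ∀ xs → Linked ℕ._≥_ xs → part xs 1 ≡ f 2 → Linked ℕ._≥_ (suc k ∷ xs)
    link [] _ _ = [-]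
    link (x ∷ xs) l h = subst (x ≤_) e₁ (subst (_≤ f 1) (sym h) (a (s≤s z≤n))) ∷ l

-- Turns an order ideal of boxes of `Γ` into a partition. The length of a row is found by searching
-- for its last box in `P` from the end of the row in `Γ`.
module Subshape (Γ : Partition) (PΓ : IsPartition Γ) {P : Box → Set} (P? : ∀ b → Dec (P b))
  (down : ∀ {b c} → b ∈ₚ Γ → P b → c ≼ b → Positive c → P c) where

  height : ℕ → ℕ → ℕ
  height i zero = 0
  height i (suc n) with P? (i , suc n)
  ... | yes _ = suc n
  ... | no _ = height i n

  height-≤ : ∀ i n → height i n ≤ n
  height-≤ i zero = z≤n
  height-≤ i (suc n) with P? (i , suc n)
  ... | yes _ = ℕₚ.≤-refl
  ... | no _ = ℕₚ.m≤n⇒m≤1+n (height-≤ i n)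

  height-P : ∀ i n → 0 < height i n → P (i , height i n)
  height-P i zero ()
  height-P i (suc n) p with P? (i , suc n)
  ... | yes q = q
  ... | no _ = height-P i n p

  height-max : ∀ i n {j} → j ≤ n → P (i , j) → j ≤ height i n
  height-max i zero p q = p
  height-max i (suc n) {j} p q with P? (i , suc n)
  ... | yes _ = p
  ... | no np with j ℕₚ.≟ suc n
  ...   | yes refl = ⊥-elim (np q)
  ...   | no ne = height-max i n (ℕₚ.≤-pred (ℕₚ.≤∧≢⇒< p ne)) q

  private
    f : ℕ → ℕ
    f i = height i (part Γ i)

    anti : ∀ {i} → 0 < i → f (suc i) ≤ f i
    anti {i} p with f (suc i) in e
    ... | zero = z≤n
    ... | suc k = height-max i (part Γ i) (ℕₚ.≤-trans k≤ (part-suc {Γ} PΓ p))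
            (down ((s≤s z≤n , s≤s z≤n) , k≤) (subst (λ x → P (suc i , x)) e (height-P (suc i) (part Γ (suc i)) (subst (0 <_) (sym e) (s≤s z≤n)))) (ℕₚ.n≤1+n i , ℕₚ.≤-refl) (p , s≤s z≤n))
      where
      k≤ : suc k ≤ part Γ (suc i)
      k≤ = subst (_≤ part Γ (suc i)) e (height-≤ (suc i) (part Γ (suc i)))

    end : f (suc (length Γ)) ≡ 0
    end = ℕₚ.n≤0⇒n≡0 (subst (f (suc (length Γ)) ≤_) (part-beyond Γ ℕₚ.≤-refl) (height-≤ (suc (length Γ)) (part Γ (suc (length Γ)))))

  shape : Partition
  shape = fromRows (length Γ) f

  shape-partition : IsPartition shape
  shape-partition = fromRows-partition (length Γ) f anti end

  ∈-shape⁺ : ∀ {b} → b ∈ₚ Γ → P b → b ∈ₚ shape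
  ∈-shape⁺ (p , l) q = p , subst (_ ≤_) (sym (fromRows-part (length Γ) f anti end (proj₁ p))) (height-max _ _ l q)

  ∈-shape⁻ : ∀ {b} → b ∈ₚ shape → b ∈ₚ Γ × P b
  ∈-shape⁻ {i , j} (p , l) = (p , ℕₚ.≤-trans l' (height-≤ i (part Γ i))) ,
    down ((proj₁ p , j') , height-≤ i (part Γ i)) (height-P i (part Γ i) j') (ℕₚ.≤-refl , l') p
    where
    l' : j ≤ f i
    l' = subst (j ≤_) (fromRows-part (length Γ) f anti end (proj₁ p)) l
    j' : 0 < f i
    j' = ℕₚ.<-≤-trans (proj₂ p) l'

-- Standard fillings

record Std (γ δ : Partition) (t : List Box) : Set where
  constructor mkStd
  field
    order : AllPairs _⋠_ t
    sound : ∀ {b} → b ∈ t → InSkew γ δ b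
    complete : ∀ {b} → InSkew γ δ b → b ∈ t

InSkew-convex : ∀ {γ δ x y e} → IsPartition γ → IsPartition δ → InSkew γ δ x → InSkew γ δ y → x ≼ e → e ≼ y → InSkew γ δ e
InSkew-convex G D ((p , l) , n) (q , _) h k = ∈ₚ-≼ G q k e⁺ , λ i → n (∈ₚ-≼ D i h p)
  where e⁺ = ℕₚ.<-≤-trans (proj₁ p) (proj₁ h) , ℕₚ.<-≤-trans (proj₂ p) (proj₂ h)

Std-valid : ∀ {γ δ t} → IsPartition γ → IsPartition δ → Std γ δ t → Valid t
Std-valid G D S = Std.order S , λ i j p q → Std.complete S (InSkew-convex G D (Std.sound S i) (Std.sound S j) p q)

_≟ᵇ_ : (x y : Box) → Dec (x ≡ y)
_≟ᵇ_ = ≡-dec ℕₚ._≟_ ℕₚ._≟_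

open import Data.List.Membership.DecPropositional _≟ᵇ_ using (_∈?_)

Std-join : ∀ {γ δ ε s u} → IsPartition δ → ε ⊆ₚ δ → δ ⊆ₚ γ → Std δ ε s → Std γ δ u → Std γ ε (s ++ u)
Std-join {s = s} {u} D i j S U = mkStd
  (AllPairsₚ.++⁺ (Std.order S) (Std.order U) (All.tabulate λ k → All.tabulate λ l p → proj₂ (Std.sound U l) (∈ₚ-≼ D (proj₁ (Std.sound S k)) p (positive (proj₁ (Std.sound U l))))))
  (λ k → [ (λ l → j (proj₁ (Std.sound S l)) , proj₂ (Std.sound S l)) , (λ l → proj₁ (Std.sound U l) , proj₂ (Std.sound U l) ∘ i) ]′ (∈-++⁻ s k))
  c
  where
  c : ∀ {b} → InSkew _ _ b → b ∈ s ++ u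
  c {b} (p , q) with b ∈ₚ? _
  ... | yes r = ∈-++⁺ˡ (Std.complete S (r , q))
  ... | no r = ∈-++⁺ʳ s (Std.complete U (p , r))

record Split (γ ε : Partition) (s u : List Box) : Set where
  field
    middle : Partition
    partition : IsPartition middle
    lower : ε ⊆ₚ middle
    upper : middle ⊆ₚ γ
    left : Std middle ε s
    right : Std γ middle u

-- No box weakly north-west of another has the larger label; hence `ε` together with the boxes of
-- the initial segment `s` is an order ideal of `γ`, and this is the partition in the middle.
Std-split : ∀ {γ ε s u} → IsPartition γ → IsPartition ε → ε ⊆ₚ γ → Std γ ε (s ++ u) → Split γ ε s u
Std-split {γ} {ε} {s} {u} G E sub S = record
  { middle = shape
  ; partition = shape-partition
  ; lower = λ i → ∈-shape⁺ (sub i) (inj₁ i)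
  ; upper = proj₁ ∘ ∈-shape⁻
  ; left = mkStd (proj₁ ord) (λ i → ∈-shape⁺ (proj₁ (sl i)) (inj₂ i) , proj₂ (sl i)) λ (i , n) → [ ⊥-elim ∘ n , id ]′ (proj₂ (∈-shape⁻ i))
  ; right = mkStd (proj₁ (proj₂ ord))
      (λ i → proj₁ (sr i) , λ j → [ proj₂ (sr i) , (λ k → proj₂ (proj₂ ord) k i Fwd.≼-refl) ]′ (proj₂ (∈-shape⁻ j)))
      λ (i , n) → [ (λ j → ⊥-elim (n (∈-shape⁺ i (inj₂ j)))) , id ]′ (∈-++⁻ s (Std.complete S (i , λ j → n (∈-shape⁺ i (inj₁ j))))) }
  where
  ord : AllPairs _⋠_ s × AllPairs _⋠_ u × (∀ {x y} → x ∈ s → y ∈ u → x ⋠ y)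
  ord with AllPairs-ʳ++⁻ (s ʳ++ []) (subst (AllPairs _⋠_) (sym (trans (Listₚ.ʳ++-ʳ++ s) refl)) (Std.order S))
  ... | a , b , c = subst (AllPairs _⋠_) (reverse-reverse s) (reverse-AllPairs a) , b , λ i → c (∈-ʳ++⁺ˡ s i)
  sl : ∀ {b} → b ∈ s → InSkew γ ε b
  sl = Std.sound S ∘ ∈-++⁺ˡ
  sr : ∀ {b} → b ∈ u → InSkew γ ε b
  sr = Std.sound S ∘ ∈-++⁺ʳ s
  inner : ∀ c {b} → c ∈ₚ γ → b ∈ s → c ≼ b → c ∈ₚ ε ⊎ c ∈ s
  inner c i p q with c ∈ₚ? ε
  ... | yes r = inj₁ r
  ... | no r = inj₂ ([ id , (λ k → ⊥-elim (proj₂ (proj₂ ord) p k q)) ]′ (∈-++⁻ s (Std.complete S (i , r))))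
  closed : ∀ {b c} → b ∈ₚ γ → b ∈ₚ ε ⊎ b ∈ s → c ≼ b → Positive c → c ∈ₚ ε ⊎ c ∈ s
  closed i (inj₁ p) q c⁺ = inj₁ (∈ₚ-≼ E p q c⁺)
  closed i (inj₂ p) q c⁺ = inner _ (∈ₚ-≼ G i q c⁺) p q
  open Subshape γ G {P = λ b → b ∈ₚ ε ⊎ b ∈ s} (λ b → (b ∈ₚ? ε) ⊎-dec (b ∈? s)) closed

-- Skew shapes as lists of cells

InSkew⁺ : ∀ {α β i j} → 0 < i → part β i < j → j ≤ part α i → InSkew α β (i , j)
InSkew⁺ p q r = ((p , ℕₚ.≤-<-trans z≤n q) , r) , λ k → ℕₚ.<⇒≱ q (fits k)

InSkew⁻ : ∀ {α β i j} → InSkew α β (i , j) → 0 < i × part β i < j × j ≤ part α i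
InSkew⁻ (p , n) = proj₁ (positive p) , ℕₚ.≰⇒> (λ l → n (positive p , l)) , fits p

row≤length : ∀ {κ b} → b ∈ₚ κ → row b ≤ length κ
row≤length {κ} {b} p with row b ℕₚ.≤? length κ
... | yes q = q
... | no q = ⊥-elim (ℕₚ.<⇒≱ (proj₂ (positive p)) (subst (col b ≤_) (part-beyond κ (ℕₚ.≰⇒> q)) (fits p)))

∈-rl⁺ : ∀ {α β b} → InSkew α β b → b ∈ rl α β
∈-rl⁺ {α} {β} {i , j} p with InSkew⁻ p
... | p₁ , p₂ , p₃ = ∈-concatMap⁺ (∈-range1⁺ p₁ (row≤length (proj₁ p)))
  (∈-map⁺ (i ,_) (∈-ʳ++⁺ˡ (filterB _ (range1 (part α i))) (∈-filterB⁺ (∈-range1⁺ (ℕₚ.≤-<-trans z≤n p₂) p₃) (<ᵇ-intro p₂))))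

∈-rl⁻ : ∀ {α β b} → b ∈ rl α β → InSkew α β b
∈-rl⁻ {α} {β} p with ∈-concatMap⁻ (range1 (length α)) p
... | i , p₁ , q with ∈-map⁻ (i ,_) q
... | j , k , refl with ∈-filterB⁻ (range1 (part α i)) (∈-reverse⁻ (filterB _ (range1 (part α i))) k)
... | a , b = InSkew⁺ (proj₁ (∈-range1⁻ p₁)) (<ᵇ-elim b) (proj₂ (∈-range1⁻ a))

∈-map-row : ∀ i {xs : List ℕ} {b} → b ∈ map (i ,_) xs → row b ≡ i
∈-map-row i k with ∈-map⁻ (i ,_) k
... | _ , _ , refl = refl

rl-sorted : ∀ α β → AllPairs RL (rl α β)
rl-sorted α β = AllPairs-concatMap (range1-< (length α))
  (λ {i} _ → AllPairs-map (AllPairs.map (λ p → inj₂ (refl , p)) (reverse-AllPairs (AllPairs-filterB _ (range1-< (part α i))))))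
  λ {i} {i'} p a b → inj₁ (subst₂ _<_ (sym (∈-map-row i a)) (sym (∈-map-row i' b)) p)

rl-⊆ : ∀ {α} → rl α α ≡ []
rl-⊆ {α} with rl α α in e
... | [] = refl
... | x ∷ xs with ∈-rl⁻ {α} {α} (subst (x ∈_) (sym e) (here refl))
...   | p , n = ⊥-elim (n p)

∈-skewBoxes⁺ : ∀ {α β b} → InSkew α β b → b ∈ skewBoxes α β
∈-skewBoxes⁺ {α} {β} {i , j} p with InSkew⁻ p
... | p₁ , p₂ , p₃ = ∈-concatMap⁺ (∈-range1⁺ p₁ (row≤length (proj₁ p)))
  (∈-map⁺ (i ,_) (∈-filterB⁺ (∈-range1⁺ (ℕₚ.≤-<-trans z≤n p₂) p₃) (<ᵇ-intro p₂)))

∈-skewBoxes⁻ : ∀ {α β b} → b ∈ skewBoxes α β → InSkew α β b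
∈-skewBoxes⁻ {α} {β} p with ∈-concatMap⁻ (range1 (length α)) p
... | i , p₁ , q with ∈-map⁻ (i ,_) q
... | j , k , refl with ∈-filterB⁻ (range1 (part α i)) k
... | a , b = InSkew⁺ (proj₁ (∈-range1⁻ p₁)) (<ᵇ-elim b) (proj₂ (∈-range1⁻ a))

skewBoxes-unique : ∀ α β → Unique (skewBoxes α β)
skewBoxes-unique α β = AllPairs-concatMap (range1-< (length α))
  (λ {i} _ → AllPairs-map (AllPairs.map (λ p q → ℕₚ.<⇒≢ p (cong col q)) (AllPairs-filterB _ (range1-< (part α i)))))
  λ {i} {i'} p a b q → ℕₚ.<⇒≢ p (trans (sym (∈-map-row i a)) (trans (cong row q) (∈-map-row i' b)))

set⇒↭ : {A : Set} {xs ys : List A} → Unique xs → Unique ys → (∀ {x} → x ∈ xs → x ∈ ys) → (∀ {x} → x ∈ ys → x ∈ xs) → xs ↭ ys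
set⇒↭ u v f g = ∼bag⇒↭ (unique∧set⇒bag u v (mk⇔ f g))

⋠-unique : ∀ {t} → AllPairs _⋠_ t → Unique t
⋠-unique = AllPairs.map λ { n refl → n Fwd.≼-refl }

RL-unique : ∀ {t} → AllPairs RL t → Unique t
RL-unique = AllPairs.map λ { n refl → Fwd.RL-irr n }

Std-↭ : ∀ {γ δ t} → Std γ δ t → t ↭ skewBoxes γ δ
Std-↭ {γ} {δ} S = set⇒↭ (⋠-unique (Std.order S)) (skewBoxes-unique γ δ) (∈-skewBoxes⁺ {γ} {δ} ∘ Std.sound S) (Std.complete S ∘ ∈-skewBoxes⁻ {γ} {δ})

rl-↭ : ∀ γ δ → rl γ δ ↭ skewBoxes γ δ
rl-↭ γ δ = set⇒↭ (RL-unique (rl-sorted γ δ)) (skewBoxes-unique γ δ) (∈-skewBoxes⁺ {γ} {δ} ∘ ∈-rl⁻ {γ} {δ}) (∈-rl⁺ {γ} {δ} ∘ ∈-skewBoxes⁻ {γ} {δ})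

-- Sizes

size-rows : ∀ κ n → length κ ≤ n → size κ ≡ sum (applyUpTo (λ i → part κ (suc i)) n)
size-rows [] n _ = sym (zeros n)
  where
  zeros : ∀ n → sum (applyUpTo (λ _ → 0) n) ≡ 0
  zeros zero = refl
  zeros (suc n) = zeros n
size-rows (x ∷ κ) (suc n) (s≤s p) = cong (x +_) (size-rows κ n p)

sum-mono : ∀ n (f g : ℕ → ℕ) → (∀ i → f i ≤ g i) → sum (applyUpTo f n) ≤ sum (applyUpTo g n)
sum-mono zero f g h = z≤n
sum-mono (suc n) f g h = ℕₚ.+-mono-≤ (h 0) (sum-mono n (f ∘ suc) (g ∘ suc) (h ∘ suc))

sum-plus : ∀ n (f g h : ℕ → ℕ) → (∀ i → f i + g i ≡ h i) → sum (applyUpTo f n) + sum (applyUpTo g n) ≡ sum (applyUpTo h n)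
sum-plus zero f g h e = refl
sum-plus (suc n) f g h e = trans (ℕ-interchange (f 0) _ (g 0) _) (cong₂ _+_ (e 0) (sum-plus n (f ∘ suc) (g ∘ suc) (h ∘ suc) (e ∘ suc)))
  where
  ℕ-interchange : ∀ a b c d → (a + b) + (c + d) ≡ (a + c) + (b + d)
  ℕ-interchange a b c d = trans (ℕₚ.+-assoc a b _) (trans (cong (a +_) (trans (sym (ℕₚ.+-assoc b c d)) (trans (cong (_+ d) (ℕₚ.+-comm b c)) (ℕₚ.+-assoc c b d)))) (sym (ℕₚ.+-assoc a c _)))

size-⊆ : ∀ {κ κ'} → κ ⊆ₚ κ' → size κ ≤ size κ'
size-⊆ {κ} {κ'} s = subst₂ _≤_ (sym (size-rows κ n (ℕₚ.m≤m+n _ _))) (sym (size-rows κ' n (ℕₚ.m≤n+m _ _)))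
  (sum-mono n _ _ λ i → ⊆ₚ-part {κ} {κ'} s (s≤s z≤n))
  where n = length κ + length κ'

length-skewBoxes : ∀ {γ δ} → δ ⊆ₚ γ → length (skewBoxes γ δ) + size δ ≡ size γ
length-skewBoxes {γ} {δ} s = trans (cong₂ _+_ rows (size-rows δ n (ℕₚ.m≤n+m _ _))) (trans (sum-plus n (λ i → part γ (suc i) ∸ part δ (suc i)) _ _ λ i → ℕₚ.m∸n+n≡m (⊆ₚ-part {δ} {γ} s (s≤s z≤n))) (sym (size-rows γ n (ℕₚ.m≤m+n _ _))))
  where
  n = length γ + length δ
  between : ∀ m k → length (filterB (λ j → m <ᵇ j) (map suc (upTo k))) ≡ k ∸ m
  between m k = trans (cong (length ∘ filterB (m <ᵇ_)) (Listₚ.map-applyUpTo id suc k)) (go k 0 suc λ i → cong suc (sym (ℕₚ.+-identityʳ i)))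
    where
    -- `c` columns have been scanned, so that `f` enumerates the columns `c + 1`, `c + 2` and so on.
    go : ∀ k c f → (∀ i → f i ≡ suc (i + c)) → length (filterB (m <ᵇ_) (applyUpTo f k)) ≡ k ∸ (m ∸ c)
    go zero c f e = sym (ℕₚ.0∸n≡0 (m ∸ c))
    go (suc k) c f e with m <ᵇ f 0 in q | go k (suc c) (f ∘ suc) (λ i → trans (e (suc i)) (cong suc (sym (ℕₚ.+-suc i c))))
    ... | true | ih = trans (cong suc (trans ih (cong (k ∸_) (ℕₚ.m≤n⇒m∸n≡0 (ℕₚ.m≤n⇒m≤1+n m≤c))))) (cong (suc k ∸_) (sym (ℕₚ.m≤n⇒m∸n≡0 m≤c)))
      where
      m≤c : m ≤ c
      m≤c = ℕₚ.≤-pred (subst (m <_) (e 0) (<ᵇ-elim q))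
    ... | false | ih = trans ih (cong (suc k ∸_) (suc-∸ m c (ℕₚ.≮⇒≥ λ l → false≢true (trans (sym q) (<ᵇ-intro (subst (m <_) (sym (e 0)) l))))))
      where
      false≢true : false ≢ true
      false≢true ()
      suc-∸ : ∀ m c → suc c ≤ m → suc (m ∸ suc c) ≡ m ∸ c
      suc-∸ (suc m) zero _ = refl
      suc-∸ (suc m) (suc c) (s≤s p) = suc-∸ m c p
  rows-list : ∀ (f : ℕ → List Box) (g : ℕ → ℕ) k → (∀ i → length (f i) ≡ g i) → length (concatMap f (applyUpTo suc k)) ≡ sum (applyUpTo (g ∘ suc) k)
  rows-list f g k h = go k suc
    where
    go : ∀ k e → length (concatMap f (applyUpTo e k)) ≡ sum (applyUpTo (g ∘ e) k)
    go zero e = refl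
    go (suc k) e = trans (Listₚ.length-++ (f (e 0))) (cong₂ _+_ (h (e 0)) (go k (e ∘ suc)))
  rows : length (skewBoxes γ δ) ≡ sum (applyUpTo (λ i → part γ (suc i) ∸ part δ (suc i)) n)
  rows = trans (trans (cong (λ z → length (concatMap (λ i → map (λ j → (i , j)) (filterB (λ j → part δ i <ᵇ j) (range1 (part γ i)))) z)) (Listₚ.map-applyUpTo id suc (length γ)))
    (rows-list (λ i → map (λ j → (i , j)) (filterB (λ j → part δ i <ᵇ j) (range1 (part γ i)))) (λ i → part γ i ∸ part δ i) (length γ) λ i → trans (Listₚ.length-map (i ,_) (filterB _ (range1 (part γ i)))) (between (part δ i) (part γ i))))
    (extend (length δ) (length γ) (λ i → part γ (suc i) ∸ part δ (suc i)) λ i p → trans (cong (_∸ part δ (suc i)) (part-beyond γ (s≤s p))) (ℕₚ.0∸n≡0 (part δ (suc i))))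
    where
    extend : ∀ m k f → (∀ i → k ≤ i → f i ≡ 0) → sum (applyUpTo f k) ≡ sum (applyUpTo f (k + m))
    extend zero zero f z = refl
    extend (suc m) zero f z = trans (extend m zero (f ∘ suc) (λ i _ → z (suc i) z≤n)) (cong (_+ sum (applyUpTo (f ∘ suc) m)) (sym (z 0 z≤n)))
    extend m (suc k) f z = cong (f 0 +_) (extend m k (f ∘ suc) λ i p → z (suc i) (s≤s p))

length-rl : ∀ {γ δ} → δ ⊆ₚ γ → length (rl γ δ) + size δ ≡ size γ
length-rl {γ} {δ} s = trans (cong (_+ size δ) (↭ₚ.↭-length (rl-↭ γ δ))) (length-skewBoxes {γ} {δ} s)

Std-size : ∀ {γ δ t} → δ ⊆ₚ γ → Std γ δ t → length t + size δ ≡ size γ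
Std-size {γ} {δ} s S = trans (cong (_+ size δ) (↭ₚ.↭-length (Std-↭ S))) (length-skewBoxes {γ} {δ} s)

-- Permutations

module _ {A : Set} where

  ∈-insertions⁺ : ∀ {x : A} a b → a ++ x ∷ b ∈ insertions x (a ++ b)
  ∈-insertions⁺ [] [] = here refl
  ∈-insertions⁺ [] (y ∷ b) = here refl
  ∈-insertions⁺ (y ∷ a) b = there (∈-map⁺ (y ∷_) (∈-insertions⁺ a b))

  insertions-↭ : ∀ {x : A} ys {zs} → zs ∈ insertions x ys → zs ↭ x ∷ ys
  insertions-↭ [] (here refl) = ↭-refl
  insertions-↭ (y ∷ ys) (here refl) = ↭-refl
  insertions-↭ (y ∷ ys) (there i) with ∈-map⁻ (y ∷_) i
  ... | zs , j , refl = ↭-trans (↭-prep y (insertions-↭ ys j)) (↭-swap y _ ↭-refl)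

  ∈-perms⁺ : ∀ xs {t : List A} → t ↭ xs → t ∈ perms xs
  ∈-perms⁺ [] p with ↭ₚ.↭-empty-inv p
  ... | refl = here refl
  ∈-perms⁺ (x ∷ xs) p with ∈-∃++ (↭ₚ.∈-resp-↭ (↭-sym p) (here refl))
  ... | a , b , refl = ∈-concatMap⁺ (∈-perms⁺ xs (↭ₚ.drop-mid a [] p)) (∈-insertions⁺ a b)

  ∈-perms⁻ : ∀ xs {t : List A} → t ∈ perms xs → t ↭ xs
  ∈-perms⁻ [] (here refl) = ↭-refl
  ∈-perms⁻ (x ∷ xs) i with ∈-concatMap⁻ (perms xs) i
  ... | ys , j , k = ↭-trans (insertions-↭ ys k) (↭-prep x (∈-perms⁻ xs j))

  insertions-unique : ∀ {x : A} ys → x ∉ ys → Unique (insertions x ys)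
  insertions-unique [] n = [] ∷ []
  insertions-unique {x} (y ∷ ys) n = All.tabulate (λ i e → n (here (h (subst (_∈ _) (sym e) i))))
    ∷ Uniqueₚ.map⁺ Listₚ.∷-injectiveʳ (insertions-unique ys (n ∘ there))
    where
    h : ∀ {zs} → x ∷ zs ∈ map (y ∷_) (insertions x ys) → x ≡ y
    h i with ∈-map⁻ (y ∷_) i
    ... | _ , _ , refl = refl

  -- As `x` occurs in neither list, it occurs exactly once in the result, and deleting it recovers
  -- the list.
  insertions-injective : ∀ {x : A} ys ys' {zs} → x ∉ ys → x ∉ ys' → zs ∈ insertions x ys → zs ∈ insertions x ys' → ys ≡ ys'
  insertions-injective [] [] n n' i j = refl
  insertions-injective [] (y ∷ ys') n n' (here refl) (there j) with ∈-map⁻ (y ∷_) j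
  ... | _ , _ , refl = ⊥-elim (n' (here refl))
  insertions-injective (y ∷ ys) [] n n' (there i) (here refl) with ∈-map⁻ (y ∷_) i
  ... | _ , _ , refl = ⊥-elim (n (here refl))
  insertions-injective (y ∷ ys) (y' ∷ ys') n n' (here refl) (here refl) = refl
  insertions-injective (y ∷ ys) (y' ∷ ys') n n' (here refl) (there j) with ∈-map⁻ (y' ∷_) j
  ... | _ , _ , refl = ⊥-elim (n' (here refl))
  insertions-injective (y ∷ ys) (y' ∷ ys') n n' (there i) (here refl) with ∈-map⁻ (y ∷_) i
  ... | _ , _ , refl = ⊥-elim (n (here refl))
  insertions-injective (y ∷ ys) (y' ∷ ys') n n' (there i) (there j) with ∈-map⁻ (y ∷_) i | ∈-map⁻ (y' ∷_) j
  ... | _ , k , refl | _ , l , refl = cong (y ∷_) (insertions-injective ys ys' (n ∘ there) (n' ∘ there) k l)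

  perms-unique : ∀ {xs : List A} → Unique xs → Unique (perms xs)
  perms-unique [] = [] ∷ []
  perms-unique {x ∷ xs} (n ∷ u) = AllPairs-concatMap {Q = λ ys ys' → ys ≢ ys' × x ∉ ys × x ∉ ys'}
    (enrich (perms-unique u) λ i j → All.lookup n (↭ₚ.∈-resp-↭ (∈-perms⁻ xs i) j) refl)
    (λ {ys} i → insertions-unique ys λ j → All.lookup n (↭ₚ.∈-resp-↭ (∈-perms⁻ xs i) j) refl)
    λ { {ys} {ys'} (q , a , b) i j refl → q (insertions-injective ys ys' a b i j) }
    where
    enrich : ∀ {zss : List (List A)} → Unique zss → (∀ {zs} → zs ∈ zss → x ∉ zs) → AllPairs (λ ys ys' → ys ≢ ys' × x ∉ ys × x ∉ ys') zss
    enrich [] f = []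
    enrich (r ∷ rs) f = All.tabulate (λ i → All.lookup r i , f (here refl) , f (there i)) ∷ enrich rs (f ∘ there)

-- Enumerations of partitions

∈-partsBounded⁻ : ∀ f n m {κ} → κ ∈ partsBounded f n m → IsPartition κ × size κ ≡ n × part κ 1 ≤ m
∈-partsBounded⁻ zero zero m (here refl) = ([] , []) , refl , z≤n
∈-partsBounded⁻ (suc f) zero m (here refl) = ([] , []) , refl , z≤n
∈-partsBounded⁻ (suc f) (suc n) m i with ∈-concatMap⁻ {f = λ k → map (k ∷_) (partsBounded f (suc n ∸ k) k)} (filterB (λ k → k ≤ᵇ m) (range1 (suc n))) i
... | k , j , l with ∈-filterB⁻ {p = λ k → k ≤ᵇ m} (range1 (suc n)) j | ∈-map⁻ (k ∷_) l
... | a , b | κ , c , refl with ∈-partsBounded⁻ f (suc n ∸ k) k c | ∈-range1⁻ a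
... | (p , q) , s , h | k⁺ , k≤ = ((k⁺ ∷ p) , link κ q h) , trans (cong (k +_) s) (ℕₚ.m+[n∸m]≡n k≤) , ≤ᵇ-elim b
  where
  link : ∀ xs → Linked ℕ._≥_ xs → part xs 1 ≤ k → Linked ℕ._≥_ (k ∷ xs)
  link [] _ _ = [-]
  link (x ∷ xs) l h = h ∷ l

∈-partsBounded⁺ : ∀ f n m {κ} → IsPartition κ → size κ ≡ n → part κ 1 ≤ m → n ≤ f → κ ∈ partsBounded f n m
∈-partsBounded⁺ zero zero m {[]} P e l _ = here refl
∈-partsBounded⁺ (suc f) zero m {[]} P e l _ = here refl
∈-partsBounded⁺ zero zero m {suc k ∷ κ} P () l _
∈-partsBounded⁺ (suc f) zero m {suc k ∷ κ} P () l _
∈-partsBounded⁺ f zero m {zero ∷ κ} (() ∷ _ , _) e l _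
∈-partsBounded⁺ (suc f) (suc n) m {k ∷ κ} ((k⁺ ∷ p) , q) e l (s≤s n≤) =
  ∈-concatMap⁺ {f = λ k → map (k ∷_) (partsBounded f (suc n ∸ k) k)} (∈-filterB⁺ {p = λ k → k ≤ᵇ m} (∈-range1⁺ k⁺ (subst (k ≤_) e (ℕₚ.m≤m+n k (size κ)))) (≤ᵇ-intro l))
    (∈-map⁺ (k ∷_) (∈-partsBounded⁺ f (suc n ∸ k) k (p , Linked.tail q) (trans (sym (ℕₚ.m+n∸m≡n k (size κ))) (cong (_∸ k) e)) (head q)
      (ℕₚ.≤-trans (ℕₚ.∸-monoʳ-≤ (suc n) k⁺) n≤)))
  where
  head : ∀ {κ} → Linked ℕ._≥_ (k ∷ κ) → part κ 1 ≤ k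
  head [-] = z≤n
  head (h ∷ _) = h

∈-map-∷ : ∀ {k k' : ℕ} {xs ys : List (List ℕ)} {x y : List ℕ} → x ∈ map (k ∷_) xs → y ∈ map (k' ∷_) ys → x ≡ y → k ≡ k'
∈-map-∷ i j refl with ∈-map⁻ (_ ∷_) i | ∈-map⁻ (_ ∷_) j
... | _ , _ , refl | _ , _ , refl = refl

partsBounded-unique : ∀ f n m → Unique (partsBounded f n m)
partsBounded-unique zero zero m = [] ∷ []
partsBounded-unique (suc f) zero m = [] ∷ []
partsBounded-unique zero (suc n) m = []
partsBounded-unique (suc f) (suc n) m = AllPairs-concatMap {f = λ k → map (k ∷_) (partsBounded f (suc n ∸ k) k)} (AllPairs-filterB (λ k → k ≤ᵇ m) (range1-< (suc n)))
  (λ {k} _ → Uniqueₚ.map⁺ Listₚ.∷-injectiveʳ (partsBounded-unique f (suc n ∸ k) k))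
  λ p a b e → ℕₚ.<⇒≢ p (∈-map-∷ a b e)

∈-partitionsOf⁺ : ∀ {n κ} → IsPartition κ → size κ ≡ n → κ ∈ partitionsOf n
∈-partitionsOf⁺ {n} {κ} P refl = ∈-partsBounded⁺ n n n P refl (first κ) ℕₚ.≤-refl
  where
  first : ∀ κ → part κ 1 ≤ size κ
  first [] = z≤n
  first (x ∷ κ) = ℕₚ.m≤m+n x _

∈-partitionsOf⁻ : ∀ {n κ} → κ ∈ partitionsOf n → IsPartition κ × size κ ≡ n
∈-partitionsOf⁻ {n} i with ∈-partsBounded⁻ n n n i
... | p , q , _ = p , q

containedB⁻ : ∀ {κ κ'} → containedB κ κ' ≡ true → κ ⊆ₚ κ'
containedB⁻ {κ} {κ'} e {b} p = positive p , ℕₚ.≤-trans (fits p) (≤ᵇ-elim (allB-elim {xs = range1 (length κ)} e (∈-range1⁺ (proj₁ (positive p)) (row≤length p))))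

containedB⁺ : ∀ {κ κ'} → κ ⊆ₚ κ' → containedB κ κ' ≡ true
containedB⁺ {κ} {κ'} s = allB-intro (range1 (length κ)) λ i → ≤ᵇ-intro (⊆ₚ-part {κ} {κ'} s (proj₁ (∈-range1⁻ i)))

∈-subPartitions⁺ : ∀ {κ κ'} → IsPartition κ → κ ⊆ₚ κ' → κ ∈ subPartitions κ'
∈-subPartitions⁺ {κ} {κ'} P s = ∈-concatMap⁺ {f = λ k → filterB (λ μ → containedB μ κ') (partitionsOf k)} {xs = 0 ∷ range1 (size κ')} (h (size κ) refl) (∈-filterB⁺ {p = λ μ → containedB μ κ'} (∈-partitionsOf⁺ P refl) (containedB⁺ {κ} {κ'} s))
  where
  h : ∀ k → k ≡ size κ → k ∈ 0 ∷ range1 (size κ')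
  h zero _ = here refl
  h (suc k) e = there (∈-range1⁺ (s≤s z≤n) (subst (_≤ size κ') (sym e) (size-⊆ {κ} {κ'} s)))

∈-subPartitions⁻ : ∀ {κ κ'} → κ ∈ subPartitions κ' → IsPartition κ × κ ⊆ₚ κ'
∈-subPartitions⁻ {κ} {κ'} i with ∈-concatMap⁻ {f = λ k → filterB (λ μ → containedB μ κ') (partitionsOf k)} (0 ∷ range1 (size κ')) i
... | k , _ , j with ∈-filterB⁻ {p = λ μ → containedB μ κ'} (partitionsOf k) j
... | l , e = proj₁ (∈-partitionsOf⁻ {k} l) , containedB⁻ {κ} {κ'} e

subPartitions-unique : ∀ κ → Unique (subPartitions κ)
subPartitions-unique κ = AllPairs-concatMap {Q = _≢_} (All.tabulate (λ i e → ℕₚ.<⇒≢ (proj₁ (∈-range1⁻ i)) e) ∷ AllPairs.map ℕₚ.<⇒≢ (range1-< (size κ)))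
  (λ {k} _ → AllPairs-filterB (λ μ → containedB μ κ) (partsBounded-unique k k k))
  λ {k} {k'} p a b e → p (trans (sym (proj₂ (∈-partitionsOf⁻ {k} (proj₁ (∈-filterB⁻ {p = λ μ → containedB μ κ} (partitionsOf k) a)))))
    (trans (cong size e) (proj₂ (∈-partitionsOf⁻ {k'} (proj₁ (∈-filterB⁻ {p = λ μ → containedB μ κ} (partitionsOf k') b))))))

-- Remmel-Whitney tableaux as pictures

record Tab (γ δ α β : Partition) (P : List Entry) : Set where
  field
    cells : map cell P ≡ rl α β
    pic : Pic P
    std : Std γ δ (boxes P)

o : Box
o = 0 , 0

-- `isStandardB` compares boxes of a common row or column only. For boxes in general position the
-- corner in the row of the one and the column of the other belongs to the skew shape, and wherever
-- its label falls, one of the two comparisons with it gives the contradiction.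
stdTableaux-sound : ∀ {γ δ t} → IsPartition γ → IsPartition δ → t ∈ stdTableaux γ δ → Std γ δ t
stdTableaux-sound {γ} {δ} {t} G D i with ∈-filterB⁻ {p = isStandardB} (perms (skewBoxes γ δ)) i
... | j , e = mkStd (AllPairs-at⁺ o t order) (∈-skewBoxes⁻ ∘ ↭ₚ.∈-resp-↭ t↭) complete
  where
  t↭ : t ↭ skewBoxes γ δ
  t↭ = ∈-perms⁻ (skewBoxes γ δ) j
  complete : ∀ {b} → InSkew γ δ b → b ∈ t
  complete = ↭ₚ.∈-resp-↭ (↭-sym t↭) ∘ ∈-skewBoxes⁺
  increasing : ∀ {k l} → 0 < k → k < l → l ≤ length t →
    (row (boxOf t k) ≡ row (boxOf t l) → col (boxOf t k) < col (boxOf t l)) ×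
    (col (boxOf t k) ≡ col (boxOf t l) → row (boxOf t k) < row (boxOf t l))
  increasing {k} {l} p q r with ∧-elim {(row (boxOf t k) ≡ᵇ row (boxOf t l)) ⇒B (col (boxOf t k) <ᵇ col (boxOf t l))}
      (⇒B-elim (allB-elim {xs = range1 (length t)} (allB-elim {xs = range1 (length t)} e (∈-range1⁺ p (ℕₚ.≤-trans (ℕₚ.<⇒≤ q) r))) (∈-range1⁺ (ℕₚ.<-trans p q) r)) (<ᵇ-intro q))
  ... | a , b = (λ z → <ᵇ-elim (⇒B-elim a (≡ᵇ-intro z))) , λ z → <ᵇ-elim (⇒B-elim b (≡ᵇ-intro z))
  order : ∀ {k l} → 0 < k → k < l → l ≤ length t → boxOf t k ⋠ boxOf t l
  order {k} {l} p q r (u , v) = via (∈-at o (complete corner))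
    where
    x = boxOf t k
    y = boxOf t l
    corner : InSkew γ δ (row y , col x)
    corner = InSkew-convex G D (∈-skewBoxes⁻ (↭ₚ.∈-resp-↭ t↭ (at-∈ o t (ℕₚ.<-trans p q) r))) (∈-skewBoxes⁻ (↭ₚ.∈-resp-↭ t↭ (at-∈ o t p (ℕₚ.≤-trans (ℕₚ.<⇒≤ q) r))))
      (ℕₚ.≤-refl , v) (u , ℕₚ.≤-refl)
    via : ∃[ m ] (0 < m × m ≤ length t × boxOf t m ≡ (row y , col x)) → ⊥
    via (m , m⁺ , m≤ , em) with ℕₚ.<-cmp m k
    ... | tri< m<k _ _ = ℕₚ.<⇒≱ (proj₁ (increasing m⁺ (ℕₚ.<-trans m<k q) r) (cong row em)) (subst (col y ≤_) (sym (cong col em)) v)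
    ... | tri≈ _ refl _ = ℕₚ.<⇒≱ (proj₁ (increasing p q r) (cong row em)) v
    ... | tri> _ _ k<m = ℕₚ.<⇒≱ (proj₂ (increasing p k<m m≤) (sym (cong col em))) (subst (_≤ row x) (sym (cong row em)) u)

stdTableaux-complete : ∀ {γ δ t} → Std γ δ t → t ∈ stdTableaux γ δ
stdTableaux-complete {γ} {δ} {t} S = ∈-filterB⁺ {p = isStandardB} (∈-perms⁺ (skewBoxes γ δ) (Std-↭ S))
  (allB-intro (range1 (length t)) λ {k} i → allB-intro (range1 (length t)) λ {l} j → ⇒B-intro λ q →
    ∧-intro (⇒B-intro λ e → <ᵇ-intro (ℕₚ.≰⇒> λ h → order i j q (ℕₚ.≤-reflexive (sym (≡ᵇ-elim e)) , h)))
            (⇒B-intro λ e → <ᵇ-intro (ℕₚ.≰⇒> λ h → order i j q (h , ℕₚ.≤-reflexive (sym (≡ᵇ-elim e))))))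
  where
  order : ∀ {k l} → k ∈ range1 (length t) → l ∈ range1 (length t) → (k <ᵇ l) ≡ true → boxOf t k ⋠ boxOf t l
  order i j q = AllPairs-at⁻ o (Std.order S) (proj₁ (∈-range1⁻ i)) (<ᵇ-elim q) (proj₂ (∈-range1⁻ j))

suc-∸1 : ∀ {k} n → 0 < k → k ≤ n ∸ 1 → suc k ≤ n
suc-∸1 zero p q = ⊥-elim (ℕₚ.<⇒≱ p q)
suc-∸1 (suc n) p q = s≤s q

-- (i) is tested for consecutive labels only; this covers a whole row because the labels of a row of
-- `rl` are consecutive and `Ordered` is transitive.
rwCondB-sound : ∀ {α β t} → IsPartition α → IsPartition β → rwCondB α β t ≡ true → length t ≡ length (rl α β) × Pic (zip (rl α β) t)
rwCondB-sound {α} {β} {t} A B e with ∧-elim {length t ≡ᵇ length (rl α β)} e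
... | e₁ , e' with ∧-elim {allB _ (range1 (length (rl α β) ∸ 1))} e'
... | e₂ , e₃ = len , record
  { ordered = Linkedₚ.Linked⇒AllPairs (λ {x} {y} {z} → Fwd.Ordered-trans {x} {y} {z}) (Linked-at⁺ (o , o) P linked)
  ; convex = λ i j p q → subst (_ ∈_) (sym cells) (∈-rl⁺ (InSkew-convex A B (∈-rl⁻ (subst (_ ∈_) cells i)) (∈-rl⁻ (subst (_ ∈_) cells j)) p q))
  ; desc = desc }
  where
  r = rl α β
  P = zip r t
  len : length t ≡ length r
  len = ≡ᵇ-elim e₁
  cells : map cell P ≡ r
  cells = map₁-zip r t (sym len)
  lenP : length P ≡ length r
  lenP = trans (length-zip r t (sym len)) len
  atP : ∀ i → at (o , o) P i ≡ (boxOf r i , boxOf t i)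
  atP = at-zip o o r t (sym len)
  linked : ∀ {k} → 0 < k → k ≤ length P ∸ 1 → Ordered (at (o , o) P k) (at (o , o) P (suc k))
  linked {k} p q rewrite atP k | atP (suc k) | lenP = AllPairs-at⁻ o (rl-sorted α β) p ℕₚ.≤-refl (suc-∸1 (length r) p q)
    , λ h → let (a , b) = ∧-elim {col (boxOf t k) <ᵇ col (boxOf t (suc k))} (⇒B-elim (allB-elim {xs = range1 (length r ∸ 1)} e₂ (∈-range1⁺ p q)) (≡ᵇ-intro h)) in <ᵇ-elim a , ≤ᵇ-elim b
  desc : ∀ {x y} → x ∈ P → y ∈ P → Below (cell x) (cell y) → Desc (box x) (box y)
  desc i j (u , v) with ∈-at (o , o) i | ∈-at (o , o) j
  ... | k , k⁺ , k≤ , refl | l , l⁺ , l≤ , refl rewrite atP k | atP l | lenP =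
    let (a , b) = ∧-elim {row (boxOf t k) <ᵇ row (boxOf t l)} (⇒B-elim (allB-elim {xs = range1 (length r)} (allB-elim {xs = range1 (length r)} e₃ (∈-range1⁺ k⁺ k≤)) (∈-range1⁺ l⁺ l≤)) (∧-intro (≡ᵇ-intro u) (≡ᵇ-intro v))) in <ᵇ-elim a , ≤ᵇ-elim b

RW-sound : ∀ {γ δ α β t} → IsPartition γ → IsPartition δ → IsPartition α → IsPartition β → t ∈ RW γ δ α β →
  Tab γ δ α β (zip (rl α β) t) × boxes (zip (rl α β) t) ≡ t
RW-sound {γ} {δ} {α} {β} {t} G D A B i with ∈-filterB⁻ {p = rwCondB α β} (stdTableaux γ δ) i
... | j , e with rwCondB-sound {α} {β} {t} A B e
... | len , pic = record { cells = map₁-zip (rl α β) t (sym len) ; pic = pic ; std = subst (Std γ δ) (sym bt) (stdTableaux-sound G D j) } , bt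
  where bt = map₂-zip (rl α β) t (sym len)

RW-complete : ∀ {γ δ α β P} → Tab γ δ α β P → boxes P ∈ RW γ δ α β
RW-complete {γ} {δ} {α} {β} {P} tab = ∈-filterB⁺ {p = rwCondB α β} (stdTableaux-complete (Tab.std tab))
  (∧-intro (≡ᵇ-intro (trans (Listₚ.length-map box P) lenP))
  (∧-intro (allB-intro (range1 (length r ∸ 1)) λ i → ⇒B-intro λ h → let (a , b) = asc i (≡ᵇ-elim h) in ∧-intro (<ᵇ-intro a) (≤ᵇ-intro b))
    (allB-intro (range1 (length r)) λ i → allB-intro (range1 (length r)) λ {l} j → ⇒B-intro λ h → let (a , b) = desc i j h in ∧-intro (<ᵇ-intro a) (≤ᵇ-intro b))))
  where
  open Tab tab
  r = rl α β
  t = boxes P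
  lenP : length P ≡ length r
  lenP = trans (sym (Listₚ.length-map cell P)) (cong length cells)
  zipP : zip r t ≡ P
  zipP = trans (cong (λ z → zip z t) (sym cells)) (zip-map P)
  atP : ∀ i → at (o , o) P i ≡ (boxOf r i , boxOf t i)
  atP i = trans (cong (λ z → at (o , o) z i) (sym zipP)) (at-zip o o r t (sym (trans (Listₚ.length-map box P) lenP)) i)
  asc : ∀ {k} → k ∈ range1 (length r ∸ 1) → row (boxOf r k) ≡ row (boxOf r (suc k)) → Asc (boxOf t k) (boxOf t (suc k))
  asc {k} i h with subst₂ Ordered (atP k) (atP (suc k)) (AllPairs-at⁻ (o , o) (Pic.ordered pic) (proj₁ (∈-range1⁻ i)) ℕₚ.≤-refl
      (subst (suc k ≤_) (sym lenP) (suc-∸1 (length r) (proj₁ (∈-range1⁻ i)) (proj₂ (∈-range1⁻ i)))))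
  ... | _ , f = f h
  member : ∀ {k} → k ∈ range1 (length r) → (boxOf r k , boxOf t k) ∈ P
  member {k} i = subst (_∈ P) (atP k) (at-∈ (o , o) P (proj₁ (∈-range1⁻ i)) (subst (k ≤_) (sym lenP) (proj₂ (∈-range1⁻ i))))
  desc : ∀ {k l} → k ∈ range1 (length r) → l ∈ range1 (length r) → ((col (boxOf r k) ≡ᵇ col (boxOf r l)) ∧ (row (boxOf r l) ≡ᵇ suc (row (boxOf r k)))) ≡ true →
    Desc (boxOf t k) (boxOf t l)
  desc {k} {l} i j h with ∧-elim {col (boxOf r k) ≡ᵇ col (boxOf r l)} h
  ... | u , v = Pic.desc pic (member i) (member j) (≡ᵇ-elim u , ≡ᵇ-elim v)

zip-boxes : ∀ {γ δ α β P} → Tab γ δ α β P → zip (rl α β) (boxes P) ≡ P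
zip-boxes {P = P} tab = trans (cong (λ z → zip z (boxes P)) (sym (Tab.cells tab))) (zip-map P)

RW-unique : ∀ γ δ α β → Unique (RW γ δ α β)
RW-unique γ δ α β = AllPairs-filterB (rwCondB α β) (AllPairs-filterB isStandardB (perms-unique (skewBoxes-unique γ δ)))

-- Infusion on tableaux

record Stacked (μ ν : Partition) (β γ α ε : Partition) (s u : List Entry) : Set where
  field
    middle : Partition
    partition : IsPartition middle
    lower : ν ⊆ₚ middle
    upper : middle ⊆ₚ μ
    left : Tab middle ν β γ s
    right : Tab μ middle α ε u

  joined : Std μ ν (boxes s ++ boxes u)
  joined = Std-join partition lower upper (Tab.std left) (Tab.std right)

stacked-valid : ∀ {μ ν β γ α ε s u} → IsPartition μ → IsPartition ν → Stacked μ ν β γ α ε s u → Valid (boxes s ++ (boxes u ++ []))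
stacked-valid {s = s} {u} M N S = subst (λ x → Valid (boxes s ++ x)) (sym (Listₚ.++-identityʳ (boxes u))) (Std-valid M N (Stacked.joined S))

module _ {μ ν α ε β γ : Partition} (M : IsPartition μ) (N : IsPartition ν) where

  private
    -- The passes permute the boxes of the union and keep the joint word valid, so cutting this word
    -- after `s` yields the new partition in the middle.
    restack : ∀ {α ε β γ t₁ t₂ s u} → Stacked μ ν α ε β γ t₁ t₂ → boxes t₁ ++ boxes t₂ ↭ boxes s ++ boxes u → Valid (boxes s ++ (boxes u ++ [])) →
      map cell s ≡ rl β γ → map cell u ≡ rl α ε → Pic s → Pic u → Stacked μ ν β γ α ε s u
    restack {s = s} {u} S p v cs cu ps pu = record
      { middle = Split.middle sp ; partition = Split.partition sp ; lower = Split.lower sp ; upper = Split.upper sp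
      ; left = record { cells = cs ; pic = ps ; std = Split.left sp }
      ; right = record { cells = cu ; pic = pu ; std = Split.right sp } }
      where
      J = Stacked.joined S
      sp : Split μ ν (boxes s) (boxes u)
      sp = Std-split M N (Stacked.upper S ∘ Stacked.lower S) (mkStd (proj₁ (subst (λ x → Valid (boxes s ++ x)) (Listₚ.++-identityʳ (boxes u)) v))
        (Std.sound J ∘ ↭ₚ.∈-resp-↭ (↭-sym p)) (↭ₚ.∈-resp-↭ p ∘ Std.complete J))

  infuse-Stacked : ∀ {t₁ t₂} → Stacked μ ν α ε β γ t₁ t₂ → Stacked μ ν β γ α ε (proj₁ (infuse t₁ t₂)) (proj₂ (infuse t₁ t₂))
  infuse-Stacked {t₁} {t₂} S = restack S (Grid-↭ G) (Grid-valid [] G v)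
    (trans (proj₁ (Grid-cells G)) (Tab.cells (Stacked.right S))) (trans (proj₂ (Grid-cells G)) (Tab.cells (Stacked.left S)))
    (Grid-Pic₁ [] G v (Tab.pic (Stacked.right S))) (Grid-Pic₂ [] t₂ G v (Tab.pic (Stacked.left S)))
    where
    G = infuse-Grid t₁ t₂
    v = stacked-valid M N S

  uninfuse-Stacked : ∀ {s u} → Stacked μ ν β γ α ε s u → Stacked μ ν α ε β γ (proj₁ (uninfuse s u)) (proj₂ (uninfuse s u))
  uninfuse-Stacked {s} {u} S = restack S (↭-sym (Grid-↭ G)) v
    (trans (sym (proj₂ (Grid-cells G))) (Tab.cells (Stacked.right S))) (trans (sym (proj₁ (Grid-cells G))) (Tab.cells (Stacked.left S)))
    (Grid-Pic₂⁻ [] (proj₂ (uninfuse s u)) G v (Tab.pic (Stacked.right S))) (Grid-Pic₁⁻ [] G v (Tab.pic (Stacked.left S)))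
    where
    G = proj₁ (uninfuse-Grid [] s u (stacked-valid M N S))
    v = proj₂ (uninfuse-Grid [] s u (stacked-valid M N S))

  uninfuse-infuse : ∀ {t₁ t₂} → Stacked μ ν α ε β γ t₁ t₂ → uninfuse (proj₁ (infuse t₁ t₂)) (proj₂ (infuse t₁ t₂)) ≡ (t₁ , t₂)
  uninfuse-infuse {t₁} {t₂} S = Grid-uninfuse [] (infuse-Grid t₁ t₂) (stacked-valid M N S)

  infuse-uninfuse : ∀ {s u} → Stacked μ ν β γ α ε s u → infuse (proj₁ (uninfuse s u)) (proj₂ (uninfuse s u)) ≡ (s , u)
  infuse-uninfuse {s} {u} S = Grid-infuse (proj₁ (uninfuse-Grid [] s u (stacked-valid M N S)))

-- Jeu-de-taquin slides

eqBox-refl : ∀ b → eqBox b b ≡ true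
eqBox-refl (i , j) = ∧-intro (≡ᵇ-intro {i} refl) (≡ᵇ-intro {j} refl)

eqBox-≢ : ∀ {b c} → b ≢ c → eqBox b c ≡ false
eqBox-≢ {i , j} {k , l} n with eqBox (i , j) (k , l) in e
... | false = refl
... | true with ∧-elim {i ≡ᵇ k} e
...   | p , q = ⊥-elim (n (cong₂ _,_ (≡ᵇ-elim p) (≡ᵇ-elim q)))

labelAt-∉ : ∀ t {b} → b ∉ t → labelAt t b ≡ nothing
labelAt-∉ [] n = refl
labelAt-∉ (c ∷ t) {b} n rewrite eqBox-≢ {c} {b} (λ e → n (here (sym e))) | labelAt-∉ t (n ∘ there) = refl

labelAt-∈ : ∀ p {b r} → b ∉ p → labelAt (p ++ b ∷ r) b ≡ just (suc (length p))
labelAt-∈ [] {b} n rewrite eqBox-refl b = refl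
labelAt-∈ (c ∷ p) {b} {r} n rewrite eqBox-≢ {c} {b} (λ e → n (here (sym e))) | labelAt-∈ p {b} {r} (n ∘ there) = refl

-- For the other neighbour of the hole: it may be absent, but if present it has the larger label. So
-- the comparison in `slideFuel` picks the first of the two in the word.
labelAt-later : ∀ p {b c r} → c ∉ p → b ≢ c → labelAt (p ++ b ∷ r) c ≡ nothing ⊎ ∃[ l ] (labelAt (p ++ b ∷ r) c ≡ just l × suc (length p) < l)
labelAt-later [] {b} {c} {r} n e rewrite eqBox-≢ e with labelAt r c in q
... | nothing = inj₁ refl
... | just l = inj₂ (suc l , refl , s≤s (positive-label r q))
  where
  positive-label : ∀ r {l} → labelAt r c ≡ just l → 0 < l
  positive-label (x ∷ r) q with eqBox x c
  positive-label (x ∷ r) refl | true = s≤s z≤n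
  positive-label (x ∷ r) q | false with labelAt r c
  positive-label (x ∷ r) refl | false | just _ = s≤s z≤n
labelAt-later (x ∷ p) {b} {c} {r} n e rewrite eqBox-≢ {x} {c} (λ q → n (here (sym q))) with labelAt-later p {b} {c} {r} (n ∘ there) e
... | inj₁ q rewrite q = inj₁ refl
... | inj₂ (l , q , k) rewrite q = inj₂ (suc l , refl , s≤s k)

setAt-++ : ∀ p {b r e} → setAt (p ++ b ∷ r) (suc (length p)) e ≡ p ++ e ∷ r
setAt-++ [] = refl
setAt-++ (x ∷ p) = cong (x ∷_) (setAt-++ p)

module _ (zs : List Box) {e : Box} {r : List Box} (v : Valid (zs ʳ++ (e ∷ r))) where

  private
    p = reverse zs

    fresh : ∀ {x} → e ≼ x → x ∉ p
    fresh h i = Fwd.≼-above {zs} v (∈-reverse⁻ zs i) h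

  fresh-right : (row e , suc (col e)) ∉ p
  fresh-right = fresh (ℕₚ.≤-refl , ℕₚ.n≤1+n _)

  fresh-below : (suc (row e) , col e) ∉ p
  fresh-below = fresh (ℕₚ.n≤1+n _ , ℕₚ.≤-refl)

slideFuel-end : ∀ f t e → labelAt t (row e , suc (col e)) ≡ nothing → labelAt t (suc (row e) , col e) ≡ nothing → slideFuel f t e ≡ (t , e)
slideFuel-end zero t e _ _ = refl
slideFuel-end (suc f) t (i , j) p q rewrite p | q = refl

slideFuel-right : ∀ f p e r → (row e , suc (col e)) ∉ p → (suc (row e) , col e) ∉ p →
  slideFuel (suc f) (p ++ (row e , suc (col e)) ∷ r) e ≡ slideFuel f (p ++ e ∷ r) (row e , suc (col e))
slideFuel-right f p (i , j) r m n rewrite labelAt-∈ p {i , suc j} {r} m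
  with labelAt (p ++ (i , suc j) ∷ r) (suc i , j) | labelAt-later p {i , suc j} {suc i , j} {r} n (λ ())
... | _ | inj₁ refl rewrite setAt-++ p {i , suc j} {r} {i , j} = refl
... | _ | inj₂ (l , refl , k) rewrite <ᵇ-intro k | setAt-++ p {i , suc j} {r} {i , j} = refl

slideFuel-below : ∀ f p e r → (row e , suc (col e)) ∉ p → (suc (row e) , col e) ∉ p →
  slideFuel (suc f) (p ++ (suc (row e) , col e) ∷ r) e ≡ slideFuel f (p ++ e ∷ r) (suc (row e) , col e)
slideFuel-below f p (i , j) r m n rewrite labelAt-∈ p {suc i , j} {r} n
  with labelAt (p ++ (suc i , j) ∷ r) (i , suc j) | labelAt-later p {suc i , j} {i , suc j} {r} m (λ ())
... | _ | inj₁ refl rewrite setAt-++ p {suc i , j} {r} {i , j} = refl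
... | _ | inj₂ (l , refl , k) with l <ᵇ suc (length p) in q
...   | true = ⊥-elim (ℕₚ.<⇒≱ k (ℕₚ.<⇒≤ (<ᵇ-elim q)))
...   | false rewrite setAt-++ p {suc i , j} {r} {i , j} = refl

-- A `Pass` sends the hole to the first box of the remaining word that is adjacent to it, and this
-- is the neighbour with the smaller label. Skipped boxes join `zs`, where validity forbids
-- neighbours of the hole; only hops consume fuel.
slideFuel-Pass : ∀ zs f {e w w' g} → Pass e w w' g → length w ≤ f → Valid (zs ʳ++ (e ∷ boxes w)) →
  slideFuel f (zs ʳ++ boxes w) e ≡ (zs ʳ++ boxes w' , g)
slideFuel-Pass zs f {e} done _ v = slideFuel-end f _ e (labelAt-∉ _ (fresh-right zs v)) (labelAt-∉ _ (fresh-below zs v))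
slideFuel-Pass zs f {e} (skip {b = b} na P) l v = slideFuel-Pass (b ∷ zs) f P (ℕₚ.≤-trans (ℕₚ.n≤1+n _) l) (Fwd.swap zs v na)
slideFuel-Pass zs (suc f) {e} (hop {b = b} {w = w} a P) (s≤s l) v = trans (step a) (slideFuel-Pass (e ∷ zs) f P l v)
  where
  p = reverse zs
  step : Adj e b → slideFuel (suc f) (zs ʳ++ (b ∷ boxes w)) e ≡ slideFuel f (zs ʳ++ (e ∷ boxes w)) b
  step a rewrite Listₚ.ʳ++-defn zs {b ∷ boxes w} | Listₚ.ʳ++-defn zs {e ∷ boxes w} with a
  ... | inj₁ (refl , refl) = slideFuel-right f p e (boxes w) (fresh-right zs v) (fresh-below zs v)
  ... | inj₂ (refl , refl) = slideFuel-below f p e (boxes w) (fresh-right zs v) (fresh-below zs v)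

Slide-Grid : ∀ rp {t₁ t₂ s u q} → Grid t₁ t₂ s u → Valid (rp ʳ++ (boxes t₁ ++ (boxes t₂ ++ q))) → Slide (boxes t₁) (boxes t₂) ≡ boxes s
Slide-Grid rp nil v = refl
Slide-Grid rp (cons {e = e} {s₀ = s₀} G P) v =
  trans (cong (λ t → proj₁ (slide t e)) (Slide-Grid (e ∷ rp) G v))
        (cong proj₁ (slideFuel-Pass [] (suc (length (boxes s₀))) P (ℕₚ.≤-trans (ℕₚ.≤-reflexive (sym (Listₚ.length-map box s₀))) (ℕₚ.n≤1+n _))
          (prefix-valid rp (e ∷ boxes s₀) (Grid-valid (e ∷ rp) G v))))

Slide-infuse : ∀ {μ ν α ε β γ t₁ t₂} → IsPartition μ → IsPartition ν → Stacked μ ν α ε β γ t₁ t₂ →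
  Slide (boxes t₁) (boxes t₂) ≡ boxes (proj₁ (infuse t₁ t₂))
Slide-infuse {t₁ = t₁} {t₂} M N S = Slide-Grid [] (infuse-Grid t₁ t₂) (stacked-valid M N S)

-- Relative positions in a picture

AllPairs-∈ : {A : Set} {R Q : A → A → Set} {xs : List A} → (∀ {x y} → x ∈ xs → y ∈ xs → R x y → Q x y) → AllPairs R xs → AllPairs Q xs
AllPairs-∈ f [] = []
AllPairs-∈ f (r ∷ rs) = All.tabulate (λ i → f (here refl) (there i) (All.lookup r i)) ∷ AllPairs-∈ (λ i j → f (there i) (there j)) rs

RL? : ∀ {c d} → c ≢ d → RL c d ⊎ RL d c
RL? {c} {d} n with ℕₚ.<-cmp (row c) (row d) | ℕₚ.<-cmp (col c) (col d)
... | tri< p _ _ | _ = inj₁ (inj₁ p)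
... | tri> _ _ p | _ = inj₂ (inj₁ p)
... | tri≈ _ p _ | tri< q _ _ = inj₂ (inj₂ (sym p , q))
... | tri≈ _ p _ | tri> _ _ q = inj₁ (inj₂ (p , q))
... | tri≈ _ p _ | tri≈ _ q _ = ⊥-elim (n (cong₂ _,_ p q))

look : {A : Set} → A → List (Box × A) → Box → A
look a [] c = a
look a ((d , b) ∷ P) c with d ≟ᵇ c
... | yes _ = b
... | no _ = look a P c

look-∈ : {A : Set} {a b : A} {P : List (Box × A)} {c : Box} → (c , b) ∈ P → (c , look a P c) ∈ P
look-∈ {P = (d , b) ∷ P} {c} i with d ≟ᵇ c
... | yes refl = here refl
look-∈ {P = (d , b) ∷ P} {c} (here refl) | no n = ⊥-elim (n refl)
look-∈ {P = (d , b) ∷ P} {c} (there i) | no n = there (look-∈ i)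

module Picture {α β : Partition} (A : IsPartition α) (B : IsPartition β) {P : List Entry} (cells : map cell P ≡ rl α β) (pic : Pic P) where

  skew : ∀ {e} → e ∈ P → InSkew α β (cell e)
  skew i = ∈-rl⁻ (subst (_ ∈_) cells (∈-map⁺ cell i))

  entry : ∀ {c} → InSkew α β c → ∃[ b ] (c , b) ∈ P
  entry {c} p with ∈-map⁻ cell (subst (c ∈_) (sym cells) (∈-rl⁺ p))
  ... | (_ , b) , i , refl = b , i

  between : ∀ {e f c} → e ∈ P → f ∈ P → cell e ≼ c → c ≼ cell f → ∃[ b ] (c , b) ∈ P
  between i j p q = entry (InSkew-convex A B (skew i) (skew j) p q)

  same-cell : ∀ {c b b'} → (c , b) ∈ P → (c , b') ∈ P → b ≡ b'
  same-cell i j with AllPairs-compare (Pic.ordered pic) i j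
  ... | inj₁ refl = refl
  ... | inj₂ (inj₁ (p , _)) = ⊥-elim (Fwd.RL-irr p)
  ... | inj₂ (inj₂ (p , _)) = ⊥-elim (Fwd.RL-irr p)

  asc : ∀ {e f} → e ∈ P → f ∈ P → row (cell e) ≡ row (cell f) → col (cell f) < col (cell e) → Asc (box e) (box f)
  asc i j p l with AllPairs-compare (Pic.ordered pic) i j
  ... | inj₁ refl = ⊥-elim (ℕₚ.<-irrefl refl l)
  ... | inj₂ (inj₁ (_ , h)) = h p
  ... | inj₂ (inj₂ (k , _)) = ⊥-elim (Fwd.RL-asym k (inj₂ (p , l)))

  -- Condition (ii) iterated down a column of the convex set of cells. The row rule needs the
  -- quantitative form: the rows of the boxes grow at least as fast as the rows of the cells.
  desc : ∀ k {x y} {a b} → ((x , y) , a) ∈ P → ((x + suc k , y) , b) ∈ P → row a + suc k ≤ row b × col b ≤ col a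
  desc zero {x} {y} {a} {b} i j with Pic.desc pic i j (refl , ℕₚ.+-comm x 1)
  ... | p , q = subst (_≤ row b) (ℕₚ.+-comm 1 (row a)) p , q
  desc (suc k) {x} {y} {a} {b} i j with between {c = x + suc k , y} i j (ℕₚ.m≤m+n x (suc k) , ℕₚ.≤-refl) (ℕₚ.+-monoʳ-≤ x (ℕₚ.n≤1+n (suc k)) , ℕₚ.≤-refl)
  ... | m , im with desc k i im | Pic.desc pic im j (refl , ℕₚ.+-suc x (suc k))
  ...   | p , q | p' , q' = subst (_≤ row b) (sym (ℕₚ.+-suc (row a) (suc k))) (ℕₚ.≤-trans (s≤s p) p') , ℕₚ.≤-trans q' q

  desc-< : ∀ {x x' y a b} → ((x , y) , a) ∈ P → ((x' , y) , b) ∈ P → x < x' → row a + x' ≤ row b + x × row a < row b × col b ≤ col a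
  desc-< {x} {x'} {y} {a} {b} i j l with ℕₚ.m≤n⇒∃[o]m+o≡n l
  ... | k , refl with desc k i (subst (λ z → ((z , y) , b) ∈ P) (sym (ℕₚ.+-suc x k)) j)
  ...   | p , q = subst (_≤ row b + x) (trans (ℕₚ.+-assoc (row a) (suc k) x) (cong (λ z → row a + suc z) (ℕₚ.+-comm k x))) (ℕₚ.+-monoˡ-≤ x p) , ℕₚ.<-≤-trans (ℕₚ.m<m+n (row a) (s≤s z≤n)) p , q

  -- The cell in the row of `e` and the column of `f` mediates: it is read before `e` in the same
  -- row and lies above `f`, so (i) and (ii) apply to it.
  south-west : ∀ {e f} → e ∈ P → f ∈ P → row (cell e) < row (cell f) → col (cell e) < col (cell f) →
    ∃[ z ] ((row (cell e) , col (cell f)) , z) ∈ P × Asc z (box e) × Desc z (box f)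
  south-west i j p q with between i j (ℕₚ.≤-refl , ℕₚ.<⇒≤ q) (ℕₚ.<⇒≤ p , ℕₚ.≤-refl)
  ... | z , k = z , k , asc k i refl q , proj₂ (desc-< k j p)

  sw : ∀ {e f} → e ∈ P → f ∈ P → row (cell e) < row (cell f) → col (cell e) < col (cell f) → row (box e) < row (box f) × col (box f) < col (box e)
  sw i j p q = let (_ , _ , (a , b) , (c , d)) = south-west i j p q in ℕₚ.≤-<-trans b c , ℕₚ.≤-<-trans d a

-- Cutting and gluing tableaux along the row rule

Sat : ℕ → Entry → Set
Sat r e = r + row (cell e) ≤ row (box e) + col (cell e)

Sat? : ∀ r e → Dec (Sat r e)
Sat? r e = r + row (cell e) ℕₚ.≤? row (box e) + col (cell e)

satB : ℕ → Entry → Bool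
satB r (c , b) = rowRuleEntry r c ℤ.≤ᵇ ℤ.+ row b

satB⁻ : ∀ r e → satB r e ≡ true → Sat r e
satB⁻ r ((i , j) , (k , _)) p = ℤₚ.drop‿+≤+ (subst (ℤ._≤ ℤ.+ (k + j)) (ℤₚ.+-identityʳ (ℤ.+ (r + i))) (subst₂ ℤ._≤_ eq refl (ℤₚ.+-monoˡ-≤ (ℤ.+ j) (ℤₚ.≤ᵇ⇒≤ {(ℤ.+ r ℤ.+ ℤ.+ i) ℤ.- ℤ.+ j} (T⁺ p)))))
  where
  eq : (ℤ.+ (r + i) ℤ.- ℤ.+ j) ℤ.+ ℤ.+ j ≡ ℤ.+ (r + i) ℤ.+ ℤ.+ 0
  eq = trans (ℤₚ.+-assoc (ℤ.+ (r + i)) (ℤ.- ℤ.+ j) (ℤ.+ j)) (cong (λ z → ℤ.+ (r + i) ℤ.+ z) (ℤₚ.+-inverseˡ (ℤ.+ j)))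

satB⁺ : ∀ r e → Sat r e → satB r e ≡ true
satB⁺ r ((i , j) , (k , _)) p = T⁻ (ℤₚ.≤⇒≤ᵇ (subst (ℤ.+ (r + i) ℤ.- ℤ.+ j ℤ.≤_) eq (ℤₚ.+-monoˡ-≤ (ℤ.- ℤ.+ j) (ℤ.+≤+ p))))
  where
  eq : ℤ.+ (k + j) ℤ.- ℤ.+ j ≡ ℤ.+ k
  eq = trans (ℤₚ.+-assoc (ℤ.+ k) (ℤ.+ j) (ℤ.- ℤ.+ j)) (trans (cong (λ z → ℤ.+ k ℤ.+ z) (ℤₚ.+-inverseʳ (ℤ.+ j))) (ℤₚ.+-identityʳ (ℤ.+ k)))

unsB : ℕ → Entry → Bool
unsB r e = not (satB r e)

unsB⁻ : ∀ r e → unsB r e ≡ true → ¬ Sat r e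
unsB⁻ r e p s with satB r e | satB⁺ r e s
unsB⁻ r e () s | true | _

unsB⁺ : ∀ r e → ¬ Sat r e → unsB r e ≡ true
unsB⁺ r e n with satB r e in q
... | true = ⊥-elim (n (satB⁻ r e q))
... | false = refl

module RowRule (r : ℕ) where

  sats unsats : List Entry → List Entry
  sats = filterB (satB r)
  unsats = filterB (unsB r)

  ∈-sats⁺ : ∀ {P e} → e ∈ P → Sat r e → e ∈ sats P
  ∈-sats⁺ {e = e} i s = ∈-filterB⁺ {p = satB r} i (satB⁺ r e s)

  ∈-sats⁻ : ∀ P {e} → e ∈ sats P → e ∈ P × Sat r e
  ∈-sats⁻ P {e} i with ∈-filterB⁻ {p = satB r} P i
  ... | j , s = j , satB⁻ r e s

  ∈-unsats⁺ : ∀ {P e} → e ∈ P → ¬ Sat r e → e ∈ unsats P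
  ∈-unsats⁺ {e = e} i s = ∈-filterB⁺ {p = unsB r} i (unsB⁺ r e s)

  ∈-unsats⁻ : ∀ P {e} → e ∈ unsats P → e ∈ P × ¬ Sat r e
  ∈-unsats⁻ P {e} i with ∈-filterB⁻ {p = unsB r} P i
  ... | j , s = j , unsB⁻ r e s

  module Filling {α β : Partition} (A : IsPartition α) (B : IsPartition β) {P : List Entry} (cells : map cell P ≡ rl α β) (pic : Pic P)
    (valid : Valid (boxes P)) where
    open Picture A B cells pic public

    order : ∀ {e f} → e ∈ P → f ∈ P → RL (cell e) (cell f) → box e ⋠ box f
    order i j p with AllPairs-compare (AllPairs.zip (Pic.ordered pic , AllPairsₚ.map⁻ (proj₁ valid))) i j
    ... | inj₁ refl = ⊥-elim (Fwd.RL-irr p)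
    ... | inj₂ (inj₁ (_ , h)) = h
    ... | inj₂ (inj₂ ((k , _) , _)) = ⊥-elim (Fwd.RL-asym k p)

    private
      before : ∀ {e f} → e ∈ P → f ∈ P → box e ≼ box f → box e ≢ box f → RL (cell e) (cell f)
      before {e} {f} i j p n with cell e ≟ᵇ cell f
      before i j p n | yes refl = ⊥-elim (n (same-cell i j))
      before i j p n | no m with RL? m
      ... | inj₁ k = k
      ... | inj₂ k = ⊥-elim (order j i k p)

      -- By the order of labels `e` is read before `f`, and `asc` and `sw` leave only one position:
      -- the cell of `f` is strictly lower and not further right. From `e` to `f` the row rule entry
      -- then grows by at least one, the row of the box by exactly one.
      up : ∀ {e f} → e ∈ P → f ∈ P → suc (row (box e)) ≡ row (box f) → col (box e) ≡ col (box f) → Sat r f → Sat r e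
      up {e} {f} i j p q s with before i j (ℕₚ.≤-trans (ℕₚ.n≤1+n _) (ℕₚ.≤-reflexive p) , ℕₚ.≤-reflexive q) (λ h → ℕₚ.1+n≢n (trans p (sym (cong row h))))
      ... | inj₂ (a , b) = ⊥-elim (ℕₚ.<⇒≢ (proj₁ (asc i j a b)) q)
      ... | inj₁ a with ℕₚ.<-≤-connex (col (cell e)) (col (cell f))
      ...   | inj₁ b = ⊥-elim (ℕₚ.<⇒≢ (proj₂ (sw i j a b)) (sym q))
      ...   | inj₂ b = ℕₚ.≤-pred (ℕₚ.≤-trans (subst (_≤ r + row (cell f)) (ℕₚ.+-suc r (row (cell e))) (ℕₚ.+-monoʳ-≤ r a))
                (ℕₚ.≤-trans s (subst (row (box f) + col (cell f) ≤_) (cong (_+ col (cell e)) (sym p)) (ℕₚ.+-monoʳ-≤ (row (box f)) b))))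

      left : ∀ {e f} → e ∈ P → f ∈ P → row (box e) ≡ row (box f) → suc (col (box e)) ≡ col (box f) → Sat r f → Sat r e
      left {e} {f} i j p q s = weaken (before i j (ℕₚ.≤-reflexive p , ℕₚ.≤-trans (ℕₚ.n≤1+n _) (ℕₚ.≤-reflexive q)) (λ h → ℕₚ.1+n≢n (trans q (sym (cong col h)))))
        where
        finish : row (cell e) ≤ row (cell f) → col (cell f) ≤ col (cell e) → Sat r e
        finish a b = ℕₚ.≤-trans (ℕₚ.+-monoʳ-≤ r a) (ℕₚ.≤-trans s (ℕₚ.+-mono-≤ (ℕₚ.≤-reflexive (sym p)) b))
        weaken : RL (cell e) (cell f) → Sat r e
        weaken (inj₂ (a , b)) = finish (ℕₚ.≤-reflexive a) (ℕₚ.<⇒≤ b)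
        weaken (inj₁ a) with ℕₚ.<-≤-connex (col (cell e)) (col (cell f))
        ... | inj₁ b = ⊥-elim (ℕₚ.<-asym (proj₂ (sw i j a b)) (subst (col (box e) <_) q ℕₚ.≤-refl))
        ... | inj₂ b = finish (ℕₚ.<⇒≤ a) b

    -- Convexity provides a path of single steps up or left from the box of `f` to that of `e`,
    -- along which `up` and `left` apply. So satisfying boxes may be given the smallest labels and
    -- form a tableau of their own.
    ideal : ∀ {e f} → e ∈ P → f ∈ P → box e ≼ box f → Sat r f → Sat r e
    ideal i j p s = go _ i j p s ℕₚ.≤-refl
      where
      lookup : ∀ {b} → b ∈ boxes P → ∃[ c ] (c , b) ∈ P
      lookup i with ∈-map⁻ box i
      ... | (c , _) , j , refl = c , j
      go : ∀ n {e f} → e ∈ P → f ∈ P → box e ≼ box f → Sat r f → row (box f) + col (box f) ≤ n → Sat r e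
      go n {_ , x , y} {_ , x' , y'} i j (p , q) s l with ℕₚ.<-≤-connex x x'
      go (suc n) {e} {f@(_ , suc x' , y')} i j (p , q) s (s≤s l) | inj₁ u
        with lookup (proj₂ valid {e = x' , y'} (∈-map⁺ box i) (∈-map⁺ box j) (ℕₚ.≤-pred u , q) (ℕₚ.n≤1+n x' , ℕₚ.≤-refl))
      ... | c , k = go n i k (ℕₚ.≤-pred u , q) (up k j refl refl s) l
      go n {_ , x , y} {_ , x' , y'} i j (p , q) s l | inj₂ u with ℕₚ.<-≤-connex y y'
      ... | inj₂ v with ℕₚ.≤-antisym p u | ℕₚ.≤-antisym q v
      ...   | refl | refl = same i j s
        where
        same : ∀ {c d b} → (c , b) ∈ P → (d , b) ∈ P → Sat r (d , b) → Sat r (c , b)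
        same {c} {d} i j s with c ≟ᵇ d
        ... | yes refl = s
        ... | no m with RL? m
        ...   | inj₁ k = ⊥-elim (order i j k Fwd.≼-refl)
        ...   | inj₂ k = ⊥-elim (order j i k Fwd.≼-refl)
      go zero {_ , x , y} {_ , x' , suc y'} i j (p , q) s l | inj₂ u | inj₁ v = ⊥-elim (ℕₚ.<⇒≱ (ℕₚ.<-≤-trans (s≤s z≤n) (ℕₚ.m≤n+m (suc y') x')) l)
      go (suc n) {_ , x , y} {_ , x' , suc y'} i j (p , q) s l | inj₂ u | inj₁ v
        with lookup (proj₂ valid {e = x' , y'} (∈-map⁺ box i) (∈-map⁺ box j) (p , ℕₚ.≤-pred v) (ℕₚ.≤-refl , ℕₚ.n≤1+n y'))
      ... | c , k = go n i k (p , ℕₚ.≤-pred v) (left k j refl refl s) (ℕₚ.≤-pred (subst (_≤ suc n) (ℕₚ.+-suc x' y') l))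

    -- The only way for a satisfying entry to be read after a violating one. The alternative, a cell
    -- further right or a box at least two rows lower, is what `conflict` uses to tell apart the
    -- positions of the hole.
    cross : ∀ {e f} → e ∈ P → f ∈ P → RL (cell e) (cell f) → ¬ Sat r e → Sat r f →
      (row (cell e) < row (cell f) × (col (cell e) < col (cell f) ⊎ suc (row (box e)) < row (box f))) × row (box e) < row (box f) × col (box f) < col (box e)
    cross {e} {f} i j (inj₂ (a , b)) n s = ⊥-elim (n (ℕₚ.≤-trans (ℕₚ.≤-reflexive (cong (r +_) a)) (ℕₚ.≤-trans s (ℕₚ.+-mono-≤ (proj₂ (asc i j a b)) (ℕₚ.<⇒≤ b)))))
    cross {e} {f} i j (inj₁ a) n s with ℕₚ.<-≤-connex (col (cell e)) (col (cell f))
    ... | inj₁ b = (a , inj₁ b) , sw i j a b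
    ... | inj₂ b = (a , inj₂ far) , ℕₚ.<-trans ℕₚ.≤-refl far , ℕₚ.≰⇒> λ h → n (ideal i j (ℕₚ.<⇒≤ (ℕₚ.<-trans ℕₚ.≤-refl far) , h) s)
      where
      -- `e` misses its row rule entry by at least one; the entry of `f`, in a lower row and not
      -- further right, is larger by at least one more.
      far : suc (row (box e)) < row (box f)
      far = ℕₚ.+-cancelʳ-≤ (col (cell e)) _ _ (ℕₚ.≤-trans (s≤s (ℕₚ.≰⇒> n)) (ℕₚ.≤-trans (subst (_≤ r + row (cell f)) (ℕₚ.+-suc r _) (ℕₚ.+-monoʳ-≤ r a)) (ℕₚ.≤-trans s (ℕₚ.+-monoʳ-≤ (row (box f)) b))))

    -- The surplus of the row of the box over the row rule entry never decreases to the right, by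
    -- (i), or downwards, by the quantitative form of (ii). Hence violating cells are closed under
    -- going north-west inside the shape and, with the inner shape, form a partition.
    violating-up : ∀ {e f} → e ∈ P → f ∈ P → cell f ≼ cell e → ¬ Sat r e → ¬ Sat r f
    violating-up {e@((x , y) , a)} {f@((x' , y') , b)} i j (p , q) n with between {c = x' , y} j i (ℕₚ.≤-refl , q) (p , ℕₚ.≤-refl)
    ... | z , k = λ s → n (vertical (horizontal s))
      where
      horizontal : Sat r f → Sat r ((x' , y) , z)
      horizontal s with ℕₚ.<-≤-connex y' y
      ... | inj₁ l = ℕₚ.≤-trans s (ℕₚ.+-mono-≤ (proj₂ (asc k j refl l)) q)
      ... | inj₂ l with ℕₚ.≤-antisym q l
      ...   | refl with same-cell k j
      ...     | refl = s
      vertical : Sat r ((x' , y) , z) → Sat r e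
      vertical s with ℕₚ.<-≤-connex x' x
      ... | inj₂ l with ℕₚ.≤-antisym p l
      ...   | refl with same-cell k i
      ...     | refl = s
      vertical s | inj₁ l = ℕₚ.+-cancelʳ-≤ x' _ _ (ℕₚ.≤-trans (ℕₚ.≤-reflexive (swapʳ r x x')) (ℕₚ.≤-trans (ℕₚ.+-monoˡ-≤ x s)
          (ℕₚ.≤-trans (ℕₚ.≤-reflexive (swapʳ (row z) y x)) (ℕₚ.≤-trans (ℕₚ.+-monoˡ-≤ y (proj₁ (desc-< k i l))) (ℕₚ.≤-reflexive (swapʳ (row a) x' y))))))
        where
        swapʳ : ∀ a b c → (a + b) + c ≡ (a + c) + b
        swapʳ a b c = trans (ℕₚ.+-assoc a b c) (trans (cong (a +_) (ℕₚ.+-comm b c)) (sym (ℕₚ.+-assoc a c b)))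

  record SatSplit (δ' β₁ β₂ γ' : Partition) (S U : List Entry) : Set where
    field
      {δ γ} : Partition
      δ-partition : IsPartition δ
      γ-partition : IsPartition γ
      β₁⊆δ : β₁ ⊆ₚ δ
      δ⊆δ' : δ ⊆ₚ δ'
      γ'⊆γ : γ' ⊆ₚ γ
      γ⊆β₂ : γ ⊆ₚ β₂
      left : Tab δ β₁ β₂ γ S
      right : Tab δ' δ γ γ' U

  Pic-⊆ : ∀ {P Q α β} → IsPartition α → IsPartition β → Pic P → (∀ {e} → e ∈ Q → e ∈ P) → AllPairs Ordered Q → map cell Q ≡ rl α β → Pic Q
  Pic-⊆ A B pic sub ord cells = record
    { ordered = ord
    ; convex = λ i j p q → subst (_ ∈_) (sym cells) (∈-rl⁺ (InSkew-convex A B (∈-rl⁻ (subst (_ ∈_) cells i)) (∈-rl⁻ (subst (_ ∈_) cells j)) p q))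
    ; desc = λ i j → Pic.desc pic (sub i) (sub j) }

  entries-sorted : ∀ {P} → AllPairs Ordered P → AllPairs (λ e f → RL (cell e) (cell f)) P
  entries-sorted = AllPairs.map proj₁

  entries-unique : ∀ {P Q} → AllPairs Ordered P → AllPairs Ordered Q → (∀ {e} → e ∈ P → e ∈ Q) → (∀ {e} → e ∈ Q → e ∈ P) → P ≡ Q
  entries-unique p q = sorted-unique {R = λ e f → RL (cell e) (cell f)} Fwd.RL-irr Fwd.RL-trans (entries-sorted p) (entries-sorted q)

  cells-unique : ∀ {P α β} → AllPairs Ordered P → (∀ {e} → e ∈ P → InSkew α β (cell e)) → (∀ {c} → InSkew α β c → c ∈ map cell P) → map cell P ≡ rl α β
  cells-unique {P} {α} {β} p f g = sorted-unique {R = RL} Fwd.RL-irr Fwd.RL-trans (AllPairs-map (entries-sorted p)) (rl-sorted α β)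
    (λ i → let (e , j , q) = ∈-map⁻ cell i in subst (_∈ rl α β) (sym q) (∈-rl⁺ (f j))) (g ∘ ∈-rl⁻)

  -- By `ideal` the satisfying boxes can be listed before the violating ones without spoiling the
  -- filling, which yields `δ`. By `violating-up` the violating cells together with `γ'` form the
  -- partition `γ`.
  sat-split : ∀ {δ' β₁ β₂ γ' P} → IsPartition δ' → IsPartition β₁ → IsPartition β₂ → IsPartition γ' → β₁ ⊆ₚ δ' → γ' ⊆ₚ β₂ →
    Tab δ' β₁ β₂ γ' P → SatSplit δ' β₁ β₂ γ' (sats P) (unsats P)
  sat-split {δ'} {β₁} {β₂} {γ'} {P} D' B₁ B₂ C' β⊆ γ⊆ tab = record
    { δ-partition = Split.partition sp ; γ-partition = shape-partition
    ; β₁⊆δ = Split.lower sp ; δ⊆δ' = Split.upper sp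
    ; γ'⊆γ = γ'⊆shape ; γ⊆β₂ = proj₁ ∘ ∈-shape⁻
    ; left = record { cells = cellsˡ ; pic = Pic-⊆ B₂ shape-partition pic (proj₁ ∘ ∈-sats⁻ P) ordˡ cellsˡ ; std = Split.left sp }
    ; right = record { cells = cellsʳ ; pic = Pic-⊆ shape-partition C' pic (proj₁ ∘ ∈-unsats⁻ P) ordʳ cellsʳ ; std = Split.right sp } }
    where
    open Tab tab
    open Filling B₂ C' cells pic (Std-valid D' B₁ std)
    ordˡ : AllPairs Ordered (sats P)
    ordˡ = AllPairs-filterB (satB r) (Pic.ordered pic)
    ordʳ : AllPairs Ordered (unsats P)
    ordʳ = AllPairs-filterB (unsB r) (Pic.ordered pic)
    ⋠-boxes : AllPairs (λ e f → box e ⋠ box f) P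
    ⋠-boxes = AllPairsₚ.map⁻ (Std.order std)
    std' : Std δ' β₁ (boxes (sats P) ++ boxes (unsats P))
    std' = mkStd
      (AllPairsₚ.++⁺ (AllPairs-map (AllPairs-filterB (satB r) ⋠-boxes)) (AllPairs-map (AllPairs-filterB (unsB r) ⋠-boxes))
        (All.tabulate λ i → All.tabulate λ j p → let (e , k , q) = ∈-map⁻ box i ; (f , l , q') = ∈-map⁻ box j in
          proj₂ (∈-unsats⁻ P l) (ideal (proj₁ (∈-unsats⁻ P l)) (proj₁ (∈-sats⁻ P k)) (subst₂ _≼_ q' q p) (proj₂ (∈-sats⁻ P k)))))
      (λ i → Std.sound std ([ (λ j → sub (∈-sats⁻ P) j) , (λ j → sub (∈-unsats⁻ P) j) ]′ (∈-++⁻ (boxes (sats P)) i)))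
      λ p → let (e , i , q) = ∈-map⁻ box (Std.complete std p) in subst (_∈ _) (sym q) (place i)
      where
      sub : ∀ {Q b} {R : Entry → Set} → (∀ {e} → e ∈ Q → e ∈ P × R e) → b ∈ boxes Q → b ∈ boxes P
      sub f i with ∈-map⁻ box i
      ... | e , j , refl = ∈-map⁺ box (proj₁ (f j))
      place : ∀ {e} → e ∈ P → box e ∈ boxes (sats P) ++ boxes (unsats P)
      place {e} i with Sat? r e
      ... | yes s = ∈-++⁺ˡ (∈-map⁺ box (∈-sats⁺ i s))
      ... | no s = ∈-++⁺ʳ (boxes (sats P)) (∈-map⁺ box (∈-unsats⁺ i s))
    sp : Split δ' β₁ (boxes (sats P)) (boxes (unsats P))
    sp = Std-split D' B₁ β⊆ std'
    down : ∀ {b c} → b ∈ₚ β₂ → b ∈ₚ γ' ⊎ b ∈ map cell (unsats P) → c ≼ b → Positive c → c ∈ₚ γ' ⊎ c ∈ map cell (unsats P)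
    down i (inj₁ p) q c⁺ = inj₁ (∈ₚ-≼ C' p q c⁺)
    down {b} {c} i (inj₂ p) q c⁺ with c ∈ₚ? γ'
    ... | yes k = inj₁ k
    ... | no k with entry {c} (∈ₚ-≼ B₂ i q c⁺ , k) | ∈-map⁻ cell p
    ...   | d , l | e , l' , refl = inj₂ (∈-map⁺ cell (∈-unsats⁺ l (violating-up (proj₁ (∈-unsats⁻ P l')) l q (proj₂ (∈-unsats⁻ P l')))))
    open Subshape β₂ B₂ {P = λ c → c ∈ₚ γ' ⊎ c ∈ map cell (unsats P)} (λ c → (c ∈ₚ? γ') ⊎-dec (c ∈? map cell (unsats P))) down
    γ'⊆shape : γ' ⊆ₚ shape
    γ'⊆shape k = ∈-shape⁺ (γ⊆ k) (inj₁ k)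
    sat-unsat : ∀ {c b} → (c , b) ∈ P → Sat r (c , b) → c ∉ map cell (unsats P)
    sat-unsat i s k with ∈-map⁻ cell k
    ... | (_ , b') , l , refl with same-cell i (proj₁ (∈-unsats⁻ P l))
    ...   | refl = proj₂ (∈-unsats⁻ P l) s
    cellsˡ : map cell (sats P) ≡ rl β₂ shape
    cellsˡ = cells-unique ordˡ
      (λ i → let (j , s) = ∈-sats⁻ P i in proj₁ (skew j) , λ k → [ proj₂ (skew j) , sat-unsat j s ]′ (proj₂ (∈-shape⁻ k)))
      λ {c} (p , n) → let (b , i) = entry (p , n ∘ γ'⊆shape) in sat-cell p n i
      where
      sat-cell : ∀ {c b} → c ∈ₚ β₂ → ¬ c ∈ₚ shape → (c , b) ∈ P → c ∈ map cell (sats P)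
      sat-cell {c} {b} p n i with Sat? r (c , b)
      ... | yes s = ∈-map⁺ cell (∈-sats⁺ i s)
      ... | no s = ⊥-elim (n (∈-shape⁺ p (inj₂ (∈-map⁺ cell (∈-unsats⁺ i s)))))
    cellsʳ : map cell (unsats P) ≡ rl shape γ'
    cellsʳ = cells-unique ordʳ
      (λ i → let (j , s) = ∈-unsats⁻ P i in ∈-shape⁺ (proj₁ (skew j)) (inj₂ (∈-map⁺ cell i)) , proj₂ (skew j))
      λ (p , n) → [ (λ k → ⊥-elim (n k)) , id ]′ (proj₂ (∈-shape⁻ p))

  -- Sorts the union of the two lists into the reading order of `β₂` over `γ'`. The default `o` is
  -- not reached when `S` and `U` cover all cells.
  glue : Partition → Partition → List Entry → List Entry → List Entry
  glue β₂ γ' S U = map (λ c → c , look o (S ++ U) c) (rl β₂ γ')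

  module GlueEntries (β₂ γ' : Partition) (S U : List Entry) (cover : ∀ {c} → InSkew β₂ γ' c → ∃[ b ] (c , b) ∈ S ++ U) (inside : ∀ {e} → e ∈ S ++ U → InSkew β₂ γ' (cell e))
    (functional : ∀ {c b b'} → (c , b) ∈ S ++ U → (c , b') ∈ S ++ U → b ≡ b') where

    ∈-glue⁻ : ∀ {e : Entry} → e ∈ glue β₂ γ' S U → e ∈ S ++ U
    ∈-glue⁻ i with ∈-map⁻ (λ c → c , look o (S ++ U) c) i
    ... | c , j , refl = look-∈ (proj₂ (cover (∈-rl⁻ j)))

    ∈-glue⁺ : ∀ {e : Entry} → e ∈ S ++ U → e ∈ glue β₂ γ' S U
    ∈-glue⁺ {c , b} i = subst (λ z → (c , z) ∈ glue β₂ γ' S U) (functional (look-∈ i) i) (∈-map⁺ (λ c → c , look o (S ++ U) c) (∈-rl⁺ (inside i)))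

    glue-sorted : AllPairs (λ e f → RL (cell e) (cell f)) (glue β₂ γ' S U)
    glue-sorted = AllPairs-map (rl-sorted β₂ γ')

  glue-split : ∀ {δ' β₁ β₂ γ' P} → IsPartition δ' → IsPartition β₁ → IsPartition β₂ → IsPartition γ' → Tab δ' β₁ β₂ γ' P → glue β₂ γ' (sats P) (unsats P) ≡ P
  glue-split {δ'} {β₁} {β₂} {γ'} {P} D' B₁ B₂ C' tab = sorted-unique {R = λ e f → RL (cell e) (cell f)} Fwd.RL-irr Fwd.RL-trans
    (GE.glue-sorted) (entries-sorted (Pic.ordered pic))
    (back ∘ GE.∈-glue⁻) (GE.∈-glue⁺ ∘ forth)
    where
    open Tab tab
    open Picture B₂ C' cells pic
    back : ∀ {e} → e ∈ sats P ++ unsats P → e ∈ P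
    back i = [ proj₁ ∘ ∈-sats⁻ P , proj₁ ∘ ∈-unsats⁻ P ]′ (∈-++⁻ (sats P) i)
    forth : ∀ {e} → e ∈ P → e ∈ sats P ++ unsats P
    forth {e} i with Sat? r e
    ... | yes s = ∈-++⁺ˡ (∈-sats⁺ i s)
    ... | no s = ∈-++⁺ʳ (sats P) (∈-unsats⁺ i s)
    cover : ∀ {c} → InSkew β₂ γ' c → ∃[ b ] (c , b) ∈ sats P ++ unsats P
    cover p = let (b , i) = entry p in b , forth i
    inside : ∀ {e} → e ∈ sats P ++ unsats P → InSkew β₂ γ' (cell e)
    inside = skew ∘ back
    functional : ∀ {c b b'} → (c , b) ∈ sats P ++ unsats P → (c , b') ∈ sats P ++ unsats P → b ≡ b'
    functional i j = same-cell (back i) (back j)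
    module GE = GlueEntries β₂ γ' (sats P) (unsats P) cover inside functional

  record Glued (δ' β₁ β₂ γ' : Partition) (S U : List Entry) : Set where
    field
      tab : Tab δ' β₁ β₂ γ' (glue β₂ γ' S U)
      sats≡ : sats (glue β₂ γ' S U) ≡ S
      unsats≡ : unsats (glue β₂ γ' S U) ≡ U

  -- Pairs inside `S` or inside `U` are already in position. For mixed pairs the row rule compares
  -- the rows of the boxes; the columns follow because every box of `U` lies outside `δ` and every
  -- box of `S` inside.
  module Glue {δ' β₁ β₂ γ' S U} (D' : IsPartition δ') (B₁ : IsPartition β₁) (B₂ : IsPartition β₂) (C' : IsPartition γ')
    (sp : SatSplit δ' β₁ β₂ γ' S U) (satS : ∀ {e} → e ∈ S → Sat r e) (unsU : ∀ {e} → e ∈ U → ¬ Sat r e) where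
    open SatSplit sp

    private
      G = glue β₂ γ' S U
      module L = Filling B₂ γ-partition (Tab.cells left) (Tab.pic left) (Std-valid δ-partition B₁ (Tab.std left))
      module R = Filling γ-partition C' (Tab.cells right) (Tab.pic right) (Std-valid D' δ-partition (Tab.std right))

      cover : ∀ {c} → InSkew β₂ γ' c → ∃[ b ] (c , b) ∈ S ++ U
      cover {c} (p , n) with c ∈ₚ? γ
      ... | yes q = let (b , i) = R.entry (q , n) in b , ∈-++⁺ʳ S i
      ... | no q = let (b , i) = L.entry (p , q) in b , ∈-++⁺ˡ i

      inside : ∀ {e} → e ∈ S ++ U → InSkew β₂ γ' (cell e)
      inside i = [ (λ j → proj₁ (L.skew j) , proj₂ (L.skew j) ∘ γ'⊆γ) , (λ j → γ⊆β₂ (proj₁ (R.skew j)) , proj₂ (R.skew j)) ]′ (∈-++⁻ S i)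

      functional : ∀ {c b b'} → (c , b) ∈ S ++ U → (c , b') ∈ S ++ U → b ≡ b'
      functional i j with ∈-++⁻ S i | ∈-++⁻ S j
      ... | inj₁ k | inj₁ l = L.same-cell k l
      ... | inj₂ k | inj₂ l = R.same-cell k l
      ... | inj₁ k | inj₂ l = ⊥-elim (proj₂ (L.skew k) (proj₁ (R.skew l)))
      ... | inj₂ k | inj₁ l = ⊥-elim (proj₂ (L.skew l) (proj₁ (R.skew k)))

      module GE = GlueEntries β₂ γ' S U cover inside functional

      on : ∀ {e} → e ∈ G → e ∈ S ⊎ e ∈ U
      on i = ∈-++⁻ S (GE.∈-glue⁻ i)

      off : ∀ {e} → e ∈ S ++ U → e ∈ G
      off = GE.∈-glue⁺

      cells : map cell G ≡ rl β₂ γ'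
      cells = trans (sym (Listₚ.map-∘ (rl β₂ γ'))) (Listₚ.map-id (rl β₂ γ'))

      boxˡ : ∀ {e} → e ∈ S → InSkew δ β₁ (box e)
      boxˡ i = Std.sound (Tab.std left) (∈-map⁺ box i)

      boxʳ : ∀ {e} → e ∈ U → InSkew δ' δ (box e)
      boxʳ i = Std.sound (Tab.std right) (∈-map⁺ box i)

      apart : ∀ {e f} → e ∈ S → f ∈ U → ¬ box f ≼ box e
      apart i j p = proj₂ (boxʳ j) (∈ₚ-≼ δ-partition (proj₁ (boxˡ i)) p (positive (proj₁ (boxʳ j))))

      in-row : ∀ {e f} → e ∈ U → f ∈ S → row (cell e) ≡ row (cell f) → ¬ col (cell f) < col (cell e)
      in-row i j p q = proj₂ (L.skew j) (∈ₚ-≼ γ-partition (proj₁ (R.skew i)) (ℕₚ.≤-reflexive (sym p) , ℕₚ.<⇒≤ q) (positive (proj₁ (L.skew j))))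

      step-asc : ∀ {x y a b} → ((x , suc y) , a) ∈ G → ((x , y) , b) ∈ G → Asc a b
      step-asc {x} {y} {a} {b} i j with on i | on j
      ... | inj₁ k | inj₁ l = L.asc k l refl ℕₚ.≤-refl
      ... | inj₂ k | inj₂ l = R.asc k l refl ℕₚ.≤-refl
      ... | inj₂ k | inj₁ l = ⊥-elim (in-row k l refl ℕₚ.≤-refl)
      ... | inj₁ k | inj₂ l = ℕₚ.≰⇒> (λ h → apart k l (rows , h)) , rows
        where
        -- From column `y` to column `suc y` the row rule entry drops by exactly one: `b` stays
        -- short of the larger value and `a` reaches the smaller one.
        rows : row b ≤ row a
        rows = ℕₚ.≤-pred (ℕₚ.+-cancelʳ-≤ y _ _ (ℕₚ.≤-trans (ℕₚ.≰⇒> (unsU l)) (subst (r + x ≤_) (ℕₚ.+-suc (row a) y) (satS k))))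

      gap-asc : ∀ n {x y a b} → ((x , y + suc n) , a) ∈ G → ((x , y) , b) ∈ G → Asc a b
      gap-asc zero {x} {y} {a} i j = step-asc (subst (λ z → ((x , z) , a) ∈ G) (ℕₚ.+-comm y 1) i) j
      gap-asc (suc n) {x} {y} {a} i j with cover {x , y + suc n} (InSkew-convex B₂ C' (inside' j) (inside' i) (ℕₚ.≤-refl , ℕₚ.m≤m+n y _) (ℕₚ.≤-refl , ℕₚ.+-monoʳ-≤ y (ℕₚ.n≤1+n _)))
        where
        inside' : ∀ {e} → e ∈ G → InSkew β₂ γ' (cell e)
        inside' = inside ∘ GE.∈-glue⁻
      ... | z , k = Fwd.Asc-trans (step-asc (subst (λ w → ((x , w) , a) ∈ G) (ℕₚ.+-suc y (suc n)) i) (off k)) (gap-asc n (off k) j)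

      row-asc : ∀ {e f} → e ∈ G → f ∈ G → row (cell e) ≡ row (cell f) → col (cell f) < col (cell e) → Asc (box e) (box f)
      row-asc {(x , y') , a} {(_ , y) , b} i j refl l with ℕₚ.m≤n⇒∃[o]m+o≡n l
      ... | n , refl = gap-asc n (subst (λ z → ((x , z) , a) ∈ G) (sym (ℕₚ.+-suc y n)) i) j

      step-desc : ∀ {e f} → e ∈ G → f ∈ G → Below (cell e) (cell f) → Desc (box e) (box f)
      step-desc {(x , y) , a} {_ , b} i j (refl , refl) with on i | on j
      ... | inj₁ k | inj₁ l = Pic.desc (Tab.pic left) k l (refl , refl)
      ... | inj₂ k | inj₂ l = Pic.desc (Tab.pic right) k l (refl , refl)
      ... | inj₁ k | inj₂ l = ⊥-elim (proj₂ (L.skew k) (∈ₚ-≼ γ-partition (proj₁ (R.skew l)) (ℕₚ.n≤1+n x , ℕₚ.≤-refl) (positive (proj₁ (L.skew k)))))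
      ... | inj₂ k | inj₁ l = rows , ℕₚ.≮⇒≥ (λ h → apart l k (ℕₚ.<⇒≤ rows , ℕₚ.<⇒≤ h))
        where
        rows : row a < row b
        rows = ℕₚ.+-cancelʳ-≤ y _ _ (ℕₚ.≤-trans (ℕₚ.≰⇒> (unsU k)) (ℕₚ.≤-trans (ℕₚ.+-monoʳ-≤ r (ℕₚ.n≤1+n x)) (satS l)))

      pic : Pic G
      pic = record
        { ordered = AllPairs-∈ (λ { i j p → p , λ q → row-asc i j q (right-to-left p q) }) (GE.glue-sorted)
        ; convex = λ i j p q → subst (_ ∈_) (sym cells) (∈-rl⁺ (InSkew-convex B₂ C' (∈-rl⁻ (subst (_ ∈_) cells i)) (∈-rl⁻ (subst (_ ∈_) cells j)) p q))
        ; desc = step-desc }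
        where
        right-to-left : ∀ {c d} → RL c d → row c ≡ row d → col d < col c
        right-to-left (inj₁ p) q = ⊥-elim (ℕₚ.<⇒≢ p q)
        right-to-left (inj₂ (_ , p)) q = p

      module P = Picture B₂ C' cells pic

      order : ∀ {e f} → e ∈ G → f ∈ G → RL (cell e) (cell f) → box e ⋠ box f
      order i j p with on i | on j
      ... | inj₁ k | inj₁ l = L.order k l p
      ... | inj₂ k | inj₂ l = R.order k l p
      ... | inj₁ k | inj₂ l = apart k l
      order i j (inj₂ (a , b)) | inj₂ k | inj₁ l = λ _ → in-row k l a b
      order {e} {f} i j (inj₁ a) | inj₂ k | inj₁ l with ℕₚ.<-≤-connex (col (cell e)) (col (cell f))
      ... | inj₁ b = λ (q , _) → ℕₚ.<⇒≱ (proj₁ (P.sw i j a b)) q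
      ... | inj₂ b = λ (q , _) → ℕₚ.<⇒≱ (ℕₚ.≤-trans (s≤s (ℕₚ.≤-trans (satS l) (ℕₚ.+-mono-≤ q b))) (ℕₚ.≰⇒> (unsU k))) (ℕₚ.+-monoʳ-≤ r (ℕₚ.<⇒≤ a))

      joined : Std δ' β₁ (boxes S ++ boxes U)
      joined = Std-join δ-partition β₁⊆δ δ⊆δ' (Tab.std left) (Tab.std right)

      same-boxes : boxes S ++ boxes U ≡ boxes (S ++ U)
      same-boxes = sym (Listₚ.map-++ box S U)

    glued : Glued δ' β₁ β₂ γ' S U
    glued = record
      { tab = record
        { cells = cells
        ; pic = pic
        ; std = mkStd (AllPairs-map (AllPairs-∈ order (GE.glue-sorted)))
            (λ i → let (e , j , q) = ∈-map⁻ box i in subst (InSkew δ' β₁) (sym q) (Std.sound joined (subst (box e ∈_) (sym same-boxes) (∈-map⁺ box (GE.∈-glue⁻ j)))))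
            λ p → let (e , j , q) = ∈-map⁻ box (subst (_ ∈_) same-boxes (Std.complete joined p)) in subst (_∈ boxes G) (sym q) (∈-map⁺ box (off j)) }
      ; sats≡ = entries-unique (AllPairs-filterB (satB r) (Pic.ordered pic)) (Pic.ordered (Tab.pic left))
          (λ i → let (j , s) = ∈-sats⁻ G i in [ id , (λ k → ⊥-elim (unsU k s)) ]′ (on j)) λ i → ∈-sats⁺ (off (∈-++⁺ˡ i)) (satS i)
      ; unsats≡ = entries-unique (AllPairs-filterB (unsB r) (Pic.ordered pic)) (Pic.ordered (Tab.pic right))
          (λ i → let (j , s) = ∈-unsats⁻ G i in [ (λ k → ⊥-elim (s (satS k))) , id ]′ (on j)) λ i → ∈-unsats⁺ (off (∈-++⁺ʳ S i)) (unsU i) }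

-- Reverse slides and the violating entries

module RowRuleSlides (r : ℕ) where
  open RowRule r

  unsats-∷ : ∀ {e W} → ¬ Sat r e → unsats (e ∷ W) ≡ e ∷ unsats W
  unsats-∷ {e} n rewrite unsB⁺ r e n = refl

  unsats-drop : ∀ {e W} → Sat r e → unsats (e ∷ W) ≡ unsats W
  unsats-drop {e} s rewrite satB⁺ r e s = refl

  -- W′ restricted to the entries that violate the row rule in W.
  data Pick : List Entry → List Entry → List Entry → Set where
    [] : Pick [] [] []
    take : ∀ {e e' W W' Q} → ¬ Sat r e → Pick W W' Q → Pick (e ∷ W) (e' ∷ W') (e' ∷ Q)
    drop : ∀ {e e' W W' Q} → Sat r e → Pick W W' Q → Pick (e ∷ W) (e' ∷ W') Q

  -- A reverse slide moves entries right or down, so satisfying entries stay satisfying: every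
  -- violating entry after the run was violating before it.
  Pick-unsats : ∀ {v W W' Q g} → Bwd.Run v W W' g → Pick W W' Q → unsats W' ≡ unsats Q
  Pick-unsats Bwd.start [] = refl
  Pick-unsats (Bwd.keep {c = c} {b = b} R _) (take n p) rewrite unsB⁺ r (c , b) n = cong (_ ∷_) (Pick-unsats R p)
  Pick-unsats (Bwd.keep {c = c} {b = b} R _) (drop s p) rewrite satB⁺ r (c , b) s = Pick-unsats R p
  Pick-unsats (Bwd.move {g = g} {c = c} {b = b} R a) (take n p) with unsB r (c , g)
  ... | true = cong (_ ∷_) (Pick-unsats R p)
  ... | false = Pick-unsats R p
  Pick-unsats (Bwd.move {g = g} {c = c} {b = b} R a) (drop s p)
    rewrite satB⁺ r (c , g) (ℕₚ.≤-trans s (ℕₚ.+-monoˡ-≤ (col c) (proj₁ (Fwd.Adj⇒≼ (Adj-op⁻ a))))) = Pick-unsats R p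

  module _ {α β : Partition} (A : IsPartition α) (B : IsPartition β) {P P' : List Entry} {v h : Box} (cells : map cell P ≡ rl α β) (pic : Pic P)
    (rp q : List Box) (valid : Valid (rp ʳ++ (boxes P ++ (v ∷ q)))) (run : Bwd.Run v P P' h) where

    private
      open Filling A B cells pic (prefix-valid rp (boxes P) valid)

      mid : ∀ {z b' y d} → (z , b') ∈ P' → (y , d) ∈ P → Below y z → Desc d b'
      mid i j (p , s) = Bwd.RPic-mid q rp run (Pic⇒Bwd pic) (Valid-op rp (boxes P) valid) i j (sym p , s)

      -- Otherwise x, the satisfying entry and the hole are three boxes of a 2 × 2 block of cells whose last entry
      -- has just been moved, against mid.
      conflict : ∀ zs {c b W W' g} → (∀ {f} → f ∈ (c , b) ∷ W → f ∈ P) → (∀ {f} → f ∈ W' → f ∈ P') → (∀ {f} → f ∈ P → RL c (cell f) → f ∈ W) →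
        AllPairs Ordered ((c , b) ∷ W) → Bwd.Run v W W' g → Valid (zs ʳ++ (b ∷ (boxes W ++ (v ∷ q)))) → Sat r (c , b) → Adj b g →
        ∀ {x} → x ∈ P → ¬ Sat r x → RL (cell x) c → ¬ Adj (box x) g
      conflict zs {c} {b} {W} {W'} {g} sub sub' rest ord R w s ad {x} ix n l ax with cross ix (sub (here refl)) l n s
      ... | (lt , near) , u₁ , u₂ = shape ad ax near
        where
        a = box x
        shape : Adj b g → Adj a g → col (cell x) < col c ⊎ suc (row a) < row b → ⊥
        shape (inj₁ (refl , _)) (inj₁ (refl , _)) _ = ℕₚ.<-irrefl refl u₁
        shape (inj₂ (refl , _)) (inj₂ (refl , _)) _ = ℕₚ.<-irrefl refl u₂
        shape (inj₂ (_ , refl)) (inj₁ (refl , _)) _ = ℕₚ.<-asym u₁ ℕₚ.≤-refl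
        shape (inj₁ (refl , _)) (inj₂ (_ , p)) (inj₂ far) = ℕₚ.<⇒≢ far (sym p)
        -- The one position not excluded by `cross`: `g` is to the right of `b` and below the box of
        -- `x`. The cell in the row of `c` and the column of `x` then has no other place for its box
        -- than `g`.
        shape (inj₁ (refl , refl)) (inj₂ (p , q')) (inj₁ nw) with between {c = row c , col (cell x)} ix (sub (here refl)) (ℕₚ.<⇒≤ lt , ℕₚ.≤-refl) (ℕₚ.≤-refl , ℕₚ.<⇒≤ nw)
        ... | wb , iw = corner W W' ord R w sub sub' (rest iw (inj₂ (refl , nw)))
          where
          wc : Box
          wc = row c , col (cell x)
          e-w : Asc b wb
          e-w = asc (sub (here refl)) iw refl nw
          x-w : row a + row c ≤ row wb + row (cell x) × row a < row wb × col wb ≤ col a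
          x-w = desc-< ix iw lt
          wb≡g : wb ≡ g
          wb≡g = cong₂ _,_ (ℕₚ.≤-antisym (proj₂ e-w) (subst (_≤ row wb) (sym q') (proj₁ (proj₂ x-w))))
                           (ℕₚ.≤-antisym (subst (col wb ≤_) p (proj₂ (proj₂ x-w))) (proj₁ e-w))
          below : row c ≡ suc (row (cell x))
          below = ℕₚ.≤-antisym (ℕₚ.+-cancelˡ-≤ (row a) _ _ (ℕₚ.≤-trans (proj₁ x-w)
            (ℕₚ.≤-reflexive (trans (cong (_+ row (cell x)) (trans (cong row wb≡g) q')) (sym (ℕₚ.+-suc (row a) (row (cell x)))))))) lt
          corner : ∀ W W' → AllPairs Ordered ((c , b) ∷ W) → Bwd.Run v W W' g → Valid (zs ʳ++ (b ∷ (boxes W ++ (v ∷ q)))) →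
            (∀ {f} → f ∈ (c , b) ∷ W → f ∈ P) → (∀ {f} → f ∈ W' → f ∈ P') → (wc , wb) ∈ W → ⊥
          corner (y ∷ W) W' ((k ∷ _) ∷ (o ∷ _)) _ _ sub _ (there i) = gap (proj₁ k) (proj₁ (All.lookup o i))
            where
            gap : RL c (cell y) → RL (cell y) wc → ⊥
            gap (inj₁ p₁) (inj₁ p₂) = ℕₚ.<-asym p₁ p₂
            gap (inj₁ p₁) (inj₂ (p₂ , _)) = ℕₚ.<⇒≢ p₁ (sym p₂)
            gap (inj₂ (p₁ , _)) (inj₁ p₂) = ℕₚ.<⇒≢ p₂ (sym p₁)
            gap (inj₂ (p₁ , l₁)) (inj₂ (p₂ , l₂)) = ℕₚ.<⇒≱ (proj₁ (asc (sub (there (here refl))) iw p₂ l₂))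
              (ℕₚ.≤-trans (ℕₚ.≤-reflexive (cong col wb≡g)) (proj₁ (asc (sub (here refl)) (sub (there (here refl))) p₁ l₁)))
          -- If this entry had stayed, its box would coincide with the hole.
          corner (_ ∷ W) _ _ (Bwd.keep R _) w _ _ (here refl) with Fwd.suffix-order zs (run-valid (wb ∷ b ∷ zs) R w)
          ... | _ ∷ ((k ∷ _) ∷ _) = k (subst (g ≼_) (sym wb≡g) Fwd.≼-refl)
          corner (_ ∷ W) _ _ (Bwd.move {w' = W''} {g = g₀} R ad₀) w _ sub' (here refl) = final (Adj-op⁻ ad₀)
            where
            w₀ : Valid (zs ʳ++ (b ∷ wb ∷ g₀ ∷ (boxes W'' ++ q)))
            w₀ = run-valid (wb ∷ b ∷ zs) R w
            final : Adj wb g₀ → ⊥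
            -- A move to the right contradicts `mid` for the cell of `x` directly above. After a
            -- move down, the box below `b` would have to occur in the word between `b` and `g₀`,
            -- where there is no place for it.
            final (inj₁ (_ , p₁)) = ℕₚ.<⇒≱ (ℕₚ.≤-reflexive (sym p₁)) (ℕₚ.≤-trans (proj₂ (mid (sub' (here refl)) ix (refl , below))) (ℕₚ.≤-reflexive p))
            final (inj₂ (p₁ , p₂)) with Fwd.interval zs {e = row g₀ , col b} w₀ (there (there (here refl)))
                (ℕₚ.≤-trans (ℕₚ.n≤1+n _) (ℕₚ.≤-reflexive (sym p₂)) , ℕₚ.≤-refl) (ℕₚ.≤-refl , ℕₚ.≤-trans (ℕₚ.<⇒≤ (proj₁ e-w)) (ℕₚ.≤-reflexive p₁))
            ... | here k = ℕₚ.1+n≢n (trans (sym p₂) (cong row k))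
            ... | there (here k) = ℕₚ.1+n≢n (trans (sym p₂) (cong row k))
            ... | there (there (here k)) = ℕₚ.<⇒≢ (proj₁ e-w) (trans (cong col k) (sym p₁))
            ... | there (there (there k)) with Fwd.suffix-order zs w₀
            ...   | _ ∷ (_ ∷ (m ∷ _)) = All.lookup m k (ℕₚ.≤-refl , ℕₚ.≤-trans (ℕₚ.<⇒≤ (proj₁ e-w)) (ℕₚ.≤-reflexive p₁))

      -- Either both holes agree, or the hole of the full run sits on a box abandoned by a satisfying entry
      -- and the other hole can no longer be filled.
      State : List Entry → Box → Box → Set
      State W g g₂ = g ≡ g₂ ⊎ ((∃[ f ] (f ∈ W × Sat r f × box f ≡ g)) ×
        (∀ {x} → x ∈ P → ¬ Sat r x → (∀ {f} → f ∈ W → RL (cell x) (cell f)) → ¬ Adj (box x) g₂))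

      narrow : ∀ {e W g g₂} → State W g g₂ → State (e ∷ W) g g₂
      narrow (inj₁ p) = inj₁ p
      narrow (inj₂ ((f , i , s , p) , h)) = inj₂ ((f , there i , s , p) , λ ix n l → h ix n (l ∘ there))

      -- Runs the full word and its violating part side by side. The holes part when a satisfying
      -- entry moves; afterwards a violating entry is kept out of the full hole by `cross` and out
      -- of the other one by the property that `State` records.
      core : ∀ zs {W W' g} → (∀ {f} → f ∈ W → f ∈ P) → (∀ {f} → f ∈ W' → f ∈ P') → (∀ {e f} → e ∈ W → f ∈ P → RL (cell e) (cell f) → f ∈ W) →
        AllPairs Ordered W → Bwd.Run v W W' g → Valid (zs ʳ++ (boxes W ++ (v ∷ q))) →
        ∃[ Q ] ∃[ g₂ ] (Bwd.Run v (unsats W) Q g₂ × Pick W W' Q × State W g g₂)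
      core zs {[]} sub sub' rest ord Bwd.start w = [] , v , Bwd.start , [] , inj₁ refl
      core zs {(c , b) ∷ W} {_} {g'} sub sub' rest (o ∷ ord) run' w = step run' (Sat? r (c , b)) sub'
        where
        closed : ∀ {e f} → e ∈ W → f ∈ P → RL (cell e) (cell f) → f ∈ W
        closed i j k with rest (there i) j k
        ... | there l = l
        ... | here refl = ⊥-elim (Fwd.RL-asym k (proj₁ (All.lookup o i)))
        after : ∀ {f} → f ∈ P → RL c (cell f) → f ∈ W
        after j k with rest (here refl) j k
        ... | there l = l
        ... | here refl = ⊥-elim (Fwd.RL-irr k)
        step : ∀ {W₁ g₁} → Bwd.Run v ((c , b) ∷ W) W₁ g₁ → Dec (Sat r (c , b)) → (∀ {f} → f ∈ W₁ → f ∈ P') →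
          ∃[ Q ] ∃[ g₂ ] (Bwd.Run v (unsats ((c , b) ∷ W)) Q g₂ × Pick ((c , b) ∷ W) W₁ Q × State ((c , b) ∷ W) g₁ g₂)
        step (Bwd.keep R na) d sub₁ with core (b ∷ zs) (sub ∘ there) (sub₁ ∘ there) closed ord R w
        step (Bwd.keep R na) (yes s) sub₁ | Q , g₂ , R₂ , p , st rewrite unsats-drop {(c , b)} {W} s = Q , g₂ , R₂ , drop s p , narrow st
        step (Bwd.keep R na) (no n) sub₁ | Q , g₂ , R₂ , p , inj₁ refl rewrite unsats-∷ {(c , b)} {W} n = _ , _ , Bwd.keep R₂ na , take n p , inj₁ refl
        step (Bwd.keep R na) (no n) sub₁ | Q , g₂ , R₂ , p , st@(inj₂ (_ , h)) rewrite unsats-∷ {(c , b)} {W} n =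
          _ , _ , Bwd.keep R₂ (h (sub (here refl)) n (λ i → proj₁ (All.lookup o i)) ∘ Adj-op⁻) , take n p , narrow st
        step (Bwd.move R a) d sub₁ with core (b ∷ zs) (sub ∘ there) (sub₁ ∘ there) closed ord R w
        -- The holes part here. The restricted one stays at the former common position, which by
        -- `conflict` is adjacent to no violating box still to come.
        step (Bwd.move R a) (yes s) sub₁ | Q , g₂ , R₂ , p , inj₁ refl rewrite unsats-drop {(c , b)} {W} s = Q , g₂ , R₂ , drop s p
          , inj₂ (((c , b) , here refl , s , refl) , λ ix n l → conflict zs sub (sub₁ ∘ there) after (o ∷ ord) R w s (Adj-op⁻ a) ix n (l (here refl)))
        step (Bwd.move R a) (yes s) sub₁ | Q , g₂ , R₂ , p , inj₂ (_ , h) rewrite unsats-drop {(c , b)} {W} s = Q , g₂ , R₂ , drop s p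
          , inj₂ (((c , b) , here refl , s , refl) , λ ix n l → h ix n (l ∘ there))
        step (Bwd.move R a) (no n) sub₁ | Q , g₂ , R₂ , p , inj₁ refl rewrite unsats-∷ {(c , b)} {W} n = _ , _ , Bwd.move R₂ a , take n p , inj₁ refl
        -- The full hole is the former box of a satisfying entry read later; `cross` places it
        -- strictly south-west of `b`, so `b` cannot move into it.
        step (Bwd.move R a) (no n) sub₁ | Q , g₂ , R₂ , p , inj₂ ((f , i , s , refl) , _) =
          ⊥-elim (apart (Adj-op⁻ a) (proj₂ (cross (sub (here refl)) (sub (there i)) (proj₁ (All.lookup o i)) n s)))
          where
          apart : Adj b (box f) → ¬ (row b < row (box f) × col (box f) < col b)
          apart (inj₁ (refl , _)) (l , _) = ℕₚ.<-irrefl refl l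
          apart (inj₂ (refl , _)) (_ , l) = ℕₚ.<-irrefl refl l

    unsats-step : ∃[ Q ] ∃[ g₂ ] (Bwd.Run v (unsats P) Q g₂ × unsats P' ≡ unsats Q)
    unsats-step with core rp id id (λ _ i _ → i) (Pic.ordered pic) run valid
    ... | Q , g₂ , R₂ , p , _ = Q , g₂ , R₂ , Pick-unsats run p

  unsats-rpass : ∀ {α β P v} → IsPartition α → IsPartition β → map cell P ≡ rl α β → Pic P → ∀ rp {q} → Valid (rp ʳ++ (boxes P ++ (v ∷ q))) →
    unsats (proj₂ (rpass P v)) ≡ unsats (proj₂ (rpass (unsats P) v))
  unsats-rpass {P = P} {v} A B cells pic rp {q} w with unsats-step A B cells pic rp q w (rpass-Run P v)
  ... | Q , g₂ , R , e rewrite Run-rpass R = e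

  -- Pulling a tableau through t only depends, as far as violating entries are concerned, on its violating entries.
  unsats-uninfuse : ∀ u {α β α' β' P Q} rp rp' {q} → IsPartition α → IsPartition β → IsPartition α' → IsPartition β' →
    map cell P ≡ rl α β → Pic P → Valid (rp ʳ++ (boxes P ++ (boxes u ++ q))) →
    map cell Q ≡ rl α' β' → Pic Q → Valid (rp' ʳ++ (boxes Q ++ (boxes u ++ q))) →
    unsats P ≡ unsats Q → unsats (proj₂ (uninfuse P u)) ≡ unsats (proj₂ (uninfuse Q u))
  unsats-uninfuse [] rp rp' A B A' B' cp pp vp cq pq vq e = e
  unsats-uninfuse ((c , v) ∷ u) {P = P} {Q} rp rp' A B A' B' cp pp vp cq pq vq e =
    unsats-uninfuse u (proj₁ (rpass P v) ∷ rp) (proj₁ (rpass Q v) ∷ rp') A B A' B'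
      (trans (Run-cells (rpass-Run P v)) cp) (Run-Pic rp (rpass-Run P v) pp vp) (run-valid rp (rpass-Run P v) vp)
      (trans (Run-cells (rpass-Run Q v)) cq) (Run-Pic rp' (rpass-Run Q v) pq vq) (run-valid rp' (rpass-Run Q v) vq)
      (trans (unsats-rpass A B cp pp rp vp) (trans (cong (λ z → unsats (proj₂ (rpass z v))) e) (sym (unsats-rpass A' B' cq pq rp' vq))))

-- Finite sums

Σℤ : {A : Set} → List A → (A → ℤ) → ℤ
Σℤ [] f = ℤ.+ 0
Σℤ (x ∷ xs) f = f x ℤ.+ Σℤ xs f

Σℤ-++ : {A : Set} (xs : List A) {ys : List A} {f : A → ℤ} → Σℤ (xs ++ ys) f ≡ Σℤ xs f ℤ.+ Σℤ ys f
Σℤ-++ [] = sym (ℤₚ.+-identityˡ _)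
Σℤ-++ (x ∷ xs) {f = f} = trans (cong (λ z → f x ℤ.+ z) (Σℤ-++ xs)) (sym (ℤₚ.+-assoc (f x) _ _))

Σℤ-cong : {A : Set} (xs : List A) {f g : A → ℤ} → (∀ {x} → x ∈ xs → f x ≡ g x) → Σℤ xs f ≡ Σℤ xs g
Σℤ-cong [] h = refl
Σℤ-cong (x ∷ xs) h = cong₂ ℤ._+_ (h (here refl)) (Σℤ-cong xs (h ∘ there))

Σℤ-map : {A B : Set} (h : A → B) (xs : List A) {f : B → ℤ} → Σℤ (map h xs) f ≡ Σℤ xs (f ∘ h)
Σℤ-map h [] = refl
Σℤ-map h (x ∷ xs) {f} = cong (λ z → f (h x) ℤ.+ z) (Σℤ-map h xs)

Σℤ-concatMap : {A B : Set} (h : A → List B) (xs : List A) {f : B → ℤ} → Σℤ (concatMap h xs) f ≡ Σℤ xs (λ x → Σℤ (h x) f)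
Σℤ-concatMap h [] = refl
Σℤ-concatMap h (x ∷ xs) = trans (Σℤ-++ (h x)) (cong (λ z → Σℤ (h x) _ ℤ.+ z) (Σℤ-concatMap h xs))

+-interchange : ∀ a b c d → (a ℤ.+ b) ℤ.+ (c ℤ.+ d) ≡ (a ℤ.+ c) ℤ.+ (b ℤ.+ d)
+-interchange a b c d = trans (ℤₚ.+-assoc a b _) (trans (cong (λ z → a ℤ.+ z) (trans (sym (ℤₚ.+-assoc b c d)) (trans (cong (λ z → z ℤ.+ d) (ℤₚ.+-comm b c)) (ℤₚ.+-assoc c b d)))) (sym (ℤₚ.+-assoc a c _)))

Σℤ-+ : {A : Set} (xs : List A) {f g : A → ℤ} → Σℤ xs (λ x → f x ℤ.+ g x) ≡ Σℤ xs f ℤ.+ Σℤ xs g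
Σℤ-+ [] = refl
Σℤ-+ (x ∷ xs) {f} {g} = trans (cong (λ z → (f x ℤ.+ g x) ℤ.+ z) (Σℤ-+ xs)) (+-interchange (f x) (g x) _ _)

Σℤ-↭ : {A : Set} {xs ys : List A} {f : A → ℤ} → xs ↭ ys → Σℤ xs f ≡ Σℤ ys f
Σℤ-↭ ↭.refl = refl
Σℤ-↭ {f = f} (↭.prep x p) = cong (λ z → f x ℤ.+ z) (Σℤ-↭ p)
Σℤ-↭ {f = f} (↭.swap x y p) = trans (cong (λ z → f x ℤ.+ (f y ℤ.+ z)) (Σℤ-↭ p)) (trans (sym (ℤₚ.+-assoc (f x) (f y) _)) (trans (cong (λ z → z ℤ.+ _) (ℤₚ.+-comm (f x) (f y))) (ℤₚ.+-assoc (f y) (f x) _)))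
Σℤ-↭ (↭.trans p q) = trans (Σℤ-↭ p) (Σℤ-↭ q)

-- Bijections are given as relations since partners exist only for members of the lists and are
-- built from the proofs of membership. The partner of the first element is deleted and the rest
-- compared.
Σℤ-relation : {A B : Set} (R : A → B → Set) (xs : List A) {ys : List B} {f : A → ℤ} {g : B → ℤ} → Unique xs → Unique ys →
  (∀ {x} → x ∈ xs → ∃[ y ] (y ∈ ys × R x y)) → (∀ {y} → y ∈ ys → ∃[ x ] (x ∈ xs × R x y)) →
  (∀ {x y y'} → x ∈ xs → y ∈ ys → y' ∈ ys → R x y → R x y' → y ≡ y') →
  (∀ {x x' y} → x ∈ xs → x' ∈ xs → y ∈ ys → R x y → R x' y → x ≡ x') →
  (∀ {x y} → R x y → f x ≡ g y) → Σℤ xs f ≡ Σℤ ys g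
Σℤ-relation R [] {[]} u v to from fun inj val = refl
Σℤ-relation R [] {y ∷ ys} u v to from fun inj val with from (here refl)
... | _ , () , _
Σℤ-relation R (x ∷ xs) {ys} {f} {g} (n ∷ u) v to from fun inj val with to (here refl)
... | y , i , rxy with ∈-∃++ i
...   | as , bs , refl = trans (cong₂ ℤ._+_ (val rxy) rest) (sym (Σℤ-↭ (↭ₚ.shift y as bs)))
  where
  v' : Unique (y ∷ as ++ bs)
  v' = perm-unique (↭ₚ.shift y as bs) v
    where
    open import Data.List.Relation.Binary.Permutation.Setoid.Properties (setoid _) using (AllPairs-resp-↭)
    perm-unique : ∀ {xs ys} → xs ↭ ys → Unique xs → Unique ys
    perm-unique p = AllPairs-resp-↭ (λ k e → k (sym e)) (subst (_ ≢_) , subst (_≢ _)) (↭.↭⇒↭ₛ p)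
  keep-ys : ∀ {z} → z ∈ as ++ bs → z ∈ as ++ y ∷ bs
  keep-ys k = [ ∈-++⁺ˡ , (λ l → ∈-++⁺ʳ as (there l)) ]′ (∈-++⁻ as k)
  drop-y : ∀ {z} → z ∈ as ++ y ∷ bs → z ≢ y → z ∈ as ++ bs
  drop-y k m with ∈-++⁻ as k
  ... | inj₁ l = ∈-++⁺ˡ l
  ... | inj₂ (here e) = ⊥-elim (m e)
  ... | inj₂ (there l) = ∈-++⁺ʳ as l
  rest : Σℤ xs f ≡ Σℤ (as ++ bs) g
  rest = Σℤ-relation R xs u (AllPairs.tail v')
    (λ j → to-rest j (to (there j)))
    (λ {y'} k → from-rest k (from (keep-ys k)))
    (λ j k l → fun (there j) (keep-ys k) (keep-ys l))
    (λ j k l → inj (there j) (there k) (keep-ys l))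
    val
    where
    to-rest : ∀ {x'} → x' ∈ xs → ∃[ y' ] (y' ∈ as ++ y ∷ bs × R x' y') → ∃[ y' ] (y' ∈ as ++ bs × R x' y')
    to-rest j (y' , k , q) = y' , drop-y k (λ { refl → All.lookup n j (inj (here refl) (there j) i rxy q) }) , q
    from-rest : ∀ {y'} → y' ∈ as ++ bs → ∃[ x' ] (x' ∈ x ∷ xs × R x' y') → ∃[ x' ] (x' ∈ xs × R x' y')
    from-rest k (x' , there j , q) = x' , j , q
    from-rest k (x' , here refl , q) = ⊥-elim (All.lookup (AllPairs.head v') k (fun (here refl) i (keep-ys k) rxy q))

pairs : {A B : Set} → List A → (A → List B) → List (A × B)
pairs xs f = concatMap (λ a → map (a ,_) (f a)) xs

∈-pairs⁺ : {A B : Set} {xs : List A} {f : A → List B} {a : A} {b : B} → a ∈ xs → b ∈ f a → (a , b) ∈ pairs xs f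
∈-pairs⁺ {f = f} {a} i j = ∈-concatMap⁺ {f = λ a → map (a ,_) (f a)} i (∈-map⁺ (a ,_) j)

∈-pairs⁻ : {A B : Set} (xs : List A) {f : A → List B} {p : A × B} → p ∈ pairs xs f → proj₁ p ∈ xs × proj₂ p ∈ f (proj₁ p)
∈-pairs⁻ xs {f} i with ∈-concatMap⁻ {f = λ a → map (a ,_) (f a)} xs i
... | a , j , k with ∈-map⁻ (a ,_) k
...   | b , l , refl = j , l

pairs-unique : {A B : Set} {xs : List A} {f : A → List B} → Unique xs → (∀ {a} → a ∈ xs → Unique (f a)) → Unique (pairs xs f)
pairs-unique {f = f} u v = AllPairs-concatMap {f = λ a → map (a ,_) (f a)} u (λ {a} i → Uniqueₚ.map⁺ (λ { refl → refl }) (v i)) h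
  where
  h : ∀ {x y a b} → x ≢ y → a ∈ map (x ,_) (f x) → b ∈ map (y ,_) (f y) → a ≢ b
  h n i j refl with ∈-map⁻ (_ ,_) i | ∈-map⁻ (_ ,_) j
  ... | _ , _ , refl | _ , _ , refl = n refl

Σℤ-pairs : {A B : Set} (xs : List A) {f : A → List B} {w : A × B → ℤ} → Σℤ (pairs xs f) w ≡ Σℤ xs (λ a → Σℤ (f a) (λ b → w (a , b)))
Σℤ-pairs xs {f} = trans (Σℤ-concatMap (λ a → map (a ,_) (f a)) xs) (Σℤ-cong xs λ {a} _ → Σℤ-map (a ,_) (f a))

-- Enumerations of Remmel-Whitney tableaux

∅-partition : IsPartition []
∅-partition = [] , []

∅-⊆ : ∀ {κ} → [] ⊆ₚ κ
∅-⊆ p = ⊥-elim (ℕₚ.<⇒≱ (proj₂ (positive p)) (fits p))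

⊆ₚ-refl : ∀ {κ} → κ ⊆ₚ κ
⊆ₚ-refl p = p

Tab-size : ∀ {γ δ α β P} → δ ⊆ₚ γ → β ⊆ₚ α → Tab γ δ α β P → size γ ≡ size δ + (size α ∸ size β)
Tab-size {γ} {δ} {α} {β} {P} s s' tab = trans (sym (Std-size s (Tab.std tab))) (trans (ℕₚ.+-comm _ (size δ)) (cong (size δ +_)
  (trans (Listₚ.length-map box P) (trans (sym (Listₚ.length-map cell P)) (trans (cong length (Tab.cells tab))
  (trans (sym (ℕₚ.m+n∸n≡m _ (size β))) (cong (_∸ size β) (length-rl s'))))))))

opaque
  annotate : Partition → Partition → Tableau → List Entry
  annotate α β t = zip (rl α β) t

  annotate-zip : ∀ {α β t} → annotate α β t ≡ zip (rl α β) t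
  annotate-zip = refl

annotate-boxes : ∀ {γ δ α β P} → Tab γ δ α β P → annotate α β (boxes P) ≡ P
annotate-boxes tab = trans annotate-zip (zip-boxes tab)

-- t is a tableau of RW_{γ/δ}(α/β).
record IsRW (γ δ α β : Partition) (t : Tableau) : Set where
  field
    outer : IsPartition γ
    inner : δ ⊆ₚ γ
    tab : Tab γ δ α β (annotate α β t)
    plain : boxes (annotate α β t) ≡ t

IsRW⁺ : ∀ {γ δ α β P} → IsPartition γ → δ ⊆ₚ γ → Tab γ δ α β P → IsRW γ δ α β (boxes P)
IsRW⁺ {γ} {δ} {α} {β} G s tab = record { outer = G ; inner = s ; tab = subst (Tab γ δ α β) (sym (annotate-boxes tab)) tab ; plain = cong boxes (annotate-boxes tab) }

IsRW⇒∈ : ∀ {γ δ α β t} → IsRW γ δ α β t → t ∈ RW γ δ α β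
IsRW⇒∈ {γ} {δ} {α} {β} p = subst (_∈ RW γ δ α β) (IsRW.plain p) (RW-complete (IsRW.tab p))

∈⇒IsRW : ∀ {γ δ α β t} → IsPartition γ → IsPartition δ → IsPartition α → IsPartition β → δ ⊆ₚ γ → t ∈ RW γ δ α β → IsRW γ δ α β t
∈⇒IsRW {γ} {δ} {α} {β} G D A B s i = record { outer = G ; inner = s
  ; tab = subst (Tab γ δ α β) (sym annotate-zip) (proj₁ (RW-sound G D A B i)) ; plain = trans (cong boxes annotate-zip) (proj₂ (RW-sound G D A B i)) }

extensions : Partition → Partition → List Partition
extensions ν α = filterB (λ l → containedB ν l) (partitionsOf (size ν + size α))

opaque
  products : Partition → Partition → List (Partition × Tableau)
  products ν α = pairs (extensions ν α) (λ l → RW l ν α [])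

  Σℤ-products : ∀ ν α {w : Partition × Tableau → ℤ} → Σℤ (products ν α) w ≡ Σℤ (extensions ν α) (λ l → Σℤ (RW l ν α []) (λ t → w (l , t)))
  Σℤ-products ν α = Σℤ-pairs (extensions ν α)

  products-unique : ∀ ν α → Unique (products ν α)
  products-unique ν α = pairs-unique (AllPairs-filterB (containedB ν) (partsBounded-unique n n n)) (λ {l} _ → RW-unique l ν α [])
    where
    n : ℕ
    n = size ν + size α

  ∈-products⁺ : ∀ {ν α l t} → IsRW l ν α [] t → (l , t) ∈ products ν α
  ∈-products⁺ {ν} {α} {l} p = ∈-pairs⁺ {f = λ l → RW l ν α []} (∈-filterB⁺ {p = containedB ν} (∈-partitionsOf⁺ (IsRW.outer p) (Tab-size {l} {ν} {α} {[]} (IsRW.inner p) ∅-⊆ (IsRW.tab p))) (containedB⁺ {ν} {l} (IsRW.inner p))) (IsRW⇒∈ p)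

  products-⊇ : ∀ {ν α l t} → (l , t) ∈ products ν α → ν ⊆ₚ l
  products-⊇ {ν} {α} {l} i = containedB⁻ {ν} {l} (proj₂ (∈-filterB⁻ {p = containedB ν} (partitionsOf (size ν + size α)) (proj₁ (∈-pairs⁻ (extensions ν α) {f = λ l → RW l ν α []} i))))

  ∈-products⁻ : ∀ {ν α l t} → IsPartition ν → IsPartition α → (l , t) ∈ products ν α → IsRW l ν α [] t
  ∈-products⁻ {ν} {α} {l} {t} N A i = ∈⇒IsRW (proj₁ (∈-partitionsOf⁻ {size ν + size α} (proj₁ ext))) N A ∅-partition (containedB⁻ {ν} {l} (proj₂ ext)) (proj₂ split)
    where
    split : l ∈ extensions ν α × t ∈ RW l ν α []
    split = ∈-pairs⁻ (extensions ν α) {f = λ l → RW l ν α []} i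
    ext : l ∈ partitionsOf (size ν + size α) × containedB ν l ≡ true
    ext = ∈-filterB⁻ {p = containedB ν} (partitionsOf (size ν + size α)) (proj₁ split)

arrowsTo : Partition → Partition → Partition → Partition → List Arrow
arrowsTo a₁ a₂ b₂ b₁ = map (λ t → (b₁ , b₂ , t)) (RW b₁ a₁ a₂ b₂)

candidates : (Partition → Partition → Bool) → Partition → Partition → Partition → List Partition
candidates e a₁ a₂ b₂ = filterB (λ b₁ → containedB a₁ b₁ ∧ e b₁ b₂) (partitionsOf (size a₁ + (size a₂ ∸ size b₂)))

arrowsOver : (Partition → Partition → Bool) → Partition → Partition → Partition → List Arrow
arrowsOver e a₁ a₂ b₂ = concatMap (arrowsTo a₁ a₂ b₂) (candidates e a₁ a₂ b₂)

record IsArrow (a₁ a₂ : Partition) (a : Arrow) : Set where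
  field
    small : IsPartition (proj₁ (proj₂ a))
    below : proj₁ (proj₂ a) ⊆ₚ a₂
    isRW : IsRW (proj₁ a) a₁ a₂ (proj₁ (proj₂ a)) (proj₂ (proj₂ a))

-- arrowsFrom with the exclusion of identities replaced by an arbitrary condition e on the target.
opaque
  arrowsBy : (Partition → Partition → Bool) → Partition → Partition → List Arrow
  arrowsBy e a₁ a₂ = concatMap (arrowsOver e a₁ a₂) (subPartitions a₂)

  arrowsFrom-arrowsBy : ∀ a₁ a₂ → arrowsFrom (a₁ , a₂) ≡ arrowsBy (λ b₁ b₂ → not (eqListℕ a₁ b₁ ∧ eqListℕ a₂ b₂)) a₁ a₂
  arrowsFrom-arrowsBy a₁ a₂ = refl

  ∈-arrowsBy⁺ : ∀ e {a₁ a₂ b₁ b₂ t} → IsArrow a₁ a₂ (b₁ , b₂ , t) → e b₁ b₂ ≡ true → (b₁ , b₂ , t) ∈ arrowsBy e a₁ a₂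
  ∈-arrowsBy⁺ e {a₁} {a₂} {b₁} {b₂} {t} p h = ∈-concatMap⁺ {f = arrowsOver e a₁ a₂} (∈-subPartitions⁺ {b₂} {a₂} small below)
    (∈-concatMap⁺ {f = arrowsTo a₁ a₂ b₂} (∈-filterB⁺ {p = λ b₁ → containedB a₁ b₁ ∧ e b₁ b₂} (∈-partitionsOf⁺ outer (Tab-size {b₁} {a₁} {a₂} {b₂} inner below tab))
      (∧-intro (containedB⁺ {a₁} {b₁} inner) h)) (∈-map⁺ (λ t → (b₁ , b₂ , t)) (IsRW⇒∈ isRW)))
    where
    open IsArrow p
    open IsRW isRW

  ∈-arrowsBy⁻ : ∀ e {a₁ a₂ b₁ b₂ t} → IsPartition a₁ → IsPartition a₂ → (b₁ , b₂ , t) ∈ arrowsBy e a₁ a₂ → IsArrow a₁ a₂ (b₁ , b₂ , t) × e b₁ b₂ ≡ true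
  ∈-arrowsBy⁻ e {a₁} {a₂} {b₁} {b₂} {t} A₁ A₂ i = find i
    where
    Found : List ℕ → Tableau → Set
    Found b t = b ∈ candidates e a₁ a₂ b₂ × t ∈ RW b a₁ a₂ b₂
    arrow : b₂ ∈ subPartitions a₂ → Found b₁ t → IsArrow a₁ a₂ (b₁ , b₂ , t) × e b₁ b₂ ≡ true
    arrow j (k , l) = record { small = proj₁ sub ; below = proj₂ sub
      ; isRW = ∈⇒IsRW (proj₁ (∈-partitionsOf⁻ {size a₁ + (size a₂ ∸ size b₂)} (proj₁ cand))) A₁ A₂ (proj₁ sub) (containedB⁻ {a₁} {b₁} (proj₁ (∧-elim (proj₂ cand)))) l }
      , proj₂ (∧-elim {containedB a₁ b₁} (proj₂ cand))
      where
      sub : IsPartition b₂ × b₂ ⊆ₚ a₂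
      sub = ∈-subPartitions⁻ {b₂} {a₂} j
      cand : b₁ ∈ partitionsOf (size a₁ + (size a₂ ∸ size b₂)) × (containedB a₁ b₁ ∧ e b₁ b₂) ≡ true
      cand = ∈-filterB⁻ {p = λ b₁ → containedB a₁ b₁ ∧ e b₁ b₂} (partitionsOf (size a₁ + (size a₂ ∸ size b₂))) k
    to₁ : ∀ {b b'} → (b₁ , b₂ , t) ∈ arrowsTo a₁ a₂ b' b → b' ≡ b₂ × b ≡ b₁ × t ∈ RW b a₁ a₂ b'
    to₁ {b} {b'} m with ∈-map⁻ (λ t → (b , b' , t)) m
    ... | _ , l , refl = refl , refl , l
    over : ∀ {b'} → (b₁ , b₂ , t) ∈ arrowsOver e a₁ a₂ b' → b' ≡ b₂ × (b₁ ∈ candidates e a₁ a₂ b' × t ∈ RW b₁ a₁ a₂ b')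
    over {b'} k with ∈-concatMap⁻ {f = arrowsTo a₁ a₂ b'} (candidates e a₁ a₂ b') k
    ... | b , l , m with to₁ {b} {b'} m
    ...   | p , refl , n = p , l , n
    find : (b₁ , b₂ , t) ∈ arrowsBy e a₁ a₂ → IsArrow a₁ a₂ (b₁ , b₂ , t) × e b₁ b₂ ≡ true
    find i with ∈-concatMap⁻ {f = arrowsOver e a₁ a₂} (subPartitions a₂) i
    ... | b' , j , k with over {b'} k
    ...   | refl , m = arrow j m

  arrowsBy-unique : ∀ e a₁ a₂ → Unique (arrowsBy e a₁ a₂)
  arrowsBy-unique e a₁ a₂ = AllPairs-concatMap {f = arrowsOver e a₁ a₂} (subPartitions-unique a₂)
    (λ {b₂} _ → AllPairs-concatMap {f = arrowsTo a₁ a₂ b₂} (AllPairs-filterB (λ b₁ → containedB a₁ b₁ ∧ e b₁ b₂)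
        (partsBounded-unique (size a₁ + (size a₂ ∸ size b₂)) (size a₁ + (size a₂ ∸ size b₂)) (size a₁ + (size a₂ ∸ size b₂))))
      (λ {b₁} _ → Uniqueₚ.map⁺ (λ { refl → refl }) (RW-unique b₁ a₁ a₂ b₂)) λ n i j e → n (trans (sym (to₁ i)) (trans (cong proj₁ e) (to₁ j))))
    λ {b₂} {b₂'} n i j e → n (trans (sym (over b₂ i)) (trans (cong (proj₁ ∘ proj₂) e) (over b₂' j)))
    where
    to₁ : ∀ {b₂ b₁ a} → a ∈ arrowsTo a₁ a₂ b₂ b₁ → proj₁ a ≡ b₁
    to₁ i with ∈-map⁻ _ i
    ... | _ , _ , refl = refl
    over : ∀ b₂ {a} → a ∈ arrowsOver e a₁ a₂ b₂ → proj₁ (proj₂ a) ≡ b₂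
    over b₂ i with ∈-concatMap⁻ {f = arrowsTo a₁ a₂ b₂} (candidates e a₁ a₂ b₂) i
    ... | b₁ , _ , k with ∈-map⁻ (λ t → (b₁ , b₂ , t)) k
    ...   | _ , _ , refl = refl

-- All arrows with a given source, identities included.
arrows⁺ : Pair → List Arrow
arrows⁺ (a₁ , a₂) = arrowsBy (λ _ _ → true) a₁ a₂

∈-arrows⁺⁺ : ∀ {a₁ a₂ b₁ b₂ t} → IsArrow a₁ a₂ (b₁ , b₂ , t) → (b₁ , b₂ , t) ∈ arrows⁺ (a₁ , a₂)
∈-arrows⁺⁺ p = ∈-arrowsBy⁺ (λ _ _ → true) p refl

∈-arrows⁺⁻ : ∀ {a₁ a₂ b₁ b₂ t} → IsPartition a₁ → IsPartition a₂ → (b₁ , b₂ , t) ∈ arrows⁺ (a₁ , a₂) → IsArrow a₁ a₂ (b₁ , b₂ , t)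
∈-arrows⁺⁻ A₁ A₂ i = proj₁ (∈-arrowsBy⁻ (λ _ _ → true) A₁ A₂ i)

arrows⁺-unique : ∀ p → Unique (arrows⁺ p)
arrows⁺-unique (a₁ , a₂) = arrowsBy-unique (λ _ _ → true) a₁ a₂

-- Infusion acts on lists of entries, while the sums run over shapes with tableaux; injectivity
-- requires that the shapes can be recovered from the entries.
Std-outer-unique : ∀ {γ γ' δ t} → IsPartition γ → IsPartition γ' → δ ⊆ₚ γ → δ ⊆ₚ γ' → Std γ δ t → Std γ' δ t → γ ≡ γ'
Std-outer-unique {δ = δ} G G' s s' S S' = ⊆ₚ-antisym G G' (sub s' S S') (sub s S' S)
  where
  sub : ∀ {γ γ' t} → δ ⊆ₚ γ' → Std γ δ t → Std γ' δ t → γ ⊆ₚ γ'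
  sub s' S S' {b} p with b ∈ₚ? δ
  ... | yes q = s' q
  ... | no q = proj₁ (Std.sound S' (Std.complete S (p , q)))

rl-inner-unique : ∀ {α β β'} → IsPartition β → IsPartition β' → β ⊆ₚ α → β' ⊆ₚ α → rl α β ≡ rl α β' → β ≡ β'
rl-inner-unique {α} B B' s s' e = ⊆ₚ-antisym B B' (sub s e) (sub s' (sym e))
  where
  sub : ∀ {β β'} → β ⊆ₚ α → rl α β ≡ rl α β' → β ⊆ₚ β'
  sub {β} {β'} s e {b} p with b ∈ₚ? β'
  ... | yes q = q
  ... | no q = ⊥-elim (proj₂ (∈-rl⁻ {α} {β} (subst (b ∈_) (sym e) (∈-rl⁺ {α} {β'} (s p , q)))) p)

module _ {γ δ α β t} (p : IsRW γ δ α β t) where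
  open IsRW p

  annotated-length : length t ≡ length (rl α β)
  annotated-length = trans (cong length (sym plain)) (trans (Listₚ.length-map box (annotate α β t)) (trans (sym (Listₚ.length-map cell (annotate α β t))) (cong length (Tab.cells tab))))

IsRW-outer-unique : ∀ {γ γ' δ δ' α β α' β' t t'} → IsRW γ δ α β t → IsRW γ' δ' α' β' t' → δ ≡ δ' → t ≡ t' → γ ≡ γ'
IsRW-outer-unique {γ} {γ'} {δ} p q refl refl = Std-outer-unique (IsRW.outer p) (IsRW.outer q) (IsRW.inner p) (IsRW.inner q)
  (subst (Std γ δ) (IsRW.plain p) (Tab.std (IsRW.tab p))) (subst (Std γ' δ) (IsRW.plain q) (Tab.std (IsRW.tab q)))

annotate-injective : ∀ {γ δ α β γ' δ' α' β' t t'} → IsRW γ δ α β t → IsRW γ' δ' α' β' t' → annotate α β t ≡ annotate α' β' t' → t ≡ t' × rl α β ≡ rl α' β'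
annotate-injective p q e = trans (sym (IsRW.plain p)) (trans (cong boxes e) (IsRW.plain q))
  , trans (sym (Tab.cells (IsRW.tab p))) (trans (cong (map cell) e) (Tab.cells (IsRW.tab q)))

stack : ∀ {μ ν l α β β' t₁ t₂} → IsRW l ν α [] t₁ → IsRW μ l β β' t₂ → Stacked μ ν α [] β β' (annotate α [] t₁) (annotate β β' t₂)
stack {l = l} p q = record
  { middle = l ; partition = IsRW.outer p ; lower = IsRW.inner p ; upper = IsRW.inner q ; left = IsRW.tab p ; right = IsRW.tab q }

Stacked-left : ∀ {μ ν β γ α ε s u} (S : Stacked μ ν β γ α ε s u) → IsRW (Stacked.middle S) ν β γ (boxes s)
Stacked-left S = IsRW⁺ (Stacked.partition S) (Stacked.lower S) (Stacked.left S)

Stacked-right : ∀ {μ ν β γ α ε s u} → IsPartition μ → (S : Stacked μ ν β γ α ε s u) → IsRW μ (Stacked.middle S) α ε (boxes u)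
Stacked-right M S = IsRW⁺ M (Stacked.upper S) (Stacked.right S)

annotate-left : ∀ {μ ν β γ α ε s u} → Stacked μ ν β γ α ε s u → annotate β γ (boxes s) ≡ s
annotate-left S = annotate-boxes (Stacked.left S)

annotate-right : ∀ {μ ν β γ α ε s u} → Stacked μ ν β γ α ε s u → annotate α ε (boxes u) ≡ u
annotate-right S = annotate-boxes (Stacked.right S)

-- Commutativity of products

module _ {ν α β : Partition} (N : IsPartition ν) (A : IsPartition α) (B : IsPartition β) where

  private
    twice : Partition → Partition → List ((Partition × Tableau) × (Partition × Tableau))
    twice α β = pairs (products ν α) (λ p → products (proj₁ p) β)

    Switch : (Partition × Tableau) × (Partition × Tableau) → (Partition × Tableau) × (Partition × Tableau) → Set
    Switch ((l , t₁) , (μ , t₂)) ((k , s) , (μ' , u)) = μ ≡ μ' × infuse (annotate α [] t₁) (annotate β [] t₂) ≡ (annotate β [] s , annotate α [] u)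

    twice-unique : ∀ α β → Unique (twice α β)
    twice-unique α β = pairs-unique (products-unique ν α) λ {p} _ → products-unique (proj₁ p) β

    member : ∀ {α β l t₁ μ t₂} → IsPartition α → IsPartition β → ((l , t₁) , (μ , t₂)) ∈ twice α β → IsRW l ν α [] t₁ × IsRW μ l β [] t₂
    member {α} {β} A B i with ∈-pairs⁻ (products ν α) {f = λ p → products (proj₁ p) β} i
    ... | j , k with ∈-products⁻ {ν} {α} N A j
    ...   | p = p , ∈-products⁻ (IsRW.outer p) B k

    member⁺ : ∀ {α β l t₁ μ t₂} → IsRW l ν α [] t₁ → IsRW μ l β [] t₂ → ((l , t₁) , (μ , t₂)) ∈ twice α β
    member⁺ {α} {β} p q = ∈-pairs⁺ {f = λ p → products (proj₁ p) β} (∈-products⁺ p) (∈-products⁺ q)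

    same : ∀ {α β l t₁ μ t₂ l' t₁' μ' t₂'} → IsRW l ν α [] t₁ × IsRW μ l β [] t₂ → IsRW l' ν α [] t₁' × IsRW μ' l' β [] t₂' → μ ≡ μ' →
      _≡_ {A = List Entry × List Entry} (annotate α [] t₁ , annotate β [] t₂) (annotate α [] t₁' , annotate β [] t₂') →
      _≡_ {A = (Partition × Tableau) × (Partition × Tableau)} ((l , t₁) , (μ , t₂)) ((l' , t₁') , (μ' , t₂'))
    same {t₁ = t₁} {t₁' = t₁'} (p , q) (p' , q') e₀ e = cong₂ _,_ (cong₂ _,_ (IsRW-outer-unique p p' refl h₁) h₁) (cong₂ _,_ e₀ (proj₁ (annotate-injective q q' (cong proj₂ e))))
      where
      h₁ : t₁ ≡ t₁'
      h₁ = proj₁ (annotate-injective p p' (cong proj₁ e))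

  -- `φ` sees only the outermost shape, and this is common to both sides of `Switch` because
  -- infusion permutes the boxes of the union.
  products-commute : (φ : Partition → ℤ) →
    Σℤ (products ν α) (λ p → Σℤ (products (proj₁ p) β) (φ ∘ proj₁)) ≡ Σℤ (products ν β) (λ p → Σℤ (products (proj₁ p) α) (φ ∘ proj₁))
  products-commute φ = trans (sym (Σℤ-pairs (products ν α))) (trans
    (Σℤ-relation Switch (twice α β) {twice β α} {λ p → φ (proj₁ (proj₂ p))} {λ p → φ (proj₁ (proj₂ p))} (twice-unique α β) (twice-unique β α) to from fun inj λ (e , _) → cong φ e)
    (Σℤ-pairs (products ν β)))
    where
    to : ∀ {x} → x ∈ twice α β → ∃[ y ] (y ∈ twice β α × Switch x y)
    to {(l , t₁) , (μ , t₂)} i with member A B i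
    ... | p , q = ((Stacked.middle S , boxes s₁) , (μ , boxes u₁)) , member⁺ (Stacked-left S) (Stacked-right (IsRW.outer q) S) ,
        refl , cong₂ _,_ (sym (annotate-left S)) (sym (annotate-right S))
      where
      s₁ = proj₁ (infuse (annotate α [] t₁) (annotate β [] t₂))
      u₁ = proj₂ (infuse (annotate α [] t₁) (annotate β [] t₂))
      S : Stacked μ ν β [] α [] s₁ u₁
      S = infuse-Stacked (IsRW.outer q) N (stack p q)
    from : ∀ {y} → y ∈ twice β α → ∃[ x ] (x ∈ twice α β × Switch x y)
    from {(k , s) , (μ , u)} i with member B A i
    ... | p , q = ((Stacked.middle S , boxes t₁) , (μ , boxes t₂)) , member⁺ (Stacked-left S) (Stacked-right (IsRW.outer q) S) ,
        refl , trans (cong₂ infuse (annotate-left S) (annotate-right S)) (infuse-uninfuse (IsRW.outer q) N (stack p q))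
      where
      t₁ = proj₁ (uninfuse (annotate β [] s) (annotate α [] u))
      t₂ = proj₂ (uninfuse (annotate β [] s) (annotate α [] u))
      S : Stacked μ ν α [] β [] t₁ t₂
      S = uninfuse-Stacked (IsRW.outer q) N (stack p q)
    fun : ∀ {x y y'} → x ∈ twice α β → y ∈ twice β α → y' ∈ twice β α → Switch x y → Switch x y' → y ≡ y'
    fun {_ , _} {(_ , _) , (_ , _)} {(_ , _) , (_ , _)} _ j j' (e₀ , e) (e₀' , e') = same {β} {α} (member B A j) (member B A j') (trans (sym e₀) e₀') (trans (sym e) e')
    inj : ∀ {x x' y} → x ∈ twice α β → x' ∈ twice α β → y ∈ twice β α → Switch x y → Switch x' y → x ≡ x'
    inj {(_ , _) , (_ , _)} {(_ , _) , (_ , _)} {_ , _} i i' _ (e₀ , e) (e₀' , e') = same {α} {β} p p' (trans e₀ (sym e₀'))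
      (trans (sym (uninfuse-infuse (IsRW.outer (proj₂ p)) N (stack (proj₁ p) (proj₂ p))))
        (trans (cong (λ z → uninfuse (proj₁ z) (proj₂ z)) (trans e (sym e'))) (uninfuse-infuse (IsRW.outer (proj₂ p')) N (stack (proj₁ p') (proj₂ p')))))
      where
      p = member A B i
      p' = member A B i'

-- The row rule on annotated tableaux

module _ (r : ℕ) {a₂ b₂ : Partition} {t : Tableau} (len : length t ≡ length (rl a₂ b₂)) where

  private
    ρ = rl a₂ b₂
    P = annotate a₂ b₂ t

    at-entry : ∀ i → at (o , o) P i ≡ (boxOf ρ i , boxOf t i)
    at-entry i = trans (cong (λ z → at (o , o) z i) annotate-zip) (at-zip o o ρ t (sym len) i)

    lenP : length P ≡ length ρ
    lenP = trans (cong length annotate-zip) (trans (length-zip ρ t (sym len)) len)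

    all-entries : ∀ (p : Entry → Bool) → allB (λ i → p (boxOf ρ i , boxOf t i)) (range1 (length ρ)) ≡ true → ∀ {e} → e ∈ P → p e ≡ true
    all-entries p h {e} i with ∈-at (o , o) i
    ... | k , k⁺ , k≤ , q = subst (λ z → p z ≡ true) (trans (sym (at-entry k)) q) (allB-elim {xs = range1 (length ρ)} h (∈-range1⁺ k⁺ (subst (k ≤_) lenP k≤)))

    all-entries⁻ : ∀ (p : Entry → Bool) → (∀ {e} → e ∈ P → p e ≡ true) → allB (λ i → p (boxOf ρ i , boxOf t i)) (range1 (length ρ)) ≡ true
    all-entries⁻ p h = allB-intro (range1 (length ρ)) λ {k} i → subst (λ z → p z ≡ true) (at-entry k)
      (h (at-∈ (o , o) P (proj₁ (∈-range1⁻ i)) (subst (k ≤_) (sym lenP) (proj₂ (∈-range1⁻ i)))))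

  rowRule⁻ : rowRuleB r a₂ b₂ t ≡ true → ∀ {e} → e ∈ P → Sat r e
  rowRule⁻ h {e} i = satB⁻ r e (all-entries (satB r) h i)

  rowRule⁺ : (∀ {e} → e ∈ P → Sat r e) → rowRuleB r a₂ b₂ t ≡ true
  rowRule⁺ h = all-entries⁻ (satB r) λ {e} i → satB⁺ r e (h i)

  revRowRule⁻ : revRowRuleB r a₂ b₂ t ≡ true → ∀ {e} → e ∈ P → ¬ Sat r e
  revRowRule⁻ h {e} i = unsB⁻ r e (all-entries (unsB r) h i)

  revRowRule⁺ : (∀ {e} → e ∈ P → ¬ Sat r e) → revRowRuleB r a₂ b₂ t ≡ true
  revRowRule⁺ h = all-entries⁻ (unsB r) λ {e} i → unsB⁺ r e (h i)

-- The exchange bijection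

satArrows : ℕ → Partition → Partition → List Arrow
satArrows r ν β = filterB (satRowRule r (ν , β)) (arrows⁺ (ν , β))

revArrows : ℕ → Partition → Partition → Tableau → List Arrow
revArrows r μ γ u = filterB (λ a → satRowRule r (μ , γ) a ∧ slideRevRowRule r γ u a) (arrows⁺ (μ , γ))

module Exchange (r : ℕ) {ν α β : Partition} (N : IsPartition ν) (A : IsPartition α) (B : IsPartition β) where
  open RowRule r
  open RowRuleSlides r

  AllSat AllUnsat : List Entry → Set
  AllSat P = ∀ {e} → e ∈ P → Sat r e
  AllUnsat P = ∀ {e} → e ∈ P → ¬ Sat r e

  Left Right : Set
  Left = (Partition × Tableau) × Arrow
  Right = Arrow × ((Partition × Tableau) × Arrow)

  record IsLeft (x : Left) : Set where
    constructor mkLeft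
    open Σ x renaming (proj₁ to lt; proj₂ to a)
    field
      first : IsRW (proj₁ lt) ν α [] (proj₂ lt)
      arrow : IsArrow (proj₁ lt) β a
      sat : AllSat (annotate β (proj₁ (proj₂ a)) (proj₂ (proj₂ a)))

  record IsRight (y : Right) : Set where
    constructor mkRight
    open Σ y renaming (proj₁ to a; proj₂ to rest)
    open Σ rest renaming (proj₁ to mu; proj₂ to b)
    γ = proj₁ (proj₂ a)
    field
      arrow₁ : IsArrow ν β a
      sat₁ : AllSat (annotate β γ (proj₂ (proj₂ a)))
      second : IsRW (proj₁ mu) (proj₁ a) α [] (proj₂ mu)
      arrow₂ : IsArrow (proj₁ mu) γ b
      sat₂ : AllSat (annotate γ (proj₁ (proj₂ b)) (proj₂ (proj₂ b)))
      rev : AllUnsat (proj₁ (infuse (annotate α [] (proj₂ mu)) (annotate γ (proj₁ (proj₂ b)) (proj₂ (proj₂ b)))))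

  Slide-annotate : ∀ {μ ν l α β β' t₁ t₂} → IsPartition ν → (p : IsRW l ν α [] t₁) (q : IsRW μ l β β' t₂) →
    Slide t₁ t₂ ≡ boxes (proj₁ (infuse (annotate α [] t₁) (annotate β β' t₂)))
  Slide-annotate N p q = trans (cong₂ Slide (sym (IsRW.plain p)) (sym (IsRW.plain q))) (Slide-infuse (IsRW.outer q) N (stack p q))

  module _ {μ δ γ γ' ε : Partition} {u t : Tableau} (D : IsPartition δ) (p : IsRW μ δ α [] u) (q : IsRW ε μ γ γ' t) where

    private
      S : Stacked ε δ γ γ' α [] (proj₁ (infuse (annotate α [] u) (annotate γ γ' t))) (proj₂ (infuse (annotate α [] u) (annotate γ γ' t)))
      S = infuse-Stacked (IsRW.outer q) D (stack p q)

      slid : annotate γ γ' (Slide u t) ≡ proj₁ (infuse (annotate α [] u) (annotate γ γ' t))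
      slid = trans (cong (annotate γ γ') (Slide-annotate D p q)) (annotate-left S)

      len : length (Slide u t) ≡ length (rl γ γ')
      len = trans (cong length (Slide-annotate D p q)) (annotated-length (Stacked-left S))

    slideRev⁻ : revRowRuleB r γ γ' (Slide u t) ≡ true → AllUnsat (proj₁ (infuse (annotate α [] u) (annotate γ γ' t)))
    slideRev⁻ h {e} i = revRowRule⁻ r len h (subst (e ∈_) (sym slid) i)

    slideRev⁺ : AllUnsat (proj₁ (infuse (annotate α [] u) (annotate γ γ' t))) → revRowRuleB r γ γ' (Slide u t) ≡ true
    slideRev⁺ h = revRowRule⁺ r len λ {e} i → h (subst (e ∈_) slid i)

  ∈-satArrows⁻ : ∀ {ν β b₁ b₂ t} → IsPartition ν → IsPartition β → (b₁ , b₂ , t) ∈ satArrows r ν β → IsArrow ν β (b₁ , b₂ , t) × AllSat (annotate β b₂ t)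
  ∈-satArrows⁻ {ν} {β} {b₁} {b₂} {t} N B i = arr , rowRule⁻ r (annotated-length (IsArrow.isRW arr)) (proj₂ h)
    where
    h : (b₁ , b₂ , t) ∈ arrows⁺ (ν , β) × satRowRule r (ν , β) (b₁ , b₂ , t) ≡ true
    h = ∈-filterB⁻ {p = satRowRule r (ν , β)} (arrows⁺ (ν , β)) i
    arr : IsArrow ν β (b₁ , b₂ , t)
    arr = ∈-arrows⁺⁻ N B (proj₁ h)

  ∈-satArrows⁺ : ∀ {ν β b₁ b₂ t} → IsArrow ν β (b₁ , b₂ , t) → AllSat (annotate β b₂ t) → (b₁ , b₂ , t) ∈ satArrows r ν β
  ∈-satArrows⁺ {ν} {β} arr s = ∈-filterB⁺ {p = satRowRule r (ν , β)} (∈-arrows⁺⁺ arr) (rowRule⁺ r (annotated-length (IsArrow.isRW arr)) s)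

  opaque
    lefts : List Left
    lefts = pairs (products ν α) (λ p → satArrows r (proj₁ p) β)

    rights : List Right
    rights = pairs (satArrows r ν β) (λ a → pairs (products (proj₁ a) α) (λ p → revArrows r (proj₁ p) (proj₁ (proj₂ a)) (proj₂ p)))

    Σℤ-lefts : ∀ {w} → Σℤ lefts w ≡ Σℤ (products ν α) (λ p → Σℤ (satArrows r (proj₁ p) β) (λ a → w (p , a)))
    Σℤ-lefts = Σℤ-pairs (products ν α)

    Σℤ-rights : ∀ {w} → Σℤ rights w ≡ Σℤ (satArrows r ν β) (λ a → Σℤ (products (proj₁ a) α) (λ p → Σℤ (revArrows r (proj₁ p) (proj₁ (proj₂ a)) (proj₂ p)) (λ b → w (a , p , b))))
    Σℤ-rights = trans (Σℤ-pairs (satArrows r ν β)) (Σℤ-cong (satArrows r ν β) λ {a} _ → Σℤ-pairs (products (proj₁ a) α))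

    lefts-unique : Unique lefts
    lefts-unique = pairs-unique (products-unique ν α) λ {p} _ → AllPairs-filterB (satRowRule r (proj₁ p , β)) (arrows⁺-unique (proj₁ p , β))

    rights-unique : Unique rights
    rights-unique = pairs-unique (AllPairs-filterB (satRowRule r (ν , β)) (arrows⁺-unique (ν , β))) λ {a} _ →
      pairs-unique (products-unique (proj₁ a) α) λ {p} _ →
        AllPairs-filterB (λ b → satRowRule r (proj₁ p , proj₁ (proj₂ a)) b ∧ slideRevRowRule r (proj₁ (proj₂ a)) (proj₂ p) b) (arrows⁺-unique (proj₁ p , proj₁ (proj₂ a)))

    ∈-lefts⁺ : ∀ {x} → IsLeft x → x ∈ lefts
    ∈-lefts⁺ p = ∈-pairs⁺ {f = λ p → satArrows r (proj₁ p) β} (∈-products⁺ first) (∈-satArrows⁺ arrow sat)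
      where open IsLeft p

    ∈-lefts⁻ : ∀ {x} → x ∈ lefts → IsLeft x
    ∈-lefts⁻ {(l , t₁) , (ε , γ' , t₂)} i = mkLeft first (proj₁ arr) (proj₂ arr)
      where
      both : (l , t₁) ∈ products ν α × (ε , γ' , t₂) ∈ satArrows r l β
      both = ∈-pairs⁻ (products ν α) {f = λ p → satArrows r (proj₁ p) β} i
      first : IsRW l ν α [] t₁
      first = ∈-products⁻ N A (proj₁ both)
      arr : IsArrow l β (ε , γ' , t₂) × AllSat (annotate β γ' t₂)
      arr = ∈-satArrows⁻ (IsRW.outer first) B (proj₂ both)

    ∈-rights⁺ : ∀ {y} → IsRight y → y ∈ rights
    ∈-rights⁺ {(δ , γ , s₁) , (μ , u) , b} p = ∈-pairs⁺ {f = λ a → pairs (products (proj₁ a) α) (λ p → revArrows r (proj₁ p) (proj₁ (proj₂ a)) (proj₂ p))}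
      (∈-satArrows⁺ arrow₁ sat₁) (∈-pairs⁺ {f = λ p → revArrows r (proj₁ p) γ (proj₂ p)} (∈-products⁺ second)
        (∈-filterB⁺ {p = λ a → satRowRule r (μ , γ) a ∧ slideRevRowRule r γ u a} (∈-arrows⁺⁺ arrow₂)
          (∧-intro (rowRule⁺ r (annotated-length (IsArrow.isRW arrow₂)) sat₂) (slideRev⁺ (IsRW.outer (IsArrow.isRW arrow₁)) second (IsArrow.isRW arrow₂) rev))))
      where open IsRight p hiding (γ)

    ∈-rights⁻ : ∀ {y} → y ∈ rights → IsRight y
    ∈-rights⁻ {(δ , γ , s₁) , (μ , u) , (ε , γ' , t)} i = mkRight (proj₁ arr₁) (proj₂ arr₁) second arr₂
        (rowRule⁻ r (annotated-length (IsArrow.isRW arr₂)) (proj₁ rules)) (slideRev⁻ (IsRW.outer (IsArrow.isRW (proj₁ arr₁))) second (IsArrow.isRW arr₂) (proj₂ rules))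
      where
      outside : (δ , γ , s₁) ∈ satArrows r ν β × ((μ , u) , (ε , γ' , t)) ∈ pairs (products δ α) (λ p → revArrows r (proj₁ p) γ (proj₂ p))
      outside = ∈-pairs⁻ (satArrows r ν β) {f = λ a → pairs (products (proj₁ a) α) (λ p → revArrows r (proj₁ p) (proj₁ (proj₂ a)) (proj₂ p))} i
      inside : (μ , u) ∈ products δ α × (ε , γ' , t) ∈ revArrows r μ γ u
      inside = ∈-pairs⁻ (products δ α) {f = λ p → revArrows r (proj₁ p) γ (proj₂ p)} (proj₂ outside)
      final : (ε , γ' , t) ∈ arrows⁺ (μ , γ) × (satRowRule r (μ , γ) (ε , γ' , t) ∧ slideRevRowRule r γ u (ε , γ' , t)) ≡ true
      final = ∈-filterB⁻ {p = λ a → satRowRule r (μ , γ) a ∧ slideRevRowRule r γ u a} (arrows⁺ (μ , γ)) (proj₂ inside)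
      arr₁ : IsArrow ν β (δ , γ , s₁) × AllSat (annotate β γ s₁)
      arr₁ = ∈-satArrows⁻ N B (proj₁ outside)
      second : IsRW μ δ α [] u
      second = ∈-products⁻ (IsRW.outer (IsArrow.isRW (proj₁ arr₁))) A (proj₁ inside)
      arr₂ : IsArrow μ γ (ε , γ' , t)
      arr₂ = ∈-arrows⁺⁻ (IsRW.outer second) (IsArrow.small (proj₁ arr₁)) (proj₁ final)
      rules : satRowRule r (μ , γ) (ε , γ' , t) ≡ true × slideRevRowRule r γ u (ε , γ' , t) ≡ true
      rules = ∧-elim (proj₂ final)

  -- Both sides are tied to the infused pair `S`, `V`: the left one by a single infusion, the right
  -- one by sorting `S` with the row rule and pulling its violating part through the same `V`. The
  -- shapes follow from the tableaux and the common target.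
  record Exchanges (x : Left) (y : Right) : Set where
    constructor exchanges
    open Σ x renaming (proj₁ to lt; proj₂ to a)
    open Σ y renaming (proj₁ to b; proj₂ to rest)
    open Σ rest renaming (proj₁ to mu; proj₂ to c)
    field
      same-target : target a ≡ target c
      {S V} : List Entry
      infused : infuse (annotate α [] (proj₂ lt)) (annotate β (proj₁ (proj₂ a)) (proj₂ (proj₂ a))) ≡ (S , V)
      satisfied : sats S ≡ annotate β (proj₁ (proj₂ b)) (proj₂ (proj₂ b))
      pulled : uninfuse (unsats S) V ≡ (annotate α [] (proj₂ mu) , annotate (proj₁ (proj₂ b)) (proj₁ (proj₂ c)) (proj₂ (proj₂ c)))

  unsats-idem : ∀ P → unsats (unsats P) ≡ unsats P
  unsats-idem [] = refl
  unsats-idem (e ∷ P) with unsB r e in q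
  ... | true rewrite q = cong (e ∷_) (unsats-idem P)
  ... | false = unsats-idem P

  unsats-[] : ∀ {P} → AllSat P → unsats P ≡ []
  unsats-[] {P} h with unsats P in q
  ... | [] = refl
  ... | e ∷ _ with ∈-unsats⁻ P (subst (e ∈_) (sym q) (here refl))
  ...   | i , n = ⊥-elim (n (h i))

  unsats-[]⁻ : ∀ {P} → unsats P ≡ [] → AllSat P
  unsats-[]⁻ {P} q {e} i with Sat? r e
  ... | yes s₁ = s₁
  ... | no n with subst (e ∈_) q (∈-unsats⁺ i n)
  ...   | ()

  module _ {ε δ γ γ' : Partition} {S V : List Entry} (E : IsPartition ε) (D : IsPartition δ) (C : IsPartition γ) (C' : IsPartition γ')
    (s₁ : Stacked ε ν β γ' α [] S V) (s₂ : Stacked ε δ γ γ' α [] (unsats S) V) where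

    -- `S` and `unsats S` have the same violating entries, so `unsats-uninfuse` applies to them.
    -- Both directions of the bijection use this to carry the row rule from one pulled tableau to
    -- the other.
    unsats-agree : unsats (proj₂ (uninfuse S V)) ≡ unsats (proj₂ (uninfuse (unsats S) V))
    unsats-agree = unsats-uninfuse V [] [] B C' C C'
      (Tab.cells (Stacked.left s₁)) (Tab.pic (Stacked.left s₁)) (stacked-valid E N s₁)
      (Tab.cells (Stacked.left s₂)) (Tab.pic (Stacked.left s₂)) (stacked-valid E D s₂) (sym (unsats-idem S))

  module FromLeft {l t₁ ε γ' t₂} (x : IsLeft ((l , t₁) , (ε , γ' , t₂))) where
    open IsLeft x
    open IsArrow arrow
    P₁ = annotate α [] t₁
    P₂ = annotate β γ' t₂
    S = proj₁ (infuse P₁ P₂)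
    V = proj₂ (infuse P₁ P₂)

    E : IsPartition ε
    E = IsRW.outer isRW

    st₀ : Stacked ε ν α [] β γ' P₁ P₂
    st₀ = stack first isRW

    st : Stacked ε ν β γ' α [] S V
    st = infuse-Stacked E N st₀

    split : SatSplit (Stacked.middle st) ν β γ' (sats S) (unsats S)
    split = sat-split (Stacked.partition st) N B small (Stacked.lower st) below (Stacked.left st)
    open SatSplit split public

    st₂ : Stacked ε δ γ γ' α [] (unsats S) V
    st₂ = record { middle = Stacked.middle st ; partition = Stacked.partition st ; lower = δ⊆δ' ; upper = Stacked.upper st ; left = right ; right = Stacked.right st }

    st₃ : Stacked ε δ α [] γ γ' (proj₁ (uninfuse (unsats S) V)) (proj₂ (uninfuse (unsats S) V))
    st₃ = uninfuse-Stacked E δ-partition st₂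

    back : infuse (proj₁ (uninfuse (unsats S) V)) (proj₂ (uninfuse (unsats S) V)) ≡ (unsats S , V)
    back = infuse-uninfuse E δ-partition st₂

    regluing : S ≡ glue β γ' (sats S) (unsats S)
    regluing = sym (glue-split (Stacked.partition st) N B small (Stacked.left st))

    uninfused : uninfuse S V ≡ (P₁ , P₂)
    uninfused = uninfuse-infuse E N st₀

    partner : Right
    partner = (δ , γ , boxes (sats S)) , (Stacked.middle st₃ , boxes (proj₁ (uninfuse (unsats S) V))) , (ε , γ' , boxes (proj₂ (uninfuse (unsats S) V)))

    partner-right : IsRight partner
    partner-right = mkRight
      (record { small = γ-partition ; below = γ⊆β₂ ; isRW = IsRW⁺ δ-partition β₁⊆δ left })
      (λ {e} i → proj₂ (∈-sats⁻ S (subst (e ∈_) (annotate-boxes left) i)))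
      (Stacked-left st₃)
      (record { small = small ; below = γ'⊆γ ; isRW = Stacked-right E st₃ })
      (λ {e} i → unsats-[]⁻ (trans (sym (unsats-agree E δ-partition γ-partition small st st₂)) (trans (cong (unsats ∘ proj₂) uninfused) (unsats-[] sat))) (subst (e ∈_) (annotate-right st₃) i))
      (λ {e} i → proj₂ (∈-unsats⁻ S (subst (e ∈_) (trans (cong₂ (λ P Q → proj₁ (infuse P Q)) (annotate-left st₃) (annotate-right st₃)) (cong proj₁ back)) i)))

    partner-exchanges : Exchanges ((l , t₁) , (ε , γ' , t₂)) partner
    partner-exchanges = exchanges refl refl (sym (annotate-boxes left)) (cong₂ _,_ (sym (annotate-left st₃)) (sym (annotate-right st₃)))

  module FromRight {δ γ s₁ μ u ε γ' t} (y : IsRight ((δ , γ , s₁) , (μ , u) , (ε , γ' , t))) where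
    open IsRight y hiding (γ)
    open IsArrow arrow₁ renaming (small to C; below to γ⊆β; isRW to isRW₁)
    open IsArrow arrow₂ renaming (small to C'; below to γ'⊆γ; isRW to isRW₂)
    U = annotate α [] u
    T' = annotate γ γ' t
    W = proj₁ (infuse U T')
    V = proj₂ (infuse U T')

    E : IsPartition ε
    E = IsRW.outer isRW₂

    D : IsPartition δ
    D = IsRW.outer isRW₁

    stU : Stacked ε δ γ γ' α [] W V
    stU = infuse-Stacked E D (stack second isRW₂)

    split : SatSplit (Stacked.middle stU) ν β γ' (annotate β γ s₁) W
    split = record { δ-partition = D ; γ-partition = C ; β₁⊆δ = IsRW.inner isRW₁ ; δ⊆δ' = Stacked.lower stU ; γ'⊆γ = γ'⊆γ ; γ⊆β₂ = γ⊆β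
                   ; left = IsRW.tab isRW₁ ; right = Stacked.left stU }

    G = glue β γ' (annotate β γ s₁) W

    glued' : Glued (Stacked.middle stU) ν β γ' (annotate β γ s₁) W
    glued' = Glue.glued (Stacked.partition stU) N B C' split sat₁ rev

    st : Stacked ε ν β γ' α [] G V
    st = record { middle = Stacked.middle stU ; partition = Stacked.partition stU ; lower = Stacked.lower stU ∘ IsRW.inner isRW₁ ; upper = Stacked.upper stU
                ; left = Glued.tab glued' ; right = Stacked.right stU }

    st₀ : Stacked ε ν α [] β γ' (proj₁ (uninfuse G V)) (proj₂ (uninfuse G V))
    st₀ = uninfuse-Stacked E N st

    pulled' : uninfuse (unsats G) V ≡ (U , T')
    pulled' = trans (cong (λ z → uninfuse z V) (Glued.unsats≡ glued')) (uninfuse-infuse E D (stack second isRW₂))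

    partner : Left
    partner = (Stacked.middle st₀ , boxes (proj₁ (uninfuse G V))) , (ε , γ' , boxes (proj₂ (uninfuse G V)))

    partner-left : IsLeft partner
    partner-left = mkLeft (Stacked-left st₀) (record { small = C' ; below = γ⊆β ∘ γ'⊆γ ; isRW = Stacked-right E st₀ })
      (λ {e} i → unsats-[]⁻ (trans (unsats-agree E D C C' st (subst (λ z → Stacked ε δ γ γ' α [] z V) (sym (Glued.unsats≡ glued')) stU)) (trans (cong (unsats ∘ proj₂) pulled') (unsats-[] sat₂)))
        (subst (e ∈_) (annotate-right st₀) i))

    partner-exchanges : Exchanges partner ((δ , γ , s₁) , (μ , u) , (ε , γ' , t))
    partner-exchanges = exchanges refl (trans (cong₂ infuse (annotate-left st₀) (annotate-right st₀)) (infuse-uninfuse E N st)) (Glued.sats≡ glued') pulled'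

  exchange-functional : ∀ {x y y'} → IsRight y → IsRight y' → Exchanges x y → Exchanges x y' → y ≡ y'
  exchange-functional {y = (δ , γ , s₁) , (μ , u) , (ε , γ' , t)} {(δ₂ , γ₂ , s₂) , (μ₂ , u₂) , (ε₂ , γ₂' , t₂)} p q x₁ x₂ =
    cong₂ _,_ (cong₂ _,_ δ-eq (cong₂ _,_ γ-eq s-eq)) (cong₂ _,_ (cong₂ _,_ (IsRW-outer-unique (second p) (second q) δ-eq u-eq) u-eq)
      (cong₂ _,_ (cong proj₁ same-end) (cong₂ _,_ (cong proj₂ same-end) (proj₁ (annotate-injective (IsArrow.isRW (arrow₂ p)) (IsArrow.isRW (arrow₂ q)) (cong proj₂ pulled-eq))))))
    where
    open IsRight hiding (γ)
    open Exchanges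
    same-end : _≡_ {A = Pair} (ε , γ') (ε₂ , γ₂')
    same-end = trans (sym (same-target x₁)) (same-target x₂)
    run-eq : _≡_ {A = List Entry × List Entry} (S x₁ , V x₁) (S x₂ , V x₂)
    run-eq = trans (sym (infused x₁)) (infused x₂)
    sat-eq : annotate β γ s₁ ≡ annotate β γ₂ s₂
    sat-eq = trans (sym (satisfied x₁)) (trans (cong (sats ∘ proj₁) run-eq) (satisfied x₂))
    pulled-eq : _≡_ {A = List Entry × List Entry} (annotate α [] u , annotate γ γ' t) (annotate α [] u₂ , annotate γ₂ γ₂' t₂)
    pulled-eq = trans (sym (pulled x₁)) (trans (cong (λ z → uninfuse (unsats (proj₁ z)) (proj₂ z)) run-eq) (pulled x₂))
    s-eq : s₁ ≡ s₂
    s-eq = proj₁ (annotate-injective (IsArrow.isRW (arrow₁ p)) (IsArrow.isRW (arrow₁ q)) sat-eq)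
    γ-eq : γ ≡ γ₂
    γ-eq = rl-inner-unique (IsArrow.small (arrow₁ p)) (IsArrow.small (arrow₁ q)) (IsArrow.below (arrow₁ p)) (IsArrow.below (arrow₁ q))
      (proj₂ (annotate-injective (IsArrow.isRW (arrow₁ p)) (IsArrow.isRW (arrow₁ q)) sat-eq))
    δ-eq : δ ≡ δ₂
    δ-eq = IsRW-outer-unique (IsArrow.isRW (arrow₁ p)) (IsArrow.isRW (arrow₁ q)) refl s-eq
    u-eq : u ≡ u₂
    u-eq = proj₁ (annotate-injective (second p) (second q) (cong proj₁ pulled-eq))

  -- Infusing the pulled pair returns `unsats S` and `V`; gluing the satisfying part back gives `S`,
  -- and `uninfuse` then restores the original tableaux.
  exchange-injective : ∀ {x x' y} → IsLeft x → IsLeft x' → Exchanges x y → Exchanges x' y → x ≡ x'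
  exchange-injective {(l , t₁) , (ε , γ' , t₂)} {(l' , t₁') , (ε₂ , γ₂' , t₂')} p p' x₁ x₂ =
    cong₂ _,_ (cong₂ _,_ (IsRW-outer-unique (first p) (first p') refl t₁-eq) t₁-eq) (cong₂ _,_ (cong proj₁ same-end) (cong₂ _,_ (cong proj₂ same-end)
      (proj₁ (annotate-injective (IsArrow.isRW (arrow p)) (IsArrow.isRW (arrow p')) (cong proj₂ same-P)))))
    where
    open IsLeft
    open Exchanges
    module X = FromLeft p
    module X' = FromLeft p'
    same-end : _≡_ {A = Pair} (ε , γ') (ε₂ , γ₂')
    same-end = trans (same-target x₁) (sym (same-target x₂))
    pull-unsats : List Entry × List Entry → List Entry × List Entry
    pull-unsats z = uninfuse (unsats (proj₁ z)) (proj₂ z)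
    same-pull : pull-unsats (X.S , X.V) ≡ pull-unsats (X'.S , X'.V)
    same-pull = trans (cong pull-unsats (infused x₁)) (trans (trans (pulled x₁) (sym (pulled x₂))) (sym (cong pull-unsats (infused x₂))))
    again : _≡_ {A = List Entry × List Entry} (unsats X.S , X.V) (unsats X'.S , X'.V)
    again = trans (sym X.back) (trans (cong (λ z → infuse (proj₁ z) (proj₂ z)) same-pull) X'.back)
    same-sats : sats X.S ≡ sats X'.S
    same-sats = trans (cong (sats ∘ proj₁) (infused x₁)) (trans (trans (satisfied x₁) (sym (satisfied x₂))) (sym (cong (sats ∘ proj₁) (infused x₂))))
    same-S : X.S ≡ X'.S
    same-S = trans X.regluing (trans (trans (cong (λ z → glue β z (sats X.S) (unsats X.S)) (cong proj₂ same-end)) (cong₂ (glue β γ₂') same-sats (cong proj₁ again))) (sym X'.regluing))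
    same-P : _≡_ {A = List Entry × List Entry} (X.P₁ , X.P₂) (X'.P₁ , X'.P₂)
    same-P = trans (sym X.uninfused) (trans (cong₂ uninfuse same-S (cong proj₂ again)) X'.uninfused)
    t₁-eq : t₁ ≡ t₁'
    t₁-eq = proj₁ (annotate-injective (first p) (first p') (cong proj₁ same-P))

  exchange : (φ : Pair → ℤ) → Σℤ lefts (λ x → φ (target (proj₂ x))) ≡ Σℤ rights (λ y → φ (target (proj₂ (proj₂ y))))
  exchange φ = Σℤ-relation Exchanges lefts lefts-unique rights-unique
    (λ i → FromLeft.partner (∈-lefts⁻ i) , ∈-rights⁺ (FromLeft.partner-right (∈-lefts⁻ i)) , FromLeft.partner-exchanges (∈-lefts⁻ i))
    (λ j → FromRight.partner (∈-rights⁻ j) , ∈-lefts⁺ (FromRight.partner-left (∈-rights⁻ j)) , FromRight.partner-exchanges (∈-rights⁻ j))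
    (λ _ j j' → exchange-functional (∈-rights⁻ j) (∈-rights⁻ j'))
    (λ i i' _ → exchange-injective (∈-lefts⁻ i) (∈-lefts⁻ i'))
    (λ e → cong φ (Exchanges.same-target e))

-- A standard filling is determined by the rows of its entries.

count : ℕ → List ℕ → ℕ
count i xs = length (filterB (λ e → e ≡ᵇ i) xs)

bump : (ℕ → ℕ) → ℕ → ℕ → ℕ
bump ℓ i j with j ℕₚ.≟ i
... | yes _ = suc (ℓ j)
... | no _ = ℓ j

bump-here : ∀ ℓ i → bump ℓ i i ≡ suc (ℓ i)
bump-here ℓ i with i ℕₚ.≟ i
... | yes _ = refl
... | no n = ⊥-elim (n refl)

bump-≥ : ∀ ℓ i j → ℓ j ≤ bump ℓ i j
bump-≥ ℓ i j with j ℕₚ.≟ i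
... | yes _ = ℕₚ.n≤1+n (ℓ j)
... | no _ = ℕₚ.≤-refl

count-∷ : ∀ ℓ i j xs → count j (i ∷ xs) + ℓ j ≡ count j xs + bump ℓ i j
count-∷ ℓ i j xs with i ≡ᵇ j in e | j ℕₚ.≟ i
... | true | yes _ = sym (ℕₚ.+-suc (count j xs) (ℓ j))
... | true | no n = ⊥-elim (n (sym (≡ᵇ-elim e)))
... | false | no _ = refl
... | false | yes refl with trans (sym e) (≡ᵇ-intro {i} refl)
...   | ()

-- Standard fillings between two functions of row lengths. Removing the first box just raises `ℓ` in
-- its row, so inductions on the filling need no intermediate partitions.
record Fills (ℓ g : ℕ → ℕ) (t : List Box) : Set where
  field
    order : AllPairs _⋠_ t
    sound : ∀ {b} → b ∈ t → 0 < row b × ℓ (row b) < col b × col b ≤ g (row b)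
    complete : ∀ {b} → 0 < row b → ℓ (row b) < col b → col b ≤ g (row b) → b ∈ t

Fills-head : ∀ {ℓ g x t} → Fills ℓ g (x ∷ t) → col x ≡ suc (ℓ (row x))
Fills-head {ℓ} {g} {i , j} F with ℕₚ.<-cmp (suc (ℓ i)) j
... | tri≈ _ p _ = sym p
... | tri> _ _ p = ⊥-elim (ℕₚ.<⇒≱ (proj₁ (proj₂ (Fills.sound F (here refl)))) (ℕₚ.≤-pred p))
... | tri< p _ _ with Fills.sound F (here refl) | Fills.order F
...   | i⁺ , _ , h | o₁ ∷ _ with Fills.complete F {i , suc (ℓ i)} i⁺ ℕₚ.≤-refl (ℕₚ.≤-trans (ℕₚ.<⇒≤ p) h)
...     | here refl = refl
...     | there k = ⊥-elim (All.lookup o₁ k (ℕₚ.≤-refl , ℕₚ.<⇒≤ p))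

Fills-tail : ∀ {ℓ g x t} → Fills ℓ g (x ∷ t) → Fills (bump ℓ (row x)) g t
Fills-tail {ℓ} {g} {x} {t} F = record
  { order = AllPairs.tail (Fills.order F)
  ; sound = λ {b} k → proj₁ (Fills.sound F (there k)) , bumped k , proj₂ (proj₂ (Fills.sound F (there k)))
  ; complete = λ {b} p q h → strip p q (Fills.complete F p (ℕₚ.≤-<-trans (bump-≥ ℓ (row x) (row b)) q) h) }
  where
  bumped : ∀ {b} → b ∈ t → bump ℓ (row x) (row b) < col b
  bumped {b} k with row b ℕₚ.≟ row x | proj₁ (proj₂ (Fills.sound F (there k)))
  ... | no _ | p = p
  ... | yes e | p = ℕₚ.≤∧≢⇒< p λ q → All.lookup (AllPairs.head (Fills.order F)) k
        (ℕₚ.≤-reflexive e , ℕₚ.≤-reflexive (trans (sym q) (trans (cong (suc ∘ ℓ) e) (sym (Fills-head F)))))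
  strip : ∀ {b} → 0 < row b → bump ℓ (row x) (row b) < col b → b ∈ x ∷ t → b ∈ t
  strip p q (there k) = k
  strip p q (here refl) = ⊥-elim (ℕₚ.<⇒≢ q (trans (bump-here ℓ (row x)) (sym (Fills-head F))))

box-≡ : {x y : Box} → row x ≡ row y → col x ≡ col y → x ≡ y
box-≡ refl refl = refl

Fills-determined : ∀ {ℓ g g' t t'} → Fills ℓ g t → Fills ℓ g' t' → map row t ≡ map row t' → t ≡ t'
Fills-determined {t = []} {[]} F F' e = refl
Fills-determined {ℓ} {t = x ∷ t} {x' ∷ t'} F F' e = cong₂ _∷_ heads
  (Fills-determined (Fills-tail F) (subst (λ z → Fills (bump ℓ (row z)) _ t') (sym heads) (Fills-tail F')) (proj₂ (Listₚ.∷-injective e)))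
  where
  heads : x ≡ x'
  heads = box-≡ (proj₁ (Listₚ.∷-injective e)) (trans (Fills-head F) (trans (cong (suc ∘ ℓ) (proj₁ (Listₚ.∷-injective e))) (sym (Fills-head F'))))

Fills-count : ∀ {ℓ g t} → Fills ℓ g t → (∀ {i} → 0 < i → ℓ i ≤ g i) → ∀ {i} → 0 < i → count i (map row t) + ℓ i ≡ g i
Fills-count {ℓ} {g} {[]} F l {i} p with ℕₚ.m≤n⇒m<n∨m≡n (l p)
... | inj₂ q = q
... | inj₁ q with Fills.complete F {i , g i} p q ℕₚ.≤-refl
...   | ()
Fills-count {ℓ} {g} {x ∷ t} F l {i} p = trans (count-∷ ℓ (row x) i (map row t)) (Fills-count (Fills-tail F) l' p)
  where
  l' : ∀ {j} → 0 < j → bump ℓ (row x) j ≤ g j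
  l' {j} q with j ℕₚ.≟ row x
  ... | no _ = l q
  ... | yes refl = subst (_≤ g (row x)) (Fills-head F) (proj₂ (proj₂ (Fills.sound F (here refl))))

Std⇒Fills : ∀ {γ δ t} → Std γ δ t → Fills (part δ) (part γ) t
Std⇒Fills {γ} {δ} S = record
  { order = Std.order S
  ; sound = λ i → InSkew⁻ {γ} {δ} (Std.sound S i)
  ; complete = λ p q h → Std.complete S (InSkew⁺ {γ} {δ} p q h) }

Fills⇒Std : ∀ {γ δ t} → Fills (part δ) (part γ) t → Std γ δ t
Fills⇒Std {γ} {δ} F = mkStd (Fills.order F) (λ i → let (p , q , h) = Fills.sound F i in InSkew⁺ {γ} {δ} p q h) λ k → let (p , q , h) = InSkew⁻ {γ} {δ} k in Fills.complete F p q h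

-- The unique tableau of RW_{α/∅}(α)

module Straight {α : Partition} (A : IsPartition α) where

  -- Every row is reflected: `rl` reads its cells from the right, and by (i) their boxes advance
  -- from the left.
  canonical : List Entry
  canonical = map (λ c → c , (row c , suc (part α (row c)) ∸ col c)) (rl α [])

  private
    cells : map cell canonical ≡ rl α []
    cells = trans (sym (Listₚ.map-∘ (rl α []))) (Listₚ.map-id (rl α []))

    mem⁻ : ∀ {c b} → (c , b) ∈ canonical → c ∈ₚ α × b ≡ (row c , suc (part α (row c)) ∸ col c)
    mem⁻ i with ∈-map⁻ _ i
    ... | c , j , refl = proj₁ (∈-rl⁻ {α} {[]} j) , refl

    straight : ∀ {c} → c ∈ₚ α → InSkew α [] c
    straight p = p , λ q → ℕₚ.<⇒≱ (proj₂ (positive q)) (fits q)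

    asc : ∀ {c d} → d ∈ₚ α → c ∈ₚ α → row c ≡ row d → col d < col c → suc (part α (row c)) ∸ col c < suc (part α (row d)) ∸ col d
    asc {x , y} {_ , y'} p q refl l = ℕₚ.∸-monoʳ-< l (ℕₚ.m≤n⇒m≤1+n (fits q))

    all-entries : AllPairs (λ e f → (e ∈ canonical × f ∈ canonical) × RL (cell e) (cell f)) canonical
    all-entries = AllPairs-∈ (λ i j p → (i , j) , p) (AllPairs-map (rl-sorted α []))

    std : Std α [] (boxes canonical)
    std = mkStd (AllPairs-map (AllPairs.map (λ { ((i , j) , p) → order (mem⁻ i) (mem⁻ j) p }) all-entries)) sound complete
      where
      order : ∀ {c b d b'} → c ∈ₚ α × b ≡ (row c , suc (part α (row c)) ∸ col c) → d ∈ₚ α × b' ≡ (row d , suc (part α (row d)) ∸ col d) → RL c d → b ⋠ b'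
      order (p , refl) (q , refl) (inj₁ l) (h , _) = ℕₚ.<⇒≱ l h
      order (p , refl) (q , refl) (inj₂ (e , l)) (_ , h) = ℕₚ.<⇒≱ (asc q p e l) h
      sound : ∀ {b} → b ∈ boxes canonical → InSkew α [] b
      sound i with ∈-map⁻ box i
      ... | (c , b) , j , refl with mem⁻ j
      ...   | p , refl = straight ((proj₁ (positive p) , ℕₚ.m<n⇒0<n∸m (s≤s (fits p))) , ℕₚ.≤-trans (ℕₚ.∸-monoʳ-≤ (suc (part α (row c))) (proj₂ (positive p))) ℕₚ.≤-refl)
      complete : ∀ {b} → InSkew α [] b → b ∈ boxes canonical
      complete {i , j} (p , _) = subst (_∈ boxes canonical) (cong (i ,_) (ℕₚ.m∸[m∸n]≡n (ℕₚ.m≤n⇒m≤1+n (fits p))))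
        (∈-map⁺ box (∈-map⁺ (λ c → c , (row c , suc (part α (row c)) ∸ col c)) (∈-rl⁺ {α} {[]} {i , suc (part α i) ∸ j}
          (straight ((proj₁ (positive p) , ℕₚ.m<n⇒0<n∸m (s≤s (fits p))) , ℕₚ.∸-monoʳ-≤ (suc (part α i)) (proj₂ (positive p)))))))

    pic : Pic canonical
    pic = record
      { ordered = AllPairs.map (λ { ((i , j) , p) → p , ascending (mem⁻ i) (mem⁻ j) p }) all-entries
      ; convex = λ i j p q → subst (_ ∈_) (sym cells) (∈-rl⁺ {α} {[]} (InSkew-convex A ∅-partition (∈-rl⁻ (subst (_ ∈_) cells i)) (∈-rl⁻ (subst (_ ∈_) cells j)) p q))
      ; desc = λ i j → descending (mem⁻ i) (mem⁻ j) }
      where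
      ascending : ∀ {c b d b'} → c ∈ₚ α × b ≡ (row c , suc (part α (row c)) ∸ col c) → d ∈ₚ α × b' ≡ (row d , suc (part α (row d)) ∸ col d) →
        RL c d → row c ≡ row d → Asc b b'
      ascending (p , refl) (q , refl) (inj₁ l) e = ⊥-elim (ℕₚ.<⇒≢ l e)
      ascending (p , refl) (q , refl) (inj₂ (_ , l)) e = asc q p e l , ℕₚ.≤-reflexive (sym e)
      descending : ∀ {c b d b'} → c ∈ₚ α × b ≡ (row c , suc (part α (row c)) ∸ col c) → d ∈ₚ α × b' ≡ (row d , suc (part α (row d)) ∸ col d) →
        Below c d → Desc b b'
      descending {x , y} (p , refl) (q , refl) (refl , refl) = ℕₚ.≤-refl , ℕₚ.∸-monoˡ-≤ y (s≤s (part-suc {α} A (proj₁ (positive p))))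

  canonical-RW : IsRW α [] α [] (boxes canonical)
  canonical-RW = IsRW⁺ A ∅-⊆ (record { cells = cells ; pic = pic ; std = std })

  module _ {l t} (p : IsRW l [] α [] t) where
    open IsRW p
    private
      P = annotate α [] t
      open Picture A ∅-partition (Tab.cells tab) (Tab.pic tab) using (skew; desc-<; entry) renaming (asc to ascP)

      -- The top cell of the column has its box in row 1 or lower, and going down the rows of boxes
      -- grow at least as fast as the rows of cells.
      ≥-row : ∀ {e} → e ∈ P → row (cell e) ≤ row (box e)
      ≥-row {(x , y) , b} i = top (proj₁ (skew i))
        where
        top : (x , y) ∈ₚ α → x ≤ row b
        top h with 1 ℕₚ.<? x
        ... | no n = ℕₚ.≤-trans (ℕₚ.≮⇒≥ n) (proj₁ (positive (proj₁ (Std.sound (Tab.std tab) (∈-map⁺ box i)))))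
        ... | yes q with entry (straight (∈ₚ-≼ A h (ℕₚ.<⇒≤ q , ℕₚ.≤-refl) (s≤s z≤n , proj₂ (positive h))))
        ...   | a , k = ℕₚ.+-cancelˡ-≤ 1 _ _ (ℕₚ.≤-trans (ℕₚ.+-monoˡ-≤ x (proj₁ (positive (proj₁ (Std.sound (Tab.std tab) (∈-map⁺ box k)))))) (ℕₚ.≤-trans (proj₁ (desc-< k i q)) (ℕₚ.≤-reflexive (ℕₚ.+-comm (row b) 1))))

      -- As the inner shape is empty, the box above belongs to an entry too, with a smaller label
      -- and hence read earlier. It is not in the same row of cells, where (i) would force different
      -- columns, so its cell is strictly higher and the induction applies.
      ≤-row : ∀ n {e} → e ∈ P → row (box e) ≡ n → row (box e) ≤ row (cell e)
      ≤-row zero i refl = z≤n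
      ≤-row (suc n) {e} i q with 0 ℕₚ.<? n
      ... | no n≯0 = ℕₚ.≤-trans (ℕₚ.≤-reflexive q) (ℕₚ.≤-trans (s≤s (ℕₚ.≮⇒≥ n≯0)) (proj₁ (positive (proj₁ (skew i)))))
      ... | yes n⁺ = via (∈-map⁻ box (Std.complete (Tab.std tab) {n , col (box e)} above))
        where
        n≤ : n ≤ row (box e)
        n≤ = ℕₚ.≤-trans (ℕₚ.n≤1+n n) (ℕₚ.≤-reflexive (sym q))
        above : InSkew l [] (n , col (box e))
        above with Std.sound (Tab.std tab) (∈-map⁺ box i)
        ... | h , k = ∈ₚ-≼ outer h (n≤ , ℕₚ.≤-refl) (n⁺ , proj₂ (positive h)) , λ q → ℕₚ.<⇒≱ (proj₂ (positive q)) (fits q)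
        via : ∃[ f ] (f ∈ P × (n , col (box e)) ≡ box f) → row (box e) ≤ row (cell e)
        via (f , k , e₁) with ≤-row n k (sym (cong row e₁)) | AllPairs-compare (AllPairs.zip (Pic.ordered (Tab.pic tab) , AllPairsₚ.map⁻ (Std.order (Tab.std tab)))) i k
        ... | _ | inj₁ refl = ⊥-elim (ℕₚ.1+n≢n (trans (sym q) (sym (cong row e₁))))
        ... | _ | inj₂ (inj₁ (_ , h)) = ⊥-elim (h (subst (_≼ box e) e₁ (n≤ , ℕₚ.≤-refl)))
        ... | ih | inj₂ (inj₂ ((inj₁ h , _) , _)) = ℕₚ.≤-trans (ℕₚ.≤-reflexive (trans q (cong suc (cong row e₁)))) (ℕₚ.≤-trans (s≤s ih) h)
        ... | _ | inj₂ (inj₂ ((inj₂ (h , _) , a) , _)) = ⊥-elim (ℕₚ.<⇒≢ (proj₁ (a h)) (sym (cong col e₁)))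

      rows : map row t ≡ map row (boxes canonical)
      rows = trans (cong (map row) (sym plain)) (trans (same-rows P λ i → ℕₚ.≤-antisym (≤-row _ i refl) (≥-row i)) (trans (cong (map row) (Tab.cells tab))
        (trans (cong (map row) (sym cells)) (sym (same-rows canonical λ i → cong row (proj₂ (mem⁻ i)))))))
        where
        same-rows : ∀ P → (∀ {e} → e ∈ P → row (box e) ≡ row (cell e)) → map row (boxes P) ≡ map row (map cell P)
        same-rows [] h = refl
        same-rows (e ∷ P) h = cong₂ _∷_ (h (here refl)) (same-rows P (h ∘ there))

    canonical-unique : t ≡ boxes canonical
    canonical-unique = Fills-determined (subst (Fills (λ i → part [] i) (part l)) plain (Std⇒Fills {l} {[]} (Tab.std tab))) (Std⇒Fills {α} {[]} std) rows

  Σℤ-straight : (φ : Partition → ℤ) → Σℤ (products [] α) (φ ∘ proj₁) ≡ φ α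
  Σℤ-straight φ = singleton (products-unique [] α) (∈-products⁺ canonical-RW) only
    where
    only : ∀ {x} → x ∈ products [] α → x ≡ (α , boxes canonical)
    only {l , t} i = cong₂ _,_ (IsRW-outer-unique p canonical-RW refl (canonical-unique p)) (canonical-unique p)
      where
      p : IsRW l [] α [] t
      p = ∈-products⁻ ∅-partition A i
    singleton : ∀ {xs} → Unique xs → (α , boxes canonical) ∈ xs → (∀ {x} → x ∈ xs → x ≡ (α , boxes canonical)) → Σℤ xs (φ ∘ proj₁) ≡ φ α
    singleton {x ∷ []} _ _ h = trans (ℤₚ.+-identityʳ _) (cong (φ ∘ proj₁) (h (here refl)))
    singleton {x ∷ y ∷ xs} ((n ∷ _) ∷ _) _ h = ⊥-elim (n (trans (h (here refl)) (sym (h (there (here refl))))))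

-- Association lists

module _ {A : Set} where

  zip-key : ∀ {ks : List Box} {vs : List A} {c a} → (c , a) ∈ zip ks vs → c ∈ ks
  zip-key {k ∷ ks} {v ∷ vs} (here refl) = here refl
  zip-key {k ∷ ks} {v ∷ vs} (there i) = there (zip-key i)

  zip-functional : ∀ {ks : List Box} {vs : List A} {c a b} → Unique ks → (c , a) ∈ zip ks vs → (c , b) ∈ zip ks vs → a ≡ b
  zip-functional {k ∷ ks} {v ∷ vs} _ (here refl) (here refl) = refl
  zip-functional {k ∷ ks} {v ∷ vs} (n ∷ _) (here refl) (there j) = ⊥-elim (All.lookup n (zip-key j) refl)
  zip-functional {k ∷ ks} {v ∷ vs} (n ∷ _) (there i) (here refl) = ⊥-elim (All.lookup n (zip-key i) refl)
  zip-functional {k ∷ ks} {v ∷ vs} (_ ∷ u) (there i) (there j) = zip-functional u i j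

  zip-total : ∀ {ks : List Box} {vs : List A} {c} → length vs ≡ length ks → c ∈ ks → ∃[ a ] (c , a) ∈ zip ks vs
  zip-total {vs = v ∷ vs} e (here refl) = v , here refl
  zip-total {vs = v ∷ vs} e (there i) with zip-total (ℕₚ.suc-injective e) i
  ... | a , j = a , there j

  zip-ext : ∀ (ks : List Box) {vs vs' : List A} → length vs ≡ length ks → length vs' ≡ length ks →
    (∀ {c a b} → (c , a) ∈ zip ks vs → (c , b) ∈ zip ks vs' → a ≡ b) → vs ≡ vs'
  zip-ext [] {[]} {[]} _ _ _ = refl
  zip-ext (k ∷ ks) {v ∷ vs} {v' ∷ vs'} e e' h = cong₂ _∷_ (h (here refl) (here refl))
    (zip-ext ks (ℕₚ.suc-injective e) (ℕₚ.suc-injective e') λ i j → h (there i) (there j))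

  zip-map⁻ : ∀ (ks : List Box) {f : Box → A} {c a} → (c , a) ∈ zip ks (map f ks) → a ≡ f c
  zip-map⁻ (k ∷ ks) (here refl) = refl
  zip-map⁻ (k ∷ ks) (there i) = zip-map⁻ ks i

  map-look : ∀ (a : A) {ks : List Box} {vs : List A} → Unique ks → length vs ≡ length ks → map (look a (zip ks vs)) ks ≡ vs
  map-look a {ks} u e = zip-ext ks (Listₚ.length-map _ ks) e λ i j → trans (zip-map⁻ ks i) (zip-functional u (look-∈ j) j)

-- Words and semistandard tableaux

∈-words⁻ : ∀ m n {w} → w ∈ words m n → length w ≡ n × (∀ {x} → x ∈ w → 0 < x × x ≤ m)
∈-words⁻ m zero (here refl) = refl , λ ()
∈-words⁻ m (suc n) i with ∈-concatMap⁻ {f = λ v → map (v ∷_) (words m n)} (range1 m) i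
... | v , j , k with ∈-map⁻ (v ∷_) k
...   | w , l , refl with ∈-words⁻ m n l
...     | e , h = cong suc e , λ { (here refl) → ∈-range1⁻ j ; (there p) → h p }

∈-words⁺ : ∀ m {w} → (∀ {x} → x ∈ w → 0 < x × x ≤ m) → w ∈ words m (length w)
∈-words⁺ m {[]} h = here refl
∈-words⁺ m {x ∷ w} h = ∈-concatMap⁺ {f = λ v → map (v ∷_) (words m (length w))} (∈-range1⁺ (proj₁ (h (here refl))) (proj₂ (h (here refl)))) (∈-map⁺ (x ∷_) (∈-words⁺ m (h ∘ there)))

words-unique : ∀ m n → Unique (words m n)
words-unique m zero = [] ∷ []
words-unique m (suc n) = AllPairs-concatMap {f = λ v → map (v ∷_) (words m n)} (range1-< m) (λ _ → Uniqueₚ.map⁺ Listₚ.∷-injectiveʳ (words-unique m n))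
  λ p i j e → ℕₚ.<⇒≢ p (∈-map-∷ i j e)

record IsSSYT (N : ℕ) (κ : Partition) (X : List ℕ) : Set where
  field
    len : length X ≡ length (skewBoxes κ [])
    bounds : ∀ {x} → x ∈ X → 0 < x × x ≤ N
    rows : ∀ {c d a b} → (c , a) ∈ zip (skewBoxes κ []) X → (d , b) ∈ zip (skewBoxes κ []) X → row c ≡ row d → col d ≡ suc (col c) → a ≤ b
    cols : ∀ {c d a b} → (c , a) ∈ zip (skewBoxes κ []) X → (d , b) ∈ zip (skewBoxes κ []) X → col c ≡ col d → row d ≡ suc (row c) → a < b

length-straight : ∀ κ → length (skewBoxes κ []) ≡ size κ
length-straight κ = trans (sym (ℕₚ.+-identityʳ _)) (length-skewBoxes {κ} {[]} ∅-⊆)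

opaque
  ssyt : ℕ → Partition → List (List ℕ)
  ssyt N κ = filterB (isSSYTB κ) (words N (size κ))

  schurMonomials-ssyt : ∀ N κ → schurMonomials N κ ≡ map (weight N) (ssyt N κ)
  schurMonomials-ssyt N κ = refl

  ssyt-unique : ∀ N κ → Unique (ssyt N κ)
  ssyt-unique N κ = AllPairs-filterB (isSSYTB κ) (words-unique N (size κ))

  ∈-ssyt⁻ : ∀ {N κ X} → X ∈ ssyt N κ → IsSSYT N κ X
  ∈-ssyt⁻ {N} {κ} {X} i = record { len = len ; bounds = proj₂ word ; rows = λ i j p q → proj₁ (conditions i j) p q ; cols = λ i j p q → proj₂ (conditions i j) p q }
    where
    bs : List Box
    bs = skewBoxes κ []
    both : X ∈ words N (size κ) × isSSYTB κ X ≡ true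
    both = ∈-filterB⁻ {p = isSSYTB κ} (words N (size κ)) i
    word : length X ≡ size κ × (∀ {x} → x ∈ X → 0 < x × x ≤ N)
    word = ∈-words⁻ N (size κ) (proj₁ both)
    len : length X ≡ length bs
    len = trans (proj₁ word) (sym (length-straight κ))
    conditions : ∀ {c d a b} → (c , a) ∈ zip bs X → (d , b) ∈ zip bs X → (row c ≡ row d → col d ≡ suc (col c) → a ≤ b) × (col c ≡ col d → row d ≡ suc (row c) → a < b)
    conditions i j with ∈-at (o , 0) i | ∈-at (o , 0) j
    ... | k , k⁺ , k≤ , refl | l , l⁺ , l≤ , refl rewrite at-zip o 0 bs X (sym len) k | at-zip o 0 bs X (sym len) l | length-zip bs X (sym len) | len
      with ∧-elim {((row (boxOf bs k) ≡ᵇ row (boxOf bs l)) ∧ (col (boxOf bs l) ≡ᵇ suc (col (boxOf bs k)))) ⇒B (at 0 X k ≤ᵇ at 0 X l)}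
             (allB-elim {xs = range1 (length bs)} (allB-elim {xs = range1 (length bs)} (proj₂ both) (∈-range1⁺ k⁺ k≤)) (∈-range1⁺ l⁺ l≤))
    ...   | p , q = (λ u v → ≤ᵇ-elim (⇒B-elim p (∧-intro (≡ᵇ-intro u) (≡ᵇ-intro v)))) , λ u v → <ᵇ-elim (⇒B-elim q (∧-intro (≡ᵇ-intro u) (≡ᵇ-intro v)))

  ∈-ssyt⁺ : ∀ {N κ X} → IsSSYT N κ X → X ∈ ssyt N κ
  ∈-ssyt⁺ {N} {κ} {X} S = ∈-filterB⁺ {p = isSSYTB κ} (subst (λ n → X ∈ words N n) (trans len (length-straight κ)) (∈-words⁺ N bounds))
    (allB-intro (range1 (length bs)) λ {k} i → allB-intro (range1 (length bs)) λ {l} j →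
      ∧-intro (⇒B-intro λ h → ≤ᵇ-intro (rows (member i) (member j) (≡ᵇ-elim (proj₁ (∧-elim {row (boxOf bs k) ≡ᵇ row (boxOf bs l)} h))) (≡ᵇ-elim (proj₂ (∧-elim {row (boxOf bs k) ≡ᵇ row (boxOf bs l)} h)))))
              (⇒B-intro λ h → <ᵇ-intro (cols (member i) (member j) (≡ᵇ-elim (proj₁ (∧-elim {col (boxOf bs k) ≡ᵇ col (boxOf bs l)} h))) (≡ᵇ-elim (proj₂ (∧-elim {col (boxOf bs k) ≡ᵇ col (boxOf bs l)} h))))))
    where
    open IsSSYT S
    bs : List Box
    bs = skewBoxes κ []
    member : ∀ {k} → k ∈ range1 (length bs) → (boxOf bs k , at 0 X k) ∈ zip bs X
    member {k} i = subst (_∈ zip bs X) (at-zip o 0 bs X (sym len) k)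
      (at-∈ (o , 0) (zip bs X) (proj₁ (∈-range1⁻ i)) (subst (k ≤_) (sym (trans (length-zip bs X (sym len)) len)) (proj₂ (∈-range1⁻ i))))

-- Vectors as shapes

part-zipWith : ∀ {N} (u v : Vec ℕ N) i → part (toList (Vec.zipWith _+_ u v)) i ≡ part (toList u) i + part (toList v) i
part-zipWith [] [] i = refl
part-zipWith (x ∷ u) (y ∷ v) zero = refl
part-zipWith (x ∷ u) (y ∷ v) (suc zero) = refl
part-zipWith (x ∷ u) (y ∷ v) (suc (suc i)) = part-zipWith u v (suc i)

part-tabulate : ∀ N (g : ℕ → ℕ) {i} → i < N → part (toList (tabulate {n = N} (g ∘ toℕ))) (suc i) ≡ g i
part-tabulate (suc N) g {zero} _ = refl
part-tabulate (suc N) g {suc i} (s≤s p) = part-tabulate N (g ∘ suc) p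

part-weight : ∀ N X {i} → 0 < i → i ≤ N → part (toList (weight N X)) i ≡ count i X
part-weight N X {suc i} _ p = part-tabulate N (λ j → count (suc j) X) p

partition-from-parts : ∀ xs → (∀ {i} → 0 < i → i ≤ length xs → 0 < part xs i) → (∀ {i} → 0 < i → part xs (suc i) ≤ part xs i) → IsPartition xs
partition-from-parts [] h d = [] , []
partition-from-parts (x ∷ []) h d = (h {1} (s≤s z≤n) (s≤s z≤n) ∷ []) , [-]
partition-from-parts (x ∷ y ∷ xs) h d with partition-from-parts (y ∷ xs) (λ { {suc i} _ q → h {suc (suc i)} (s≤s z≤n) (s≤s q) }) (λ { {suc i} _ → d {suc (suc i)} (s≤s z≤n) })
... | p , q = (h {1} (s≤s z≤n) (s≤s z≤n) ∷ p) , d {1} (s≤s z≤n) ∷ q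

count-↭ : ∀ i {xs ys} → xs ↭ ys → count i xs ≡ count i ys
count-↭ i ↭.refl = refl
count-↭ i (↭.prep x p) with x ≡ᵇ i
... | true = cong suc (count-↭ i p)
... | false = count-↭ i p
count-↭ i (↭.swap x y p) with x ≡ᵇ i | y ≡ᵇ i
... | true | true = cong (suc ∘ suc) (count-↭ i p)
... | true | false = cong suc (count-↭ i p)
... | false | true = cong suc (count-↭ i p)
... | false | false = count-↭ i p
count-↭ i (↭.trans p q) = trans (count-↭ i p) (count-↭ i q)

-- Entries with prescribed rows, appended to the rows of a shape one after the other.
place : (ℕ → ℕ) → (Box → ℕ) → List Box → List Entry
place ℓ g [] = []
place ℓ g (c ∷ cs) = (c , (g c , suc (ℓ (g c)))) ∷ place (bump ℓ (g c)) g cs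

place-cells : ∀ ℓ g cs → map cell (place ℓ g cs) ≡ cs
place-cells ℓ g [] = refl
place-cells ℓ g (c ∷ cs) = cong (c ∷_) (place-cells _ g cs)

place-row : ∀ {ℓ g} cs {c b} → (c , b) ∈ place ℓ g cs → row b ≡ g c
place-row (c ∷ cs) (here refl) = refl
place-row (c ∷ cs) (there i) = place-row cs i

place-cell : ∀ {ℓ g} cs {e} → e ∈ place ℓ g cs → cell e ∈ cs
place-cell {ℓ} {g} cs {e} i = subst (cell e ∈_) (place-cells ℓ g cs) (∈-map⁺ cell i)

place-lower : ∀ {ℓ g} cs {c b} → (c , b) ∈ place ℓ g cs → ℓ (row b) < col b
place-lower (c ∷ cs) (here refl) = ℕₚ.≤-refl
place-lower {ℓ} {g} (c ∷ cs) {b = b} (there i) = ℕₚ.≤-<-trans (bump-≥ ℓ (g c) (row b)) (place-lower cs i)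

place-upper : ∀ {ℓ g} cs {c b} → (c , b) ∈ place ℓ g cs → col b ≤ count (row b) (map g cs) + ℓ (row b)
place-upper {ℓ} {g} (c ∷ cs) (here refl) rewrite ≡ᵇ-intro {g c} refl = s≤s (ℕₚ.m≤n+m (ℓ (g c)) (count (g c) (map g cs)))
place-upper {ℓ} {g} (c ∷ cs) {b = b} (there i) = ℕₚ.≤-trans (place-upper cs i) (ℕₚ.≤-reflexive (sym (count-∷ ℓ (g c) (row b) (map g cs))))

place-complete : ∀ {ℓ g} cs {b} → ℓ (row b) < col b → col b ≤ count (row b) (map g cs) + ℓ (row b) → b ∈ boxes (place ℓ g cs)
place-complete [] p q = ⊥-elim (ℕₚ.<⇒≱ p q)
place-complete {ℓ} {g} (c ∷ cs) {i , j} p q with ℕₚ.≤-<-connex j (bump ℓ (g c) i)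
... | inj₂ h = there (place-complete cs h (ℕₚ.≤-trans q (ℕₚ.≤-reflexive (count-∷ ℓ (g c) i (map g cs)))))
... | inj₁ h with i ℕₚ.≟ g c
...   | yes refl = here (box-≡ refl (ℕₚ.≤-antisym h p))
...   | no _ = ⊥-elim (ℕₚ.<⇒≱ p h)

place-order : ∀ {ℓ g} cs → AllPairs (λ e f → row (box e) ≡ row (box f) → col (box e) < col (box f)) (place ℓ g cs)
place-order [] = []
place-order {ℓ} {g} (c ∷ cs) = All.tabulate (λ {f} i q → subst (_< col (box f)) (trans (cong (bump ℓ (g c)) (sym q)) (bump-here ℓ (g c))) (place-lower cs i)) ∷ place-order cs

Σℤ-filterB : {A : Set} (p : A → Bool) (xs : List A) {f : A → ℤ} → (∀ {x} → x ∈ xs → p x ≡ false → f x ≡ ℤ.+ 0) → Σℤ xs f ≡ Σℤ (filterB p xs) f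
Σℤ-filterB p [] h = refl
Σℤ-filterB p (x ∷ xs) {f} h with p x in e
... | true = cong (λ z → f x ℤ.+ z) (Σℤ-filterB p xs (h ∘ there))
... | false = trans (cong₂ ℤ._+_ (h (here refl) e) (Σℤ-filterB p xs (h ∘ there))) (ℤₚ.+-identityˡ _)

-- Tableaux in products D κ whose outer shape is a union of pairwise disconnected rows over D
-- correspond to semistandard tableaux of shape κ: replace every entry by its row.
module Spread {N : ℕ} (Dv : Vec ℕ N) {bound κ : Partition} (PD : IsPartition (toList Dv)) (PW : IsPartition bound) (len≤ : length bound ≤ N)
  (gap : ∀ {i} → 0 < i → part bound (suc i) ≤ part (toList Dv) i) (K : IsPartition κ) where

  private
    D : Partition
    D = toList Dv
    bs : List Box
    bs = skewBoxes κ []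

  shape : List ℕ → Partition
  shape X = toList (Vec.zipWith _+_ Dv (weight N X))

  private
    lenD : length D ≡ N
    lenD = Vecₚ.length-toList Dv

    part-shape : ∀ X {i} → 0 < i → i ≤ N → part (shape X) i ≡ part D i + count i X
    part-shape X {i} p q = trans (part-zipWith Dv (weight N X) i) (cong (part D i +_) (part-weight N X p q))

    part-shape-beyond : ∀ X {i} → N < i → part (shape X) i ≡ 0
    part-shape-beyond X {i} p = part-beyond (shape X) (subst (_< i) (sym (Vecₚ.length-toList (Vec.zipWith _+_ Dv (weight N X)))) p)

    bound-beyond : ∀ {i} → N < i → part bound i ≡ 0
    bound-beyond p = part-beyond bound (ℕₚ.≤-<-trans len≤ p)

    D⊆shape : ∀ X → D ⊆ₚ shape X
    D⊆shape X = part-⊆ₚ {D} {shape X} λ {i} _ → ℕₚ.≤-trans (ℕₚ.m≤m+n _ _) (ℕₚ.≤-reflexive (sym (part-zipWith Dv (weight N X) i)))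

    shape-partition : ∀ X → (∀ {i} → 0 < i → part (shape X) (suc i) ≤ part (shape X) i) → IsPartition (shape X)
    shape-partition X = partition-from-parts (shape X) λ {i} p q → ℕₚ.<-≤-trans (part-pos {D} PD p (ℕₚ.≤-trans q (ℕₚ.≤-reflexive lens))) (⊆ₚ-part {D} {shape X} (D⊆shape X) p)
      where
      lens : length (shape X) ≡ length D
      lens = trans (Vecₚ.length-toList (Vec.zipWith _+_ Dv (weight N X))) (sym lenD)

  bounded-partition : ∀ X → shape X ⊆ₚ bound → IsPartition (shape X)
  bounded-partition X s = shape-partition X λ p → ℕₚ.≤-trans (⊆ₚ-part {shape X} {bound} s (s≤s z≤n)) (ℕₚ.≤-trans (gap p) (⊆ₚ-part {D} {shape X} (D⊆shape X) p))

  record Match (p : Partition × Tableau) (X : List ℕ) : Set where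
    constructor match
    field
      same-shape : proj₁ p ≡ shape X
      same-rows : ∀ {c b e} → (c , b) ∈ annotate κ [] (proj₂ p) → (c , e) ∈ zip bs X → row b ≡ e

  private
    bs-unique : Unique bs
    bs-unique = skewBoxes-unique κ []

    inside : ∀ {c} → c ∈ₚ κ → InSkew κ [] c
    inside p = p , λ q → ℕₚ.<⇒≱ (proj₂ (positive q)) (fits q)

  module FromTableau {μ T} (p : IsRW μ D κ [] T) (μ⊆ : μ ⊆ₚ bound) where
    open IsRW p
    private
      P : List Entry
      P = annotate κ [] T
      open Picture K ∅-partition (Tab.cells tab) (Tab.pic tab) using (entry; asc; same-cell; skew)

      g : Box → ℕ
      g c = row (look o P c)

    word : List ℕ
    word = map g bs

    private
      value : ∀ {c e} → (c , e) ∈ zip bs word → ∃[ b ] ((c , b) ∈ P × e ≡ row b)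
      value {c} i = look o P c , look-∈ (proj₂ (entry (∈-skewBoxes⁻ {κ} {[]} (zip-key i)))) , zip-map⁻ bs i

      in-μ : ∀ {c b} → (c , b) ∈ P → b ∈ₚ μ
      in-μ i = proj₁ (Std.sound (Tab.std tab) (∈-map⁺ box i))

      g-row : ∀ {c b} → (c , b) ∈ P → g c ≡ row b
      g-row i = cong row (same-cell (look-∈ i) i)

    -- `rl` reads a row from the right, and along it (i) moves boxes weakly up: from left to right
    -- the rows of the boxes weakly increase. Down a column (ii) makes them strictly increase.
    word-ssyt : IsSSYT N κ word
    word-ssyt = record
      { len = Listₚ.length-map g bs
      ; bounds = bounds
      ; rows = λ i j p q → row-step (value i) (value j) p q
      ; cols = λ i j p q → col-step (value i) (value j) p q }
      where
      bounds : ∀ {x} → x ∈ word → 0 < x × x ≤ N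
      bounds i with ∈-map⁻ g i
      ... | c , j , refl with in-μ (look-∈ {a = o} (proj₂ (entry (∈-skewBoxes⁻ {κ} {[]} j))))
      ...   | h = proj₁ (positive h) , ℕₚ.≤-trans (row≤length (μ⊆ h)) len≤
      row-step : ∀ {c d a b} → ∃[ x ] ((c , x) ∈ P × a ≡ row x) → ∃[ y ] ((d , y) ∈ P × b ≡ row y) → row c ≡ row d → col d ≡ suc (col c) → a ≤ b
      row-step (x , i , refl) (y , j , refl) p q = proj₂ (asc j i (sym p) (ℕₚ.≤-reflexive (sym q)))
      col-step : ∀ {c d a b} → ∃[ x ] ((c , x) ∈ P × a ≡ row x) → ∃[ y ] ((d , y) ∈ P × b ≡ row y) → col c ≡ col d → row d ≡ suc (row c) → a < b
      col-step (x , i , refl) (y , j , refl) p q = proj₁ (Pic.desc (Tab.pic tab) i j (p , q))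

    word-count : ∀ i → count i word ≡ count i (map row (boxes P))
    word-count i = trans (count-↭ i (↭ₚ.map⁺ g (↭-sym (rl-↭ κ [])))) (cong (count i) (trans (cong (map g) (sym (Tab.cells tab))) (go P λ j → g-row j)))
      where
      go : ∀ Q → (∀ {e} → e ∈ Q → g (cell e) ≡ row (box e)) → map g (map cell Q) ≡ map row (boxes Q)
      go [] h = refl
      go (e ∷ Q) h = cong₂ _∷_ (h (here refl)) (go Q (h ∘ there))

    parts : ∀ {i} → 0 < i → part μ i ≡ part (shape word) i
    parts {i} p with i ℕₚ.≤? N
    ... | yes q = sym (trans (part-shape word p q) (trans (cong (part D i +_) (word-count i)) (trans (ℕₚ.+-comm (part D i) _) (Fills-count (Std⇒Fills {μ} {D} (Tab.std tab)) (⊆ₚ-part {D} {μ} inner) p))))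
    ... | no q = trans (ℕₚ.n≤0⇒n≡0 (ℕₚ.≤-trans (⊆ₚ-part {μ} {bound} μ⊆ p) (ℕₚ.≤-reflexive (bound-beyond (ℕₚ.≰⇒> q))))) (sym (part-shape-beyond word (ℕₚ.≰⇒> q)))

    word-shape : μ ≡ shape word
    word-shape = part-ext outer (shape-partition word λ p → subst₂ _≤_ (parts (s≤s z≤n)) (parts p) (part-suc {μ} outer p)) parts

    word-match : Match (μ , T) word
    word-match = match word-shape λ i j → trans (sym (g-row i)) (sym (zip-map⁻ bs j))

  module FromWord {X} (S : IsSSYT N κ X) (⊆bound : shape X ⊆ₚ bound) where
    open IsSSYT S
    private
      g : Box → ℕ
      g = look 0 (zip bs X)

      g-value : ∀ {c} → c ∈ₚ κ → (c , g c) ∈ zip bs X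
      g-value p = look-∈ (proj₂ (zip-total len (∈-skewBoxes⁺ {κ} {[]} (inside p))))

      value∈ : ∀ {c a} → (c , a) ∈ zip bs X → a ∈ X
      value∈ {a = a} i = subst (a ∈_) (map₂-zip bs X (sym len)) (∈-map⁺ proj₂ i)

      step-row : ∀ n {x y} → (x , y) ∈ₚ κ → (x , y + n) ∈ₚ κ → g (x , y) ≤ g (x , y + n)
      step-row zero {x} {y} p q = ℕₚ.≤-reflexive (cong (λ z → g (x , z)) (sym (ℕₚ.+-identityʳ y)))
      step-row (suc n) {x} {y} p q = ℕₚ.≤-trans (step-row n p mid) (rows (g-value mid) (g-value q) refl (ℕₚ.+-suc y n))
        where
        mid : (x , y + n) ∈ₚ κ
        mid = ∈ₚ-≼ K q (ℕₚ.≤-refl , ℕₚ.+-monoʳ-≤ y (ℕₚ.n≤1+n n)) (proj₁ (positive p) , ℕₚ.≤-trans (proj₂ (positive p)) (ℕₚ.m≤m+n y n))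

      weakly : ∀ {x y y'} → (x , y) ∈ₚ κ → (x , y') ∈ₚ κ → y ≤ y' → g (x , y) ≤ g (x , y')
      weakly {x} {y} p q l with ℕₚ.m≤n⇒∃[o]m+o≡n l
      ... | n , refl = step-row n p q

      Γ : Partition
      Γ = shape X
      Γ-partition : IsPartition Γ
      Γ-partition = bounded-partition X ⊆bound

      P : List Entry
      P = place (part D) g (rl κ [])

      cells : map cell P ≡ rl κ []
      cells = place-cells (part D) g (rl κ [])

      cell∈ : ∀ {e} → e ∈ P → cell e ∈ₚ κ
      cell∈ i = proj₁ (∈-rl⁻ {κ} {[]} (place-cell (rl κ []) i))

      row-g : ∀ {c b} → (c , b) ∈ P → row b ≡ g c
      row-g = place-row (rl κ [])

      counts : ∀ i → count i (map g (rl κ [])) ≡ count i X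
      counts i = trans (count-↭ i (↭ₚ.map⁺ g (rl-↭ κ []))) (cong (count i) (map-look 0 bs-unique len))

      rows-bounded : ∀ {e} → e ∈ P → 0 < row (box e) × row (box e) ≤ N
      rows-bounded i with bounds (value∈ (g-value (cell∈ i)))
      ... | p , q = subst (0 <_) (sym (row-g i)) p , subst (_≤ N) (sym (row-g i)) q

      upper : ∀ {e} → e ∈ P → col (box e) ≤ part Γ (row (box e))
      upper {e} i = ℕₚ.≤-trans (place-upper (rl κ []) i) (ℕₚ.≤-reflexive (trans (cong (_+ part D (row (box e))) (counts (row (box e))))
        (trans (ℕₚ.+-comm _ (part D (row (box e)))) (sym (part-shape X (proj₁ (rows-bounded i)) (proj₂ (rows-bounded i)))))))

      -- By `gap`, a row of `bound` ends no later than the row of `D` above it, so boxes added in a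
      -- lower row lie to the left of those added in a higher row. Boxes of different rows are thus
      -- incomparable, and the filling is standard as soon as each row is.
      far : ∀ {e f} → e ∈ P → f ∈ P → row (box e) < row (box f) → col (box f) < col (box e)
      far {e} {f} i j l = ℕₚ.≤-<-trans (upper j) (ℕₚ.≤-<-trans (⊆ₚ-part {Γ} {bound} ⊆bound (proj₁ (rows-bounded j)))
        (ℕₚ.≤-<-trans (part-anti {bound} PW (s≤s z≤n) l) (ℕₚ.≤-<-trans (gap (proj₁ (rows-bounded i))) (place-lower (rl κ []) i))))

      ordered-entries : AllPairs (λ e f → (e ∈ P × f ∈ P) × (row (box e) ≡ row (box f) → col (box e) < col (box f)) × RL (cell e) (cell f)) P
      ordered-entries = AllPairs-∈ (λ i j p → (i , j) , p) (AllPairs.zip (place-order (rl κ []) , AllPairsₚ.map⁻ (subst (AllPairs RL) (sym cells) (rl-sorted κ []))))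

      fills : Fills (part D) (part Γ) (boxes P)
      fills = record
        { order = AllPairs-map (AllPairs.map (λ { {e} {f} ((i , j) , h , _) (p , q) → order i j h p q }) ordered-entries)
        ; sound = λ k → let (e , i , q) = ∈-map⁻ box k in subst (λ b → 0 < row b × part D (row b) < col b × col b ≤ part Γ (row b)) (sym q)
            (proj₁ (rows-bounded i) , place-lower (rl κ []) i , upper i)
        ; complete = λ {b} p q h → place-complete (rl κ []) q (complete b p q h) }
        where
        order : ∀ {e f} → e ∈ P → f ∈ P → (row (box e) ≡ row (box f) → col (box e) < col (box f)) → row (box f) ≤ row (box e) → ¬ col (box f) ≤ col (box e)
        order i j h p q with ℕₚ.m≤n⇒m<n∨m≡n p
        ... | inj₁ l = ℕₚ.<⇒≱ (far j i l) q
        ... | inj₂ e = ℕₚ.<⇒≱ (h (sym e)) q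
        complete : ∀ b → 0 < row b → part D (row b) < col b → col b ≤ part Γ (row b) → col b ≤ count (row b) (map g (rl κ [])) + part D (row b)
        complete b p q h with row b ℕₚ.≤? N
        ... | yes l = ℕₚ.≤-trans h (ℕₚ.≤-reflexive (trans (part-shape X p l) (trans (ℕₚ.+-comm (part D (row b)) _) (cong (_+ part D (row b)) (sym (counts (row b)))))))
        ... | no l = ⊥-elim (ℕₚ.<⇒≱ (ℕₚ.≤-<-trans z≤n q) (ℕₚ.≤-trans h (ℕₚ.≤-reflexive (part-shape-beyond X (ℕₚ.≰⇒> l)))))

      pic : Pic P
      pic = record
        { ordered = AllPairs.map (λ { {e} {f} ((i , j) , h , p) → p , ascending i j h p }) ordered-entries
        ; convex = λ i j p q → subst (_ ∈_) (sym cells) (∈-rl⁺ {κ} {[]} (InSkew-convex K ∅-partition (∈-rl⁻ (subst (_ ∈_) cells i)) (∈-rl⁻ (subst (_ ∈_) cells j)) p q))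
        ; desc = descending }
        where
        ascending : ∀ {e f} → e ∈ P → f ∈ P → (row (box e) ≡ row (box f) → col (box e) < col (box f)) → RL (cell e) (cell f) → row (cell e) ≡ row (cell f) → Asc (box e) (box f)
        ascending i j h (inj₁ l) q = ⊥-elim (ℕₚ.<⇒≢ l q)
        ascending {(x , y) , b} {(_ , y') , b'} i j h (inj₂ (_ , l)) refl with ℕₚ.m≤n⇒m<n∨m≡n weak
          where
          weak : row b' ≤ row b
          weak = subst₂ _≤_ (sym (row-g j)) (sym (row-g i)) (weakly (cell∈ j) (cell∈ i) (ℕₚ.<⇒≤ l))
        ... | inj₁ k = far j i k , ℕₚ.<⇒≤ k
        ... | inj₂ k = h (sym k) , ℕₚ.≤-reflexive k
        descending : ∀ {e f} → e ∈ P → f ∈ P → Below (cell e) (cell f) → Desc (box e) (box f)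
        descending {e} {f} i j (p , q) = lower , ℕₚ.<⇒≤ (far i j lower)
          where
          lower : row (box e) < row (box f)
          lower = subst₂ _<_ (sym (row-g i)) (sym (row-g j)) (cols (g-value (cell∈ i)) (g-value (cell∈ j)) p q)

      tableau : Tab Γ D κ [] P
      tableau = record { cells = cells ; pic = pic ; std = Fills⇒Std {Γ} {D} fills }

    filling : Tableau
    filling = boxes P

    filling-RW : IsRW Γ D κ [] filling
    filling-RW = IsRW⁺ Γ-partition (D⊆shape X) tableau

    filling-match : Match (Γ , filling) X
    filling-match = match refl λ {c} {b} i j → trans (row-g (subst ((c , b) ∈_) (annotate-boxes tableau) i)) (zip-functional bs-unique (g-value (cell∈ (subst ((c , b) ∈_) (annotate-boxes tableau) i))) j)

  private
    tableaux : List (Partition × Tableau)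
    tableaux = filterB (λ p → containedB (proj₁ p) bound) (products D κ)

    fillings : List (List ℕ)
    fillings = filterB (λ X → containedB (shape X) bound) (ssyt N κ)

    ∈-tableaux : ∀ {μ T} → (μ , T) ∈ tableaux → IsRW μ D κ [] T × μ ⊆ₚ bound
    ∈-tableaux {μ} {T} i = ∈-products⁻ PD K (proj₁ h) , containedB⁻ {μ} {bound} (proj₂ h)
      where
      h : (μ , T) ∈ products D κ × containedB μ bound ≡ true
      h = ∈-filterB⁻ {p = λ p → containedB (proj₁ p) bound} (products D κ) i

    ∈-fillings : ∀ {X} → X ∈ fillings → IsSSYT N κ X × shape X ⊆ₚ bound
    ∈-fillings {X} i = ∈-ssyt⁻ (proj₁ h) , containedB⁻ {shape X} {bound} (proj₂ h)
      where
      h : X ∈ ssyt N κ × containedB (shape X) bound ≡ true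
      h = ∈-filterB⁻ {p = λ X → containedB (shape X) bound} (ssyt N κ) i

    functional : ∀ {μ T X X'} → IsRW μ D κ [] T → IsSSYT N κ X → IsSSYT N κ X' → Match (μ , T) X → Match (μ , T) X' → X ≡ X'
    functional p S S' m m' = zip-ext bs (IsSSYT.len S) (IsSSYT.len S') λ i j →
      let (b , k) = Picture.entry K ∅-partition (Tab.cells (IsRW.tab p)) (Tab.pic (IsRW.tab p)) (∈-skewBoxes⁻ {κ} {[]} (zip-key i)) in
      trans (sym (Match.same-rows m k i)) (Match.same-rows m' k j)

    injective : ∀ {μ T μ' T' X} → IsRW μ D κ [] T → IsRW μ' D κ [] T' → IsSSYT N κ X → Match (μ , T) X → Match (μ' , T') X → _≡_ {A = Partition × Tableau} (μ , T) (μ' , T')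
    injective {μ} {T} {μ'} {T'} p p' S m m' = cong₂ _,_ (trans (Match.same-shape m) (sym (Match.same-shape m')))
      (Fills-determined (fill p) (fill p') (zip-ext (rl κ []) (lens p) (lens p') agree))
      where
      fill : ∀ {μ T} → IsRW μ D κ [] T → Fills (part D) (part μ) T
      fill {μ} p = subst (Fills (part D) (part μ)) (IsRW.plain p) (Std⇒Fills {μ} {D} (Tab.std (IsRW.tab p)))
      lens : ∀ {μ T} → IsRW μ D κ [] T → length (map row T) ≡ length (rl κ [])
      lens {T = T} p = trans (Listₚ.length-map row T) (annotated-length p)
      strip : ∀ {T c a} → (c , a) ∈ zip (rl κ []) (map row T) → ∃[ b ] ((c , b) ∈ annotate κ [] T × a ≡ row b)
      strip {T} {c} i with go (rl κ []) T i
        where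
        go : ∀ ks T {c a} → (c , a) ∈ zip ks (map row T) → ∃[ b ] ((c , b) ∈ zip ks T × a ≡ row b)
        go (k ∷ ks) (b ∷ T) (here refl) = b , here refl , refl
        go (k ∷ ks) (b ∷ T) (there i) with go ks T i
        ... | b' , j , e = b' , there j , e
      ... | b , j , e = b , subst ((c , b) ∈_) (sym annotate-zip) j , e
      agree : ∀ {c a b} → (c , a) ∈ zip (rl κ []) (map row T) → (c , b) ∈ zip (rl κ []) (map row T') → a ≡ b
      agree {c} i j with strip {T} i | strip {T'} j | zip-total {vs = _} (IsSSYT.len S) (∈-skewBoxes⁺ {κ} {[]} (∈-rl⁻ (zip-key i)))
      ... | b , k , refl | b' , k' , refl | e , l = trans (Match.same-rows m k l) (sym (Match.same-rows m' k' l))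

  -- Only inside `bound` are the added rows known to be disconnected; `φ` has to vanish elsewhere
  -- for the correspondence to account for both sums.
  Σℤ-spread : (φ : Partition → ℤ) → (∀ μ → containedB μ bound ≡ false → φ μ ≡ ℤ.+ 0) → Σℤ (products D κ) (φ ∘ proj₁) ≡ Σℤ (ssyt N κ) (φ ∘ shape)
  Σℤ-spread φ zero-outside = trans (Σℤ-filterB (λ p → containedB (proj₁ p) bound) (products D κ) (λ {p} _ → zero-outside (proj₁ p)))
    (trans (Σℤ-relation Match tableaux
        (AllPairs-filterB (λ p → containedB (proj₁ p) bound) (products-unique D κ)) (AllPairs-filterB (λ X → containedB (shape X) bound) (ssyt-unique N κ))
        to from
        (λ i j j' → functional (proj₁ (∈-tableaux i)) (proj₁ (∈-fillings j)) (proj₁ (∈-fillings j')))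
        (λ i i' j → injective (proj₁ (∈-tableaux i)) (proj₁ (∈-tableaux i')) (proj₁ (∈-fillings j)))
        (λ m → cong φ (Match.same-shape m)))
      (sym (Σℤ-filterB (λ X → containedB (shape X) bound) (ssyt N κ) (λ {X} _ → zero-outside (shape X)))))
    where
    to : ∀ {p} → p ∈ tableaux → ∃[ X ] (X ∈ fillings × Match p X)
    to {μ , T} i = F.word , ∈-filterB⁺ {p = λ X → containedB (shape X) bound} (∈-ssyt⁺ F.word-ssyt)
        (containedB⁺ {shape F.word} {bound} (subst (_⊆ₚ bound) F.word-shape (proj₂ (∈-tableaux i)))) , F.word-match
      where module F = FromTableau (proj₁ (∈-tableaux i)) (proj₂ (∈-tableaux i))
    from : ∀ {X} → X ∈ fillings → ∃[ p ] (p ∈ tableaux × Match p X)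
    from {X} i = (shape X , F.filling) , ∈-filterB⁺ {p = λ p → containedB (proj₁ p) bound} (∈-products⁺ F.filling-RW) (containedB⁺ {shape X} {bound} (proj₂ (∈-fillings i))) , F.filling-match
      where module F = FromWord (proj₁ (∈-fillings i)) (proj₂ (∈-fillings i))

Σℤ-0 : {A : Set} (xs : List A) → Σℤ xs (λ _ → ℤ.+ 0) ≡ ℤ.+ 0
Σℤ-0 [] = refl
Σℤ-0 (x ∷ xs) = trans (ℤₚ.+-identityˡ _) (Σℤ-0 xs)

Σℤ-*ʳ : {A : Set} (xs : List A) {f : A → ℤ} (c : ℤ) → Σℤ xs (λ x → f x ℤ.* c) ≡ Σℤ xs f ℤ.* c
Σℤ-*ʳ [] c = sym (ℤₚ.*-zeroˡ c)
Σℤ-*ʳ (x ∷ xs) {f} c = trans (cong (λ z → f x ℤ.* c ℤ.+ z) (Σℤ-*ʳ xs c)) (sym (ℤₚ.*-distribʳ-+ c (f x) (Σℤ xs f)))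

Σℤ-*ˡ : {A : Set} (xs : List A) {f : A → ℤ} (c : ℤ) → Σℤ xs (λ x → c ℤ.* f x) ≡ c ℤ.* Σℤ xs f
Σℤ-*ˡ [] c = sym (ℤₚ.*-zeroʳ c)
Σℤ-*ˡ (x ∷ xs) {f} c = trans (cong (λ z → c ℤ.* f x ℤ.+ z) (Σℤ-*ˡ xs c)) (sym (ℤₚ.*-distribˡ-+ c (f x) (Σℤ xs f)))

Σℤ-neg : {A : Set} (xs : List A) {f : A → ℤ} → Σℤ xs (λ x → ℤ.- f x) ≡ ℤ.- Σℤ xs f
Σℤ-neg [] = refl
Σℤ-neg (x ∷ xs) {f} = trans (cong (λ z → ℤ.- f x ℤ.+ z) (Σℤ-neg xs)) (sym (ℤₚ.neg-distrib-+ (f x) (Σℤ xs f)))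

Σℤ-swap : {A B : Set} (xs : List A) (ys : List B) {f : A → B → ℤ} → Σℤ xs (λ x → Σℤ ys (f x)) ≡ Σℤ ys (λ y → Σℤ xs (λ x → f x y))
Σℤ-swap [] ys = sym (Σℤ-0 ys)
Σℤ-swap (x ∷ xs) ys {f} = trans (cong (λ z → Σℤ ys (f x) ℤ.+ z) (Σℤ-swap xs ys)) (sym (Σℤ-+ ys))

-- The Littlewood-Richardson rule

products-swap : ∀ {κ λ'} → IsPartition κ → IsPartition λ' → (φ : Partition → ℤ) → Σℤ (products κ λ') (φ ∘ proj₁) ≡ Σℤ (products λ' κ) (φ ∘ proj₁)
products-swap {κ} {λ'} K L φ = trans (sym (Straight.Σℤ-straight K (λ μ → Σℤ (products μ λ') (φ ∘ proj₁))))
  (trans (products-commute ∅-partition K L φ) (Straight.Σℤ-straight L (λ μ → Σℤ (products μ κ) (φ ∘ proj₁))))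

-- Associativity out of commutativity: the product with `ω` on the left is turned into one with `ω`
-- on the right, the factors `α` and `ω` acting on `β` are exchanged, and `β` and `ω` are switched
-- back.
products-associate : ∀ {ω α β} → IsPartition ω → IsPartition α → IsPartition β → (φ : Partition → ℤ) →
  Σℤ (products β α) (λ p → Σℤ (products ω (proj₁ p)) (φ ∘ proj₁)) ≡ Σℤ (products ω β) (λ p → Σℤ (products (proj₁ p) α) (φ ∘ proj₁))
products-associate {ω} {α} {β} O A B φ = trans (Σℤ-cong (products β α) λ {p} i → products-swap O (IsRW.outer (∈-products⁻ B A i)) φ)
  (trans (products-commute B A O φ) (products-swap B O (λ μ → Σℤ (products μ α) (φ ∘ proj₁))))

ind : Bool → ℤ
ind b = if b then ℤ.+ 1 else ℤ.+ 0

module _ {N : ℕ} where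

  _⊞_ : Vec ℕ N → Vec ℕ N → Vec ℕ N
  _⊞_ = Vec.zipWith _+_

  [_≟_] : Vec ℕ N → Vec ℕ N → Bool
  [ u ≟ v ] = does (Vecₚ.≡-dec ℕₚ._≟_ u v)

  -- The coefficient of x^w in the Schur polynomial of κ.
  kostka : Vec ℕ N → Partition → ℤ
  kostka w κ = Σℤ (ssyt N κ) (λ X → ind [ weight N X ≟ w ])

-- The shapes spread w and spread w ⊞ w differ by pairwise disconnected rows of lengths w.
spread : ∀ {n} → Vec ℕ n → Vec ℕ n
spread [] = []
spread (x ∷ w) = suc (Vec.sum w) ∷ spread w

module _ where
  private
    top : ∀ {n} (w : Vec ℕ n) → part (toList (Vec.zipWith _+_ (spread w) w)) 1 ≤ suc (Vec.sum w)
    top [] = z≤n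
    top (x ∷ w) = s≤s (ℕₚ.≤-reflexive (ℕₚ.+-comm (Vec.sum w) x))

  -- Equality except after the last row: `spread` gives each inner row the sum of the later lengths,
  -- so each outer row ends exactly below the end of the inner row above it. The extra `suc` keeps
  -- all parts positive.
  spread-gap : ∀ {n} (w : Vec ℕ n) {i} → 0 < i → part (toList (Vec.zipWith _+_ (spread w) w)) (suc i) ≤ part (toList (spread w)) i
  spread-gap [] _ = z≤n
  spread-gap (x ∷ w) {suc zero} _ = top w
  spread-gap (x ∷ w) {suc (suc i)} _ = spread-gap w {suc i} (s≤s z≤n)

  spread-pos : ∀ {n} (w : Vec ℕ n) {i} → 0 < i → i ≤ length (toList (spread w)) → 0 < part (toList (spread w)) i
  spread-pos (x ∷ w) {suc zero} _ _ = s≤s z≤n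
  spread-pos (x ∷ w) {suc (suc i)} _ (s≤s p) = spread-pos w (s≤s z≤n) p
  spread-pos [] {suc i} _ ()

part-⊞-≤ : ∀ {n} (u v : Vec ℕ n) i → part (toList u) i ≤ part (toList (Vec.zipWith _+_ u v)) i
part-⊞-≤ u v i = ℕₚ.≤-trans (ℕₚ.m≤m+n _ _) (ℕₚ.≤-reflexive (sym (part-zipWith u v i)))

spread-partition : ∀ {n} (w : Vec ℕ n) → IsPartition (toList (spread w))
spread-partition w = partition-from-parts (toList (spread w)) (spread-pos w) λ {i} p → ℕₚ.≤-trans (part-⊞-≤ (spread w) w (suc i)) (spread-gap w p)

does-≡ : {A B : Set} (p : Dec A) (q : Dec B) → (A → B) → (B → A) → does p ≡ does q
does-≡ (yes _) (yes _) f g = refl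
does-≡ (no _) (no _) f g = refl
does-≡ (yes a) (no n) f g = ⊥-elim (n (f a))
does-≡ (no n) (yes b) f g = ⊥-elim (n (g b))

toList-injective : ∀ {n} (u v : Vec ℕ n) → toList u ≡ toList v → u ≡ v
toList-injective [] [] e = refl
toList-injective (x ∷ u) (y ∷ v) e = cong₂ _∷_ (proj₁ (Listₚ.∷-injective e)) (toList-injective u v (proj₂ (Listₚ.∷-injective e)))

⊞-cancel : ∀ {n} (u v w : Vec ℕ n) → Vec.zipWith _+_ u v ≡ Vec.zipWith _+_ u w → v ≡ w
⊞-cancel [] [] [] e = refl
⊞-cancel (x ∷ u) (y ∷ v) (z ∷ w) e = cong₂ _∷_ (ℕₚ.+-cancelˡ-≡ x y z (cong Vec.head e)) (⊞-cancel u v w (cong Vec.tail e))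

⊞-assoc-comm : ∀ {n} (u v w : Vec ℕ n) → Vec.zipWith _+_ (Vec.zipWith _+_ u v) w ≡ Vec.zipWith _+_ u (Vec.zipWith _+_ w v)
⊞-assoc-comm [] [] [] = refl
⊞-assoc-comm (x ∷ u) (y ∷ v) (z ∷ w) = cong₂ _∷_ (trans (ℕₚ.+-assoc x y z) (cong (x +_) (ℕₚ.+-comm y z))) (⊞-assoc-comm u v w)

module LittlewoodRichardson {N : ℕ} (w : Vec ℕ N) where

  private
    W₀ : Vec ℕ N
    W₀ = spread w

    ω target' : Partition
    ω = toList W₀
    target' = toList (W₀ ⊞ w)

    Ω : IsPartition ω
    Ω = spread-partition w

    T' : IsPartition target'
    T' = partition-from-parts target'
      (λ {i} p q → ℕₚ.<-≤-trans (spread-pos w p (ℕₚ.≤-trans q (ℕₚ.≤-reflexive (trans (Vecₚ.length-toList (W₀ ⊞ w)) (sym (Vecₚ.length-toList W₀)))))) (part-⊞-≤ W₀ w i))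
      λ {i} p → ℕₚ.≤-trans (spread-gap w p) (part-⊞-≤ W₀ w i)

    len : length target' ≤ N
    len = ℕₚ.≤-reflexive (Vecₚ.length-toList (W₀ ⊞ w))

    φ : Partition → ℤ
    φ μ = ind (eqListℕ μ target')

    φ-outside : ∀ μ → containedB μ target' ≡ false → φ μ ≡ ℤ.+ 0
    φ-outside μ e with Listₚ.≡-dec ℕₚ._≟_ μ target'
    ... | no _ = refl
    ... | yes refl with trans (sym e) (containedB⁺ {target'} {target'} ⊆ₚ-refl)
    ...   | ()

    φ-value : ∀ u → φ (toList (W₀ ⊞ u)) ≡ ind [ u ≟ w ]
    φ-value u = cong ind (does-≡ (Listₚ.≡-dec ℕₚ._≟_ (toList (W₀ ⊞ u)) target') (Vecₚ.≡-dec ℕₚ._≟_ u w)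
      (λ e → ⊞-cancel W₀ u w (toList-injective (W₀ ⊞ u) (W₀ ⊞ w) e)) (λ { refl → refl }))

  kostka-products : ∀ {κ} → IsPartition κ → Σℤ (products ω κ) (φ ∘ proj₁) ≡ kostka w κ
  kostka-products {κ} K = trans (Spread.Σℤ-spread W₀ Ω T' len (spread-gap w) K φ φ-outside) (Σℤ-cong (ssyt N κ) λ {X} _ → φ-value (weight N X))

  -- The target shape is reached from `ω` in two stages, by `β` and then by `α`, and each stage is a
  -- semistandard filling by `Spread`. If the first stage already leaves the target, both sides
  -- vanish, since every later shape contains the one before it.
  littlewood-richardson : ∀ {α β} → IsPartition α → IsPartition β →
    Σℤ (products β α) (kostka w ∘ proj₁) ≡ Σℤ (ssyt N β) (λ Y → Σℤ (ssyt N α) (λ X → ind [ weight N X ⊞ weight N Y ≟ w ]))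
  littlewood-richardson {α} {β} A B = trans (Σℤ-cong (products β α) λ i → sym (kostka-products (IsRW.outer (∈-products⁻ B A i))))
    (trans (products-associate Ω A B φ) (trans (SpreadB.Σℤ-spread θ θ-outside) (Σℤ-cong (ssyt N β) λ {Y} _ → inner Y)))
    where
    module SpreadB = Spread W₀ Ω T' len (spread-gap w) B
    θ : Partition → ℤ
    θ μ = Σℤ (products μ α) (φ ∘ proj₁)
    θ-outside : ∀ μ → containedB μ target' ≡ false → θ μ ≡ ℤ.+ 0
    θ-outside μ e = trans (Σℤ-cong (products μ α) λ {p} i → φ-outside (proj₁ p) (outside i)) (Σℤ-0 (products μ α))
      where
      outside : ∀ {p} → p ∈ products μ α → containedB (proj₁ p) target' ≡ false
      outside {l , t} i with containedB l target' in q
      ... | false = refl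
      ... | true with trans (sym e) (containedB⁺ {μ} {target'} (containedB⁻ {l} {target'} q ∘ products-⊇ i))
      ...   | ()
    φ-outer : ∀ X Y → φ (toList ((W₀ ⊞ weight N Y) ⊞ weight N X)) ≡ ind [ weight N X ⊞ weight N Y ≟ w ]
    φ-outer X Y = trans (cong (φ ∘ toList) (⊞-assoc-comm W₀ (weight N Y) (weight N X))) (φ-value (weight N X ⊞ weight N Y))
    inner : ∀ Y → θ (SpreadB.shape Y) ≡ Σℤ (ssyt N α) (λ X → ind [ weight N X ⊞ weight N Y ≟ w ])
    inner Y with containedB (SpreadB.shape Y) target' in q
    ... | true = trans (Spread.Σℤ-spread (W₀ ⊞ weight N Y) (SpreadB.bounded-partition Y (containedB⁻ {SpreadB.shape Y} {target'} q)) T' len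
        (λ {i} p → ℕₚ.≤-trans (spread-gap w p) (part-⊞-≤ W₀ (weight N Y) i)) A φ φ-outside)
      (Σℤ-cong (ssyt N α) λ {X} _ → φ-outer X Y)
    ... | false = trans (θ-outside (SpreadB.shape Y) q) (sym (trans (Σℤ-cong (ssyt N α) λ {X} _ → vanish X) (Σℤ-0 (ssyt N α))))
      where
      vanish : ∀ X → ind [ weight N X ⊞ weight N Y ≟ w ] ≡ ℤ.+ 0
      vanish X = trans (sym (φ-outer X Y)) (φ-outside (toList ((W₀ ⊞ weight N Y) ⊞ weight N X)) (outside' (containedB (toList ((W₀ ⊞ weight N Y) ⊞ weight N X)) target') refl))
        where
        outside' : ∀ b → containedB (toList ((W₀ ⊞ weight N Y) ⊞ weight N X)) target' ≡ b → b ≡ false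
        outside' false _ = refl
        outside' true h with trans (sym q) (containedB⁺ {SpreadB.shape Y} {target'} (containedB⁻ {toList ((W₀ ⊞ weight N Y) ⊞ weight N X)} {target'} h ∘ part-⊆ₚ {SpreadB.shape Y} λ {i} _ → part-⊞-≤ (W₀ ⊞ weight N Y) (weight N X) i))
        ... | ()

-- Coefficients of polynomials

module _ {N : ℕ} (m : Monomial N) where

  term : ℤ × Monomial N → ℤ
  term (c , m') = if eqMono m' m then c else ℤ.+ 0

  coeff-Σℤ : ∀ P → coeff P m ≡ Σℤ P term
  coeff-Σℤ [] = refl
  coeff-Σℤ ((c , m') ∷ P) = cong (λ z → (if eqMono m' m then c else ℤ.+ 0) ℤ.+ z) (coeff-Σℤ P)

  coeff-++ : ∀ P {Q} → coeff (P ++ Q) m ≡ coeff P m ℤ.+ coeff Q m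
  coeff-++ P {Q} = trans (coeff-Σℤ (P ++ Q)) (trans (Σℤ-++ P) (cong₂ ℤ._+_ (sym (coeff-Σℤ P)) (sym (coeff-Σℤ Q))))

  coeff-concatMap : {A : Set} (h : A → Poly N) (xs : List A) → coeff (concatMap h xs) m ≡ Σℤ xs (λ x → coeff (h x) m)
  coeff-concatMap h xs = trans (coeff-Σℤ (concatMap h xs)) (trans (Σℤ-concatMap h xs) (Σℤ-cong xs λ {x} _ → sym (coeff-Σℤ (h x))))

  if-neg : ∀ b c → (if b then ℤ.- c else ℤ.+ 0) ≡ ℤ.- (if b then c else ℤ.+ 0)
  if-neg true c = refl
  if-neg false c = refl

  coeff-⊖ : ∀ P → coeff (⊖ P) m ≡ ℤ.- coeff P m
  coeff-⊖ [] = refl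
  coeff-⊖ ((c , m') ∷ P) = trans (cong₂ ℤ._+_ (if-neg (eqMono m' m) c) (coeff-⊖ P)) (sym (ℤₚ.neg-distrib-+ (if eqMono m' m then c else ℤ.+ 0) (coeff P m)))

  product-term : ℤ × Monomial N → ℤ × Monomial N → ℤ
  product-term (c , (a , b)) (d , (a' , b')) = if eqMono (a ⊞ a' , b ⊞ b') m then c ℤ.* d else ℤ.+ 0

  coeff-⊗ : ∀ P Q → coeff (P ⊗ Q) m ≡ Σℤ P (λ p → Σℤ Q (product-term p))
  coeff-⊗ [] Q = refl
  coeff-⊗ ((c , (a , b)) ∷ P) Q = trans (coeff-++ (map _ Q)) (cong₂ ℤ._+_ (trans (coeff-Σℤ (map _ Q)) (trans (Σℤ-map _ Q) (Σℤ-cong Q λ _ → refl))) (coeff-⊗ P Q))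

  product-term-neg : ∀ p c a → product-term p (ℤ.- c , a) ≡ ℤ.- product-term p (c , a)
  product-term-neg (d , (a , b)) c (a' , b') = trans (cong (λ z → if eqMono (a ⊞ a' , b ⊞ b') m then z else ℤ.+ 0) (sym (ℤₚ.neg-distribʳ-* d c))) (if-neg (eqMono (a ⊞ a' , b ⊞ b') m) (d ℤ.* c))

  module _ (P : Poly N) where

    coeff-⊗-++ : ∀ Q R → coeff (P ⊗ (Q ++ R)) m ≡ coeff (P ⊗ Q) m ℤ.+ coeff (P ⊗ R) m
    coeff-⊗-++ Q R = trans (coeff-⊗ P (Q ++ R)) (trans (Σℤ-cong P λ {p} _ → Σℤ-++ Q) (trans (Σℤ-+ P) (cong₂ ℤ._+_ (sym (coeff-⊗ P Q)) (sym (coeff-⊗ P R)))))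

    coeff-⊗-⊖ : ∀ Q → coeff (P ⊗ (⊖ Q)) m ≡ ℤ.- coeff (P ⊗ Q) m
    coeff-⊗-⊖ Q = trans (coeff-⊗ P (⊖ Q)) (trans (Σℤ-cong P λ {p} _ → trans (Σℤ-map _ Q) (trans (Σℤ-cong Q λ {x} _ → product-term-neg p (proj₁ x) (proj₂ x)) (Σℤ-neg Q))) (trans (Σℤ-neg P) (cong ℤ.-_ (sym (coeff-⊗ P Q)))))

    coeff-⊗-concatMap : {A : Set} (h : A → Poly N) (xs : List A) → coeff (P ⊗ concatMap h xs) m ≡ Σℤ xs (λ x → coeff (P ⊗ h x) m)
    coeff-⊗-concatMap h xs = trans (coeff-⊗ P (concatMap h xs)) (trans (Σℤ-cong P λ {p} _ → Σℤ-concatMap h xs) (trans (Σℤ-swap P xs) (Σℤ-cong xs λ {x} _ → sym (coeff-⊗ P (h x)))))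

ind-∧ : ∀ a b → ind (a ∧ b) ≡ ind a ℤ.* ind b
ind-∧ true true = refl
ind-∧ true false = refl
ind-∧ false b = sym (ℤₚ.*-zeroˡ (ind b))

Σℤ-s : ∀ {N} κ₁ κ₂ {f : ℤ × Monomial N → ℤ} → Σℤ (s N (κ₁ , κ₂)) f ≡ Σℤ (ssyt N κ₁) (λ X → Σℤ (ssyt N κ₂) (λ Z → f (ℤ.+ 1 , (weight N X , weight N Z))))
Σℤ-s {N} κ₁ κ₂ {f} = trans (Σℤ-concatMap (λ mx → map (λ my → (ℤ.+ 1 , (mx , my))) (schurMonomials N κ₂)) (schurMonomials N κ₁))
  (trans (cong (λ z → Σℤ z (λ mx → Σℤ (map (λ my → (ℤ.+ 1 , (mx , my))) (schurMonomials N κ₂)) f)) (schurMonomials-ssyt N κ₁))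
  (trans (Σℤ-map (weight N) (ssyt N κ₁)) (Σℤ-cong (ssyt N κ₁) λ {X} _ → trans (Σℤ-map (λ my → (ℤ.+ 1 , (weight N X , my))) (schurMonomials N κ₂))
  (trans (cong (λ z → Σℤ z (λ my → f (ℤ.+ 1 , (weight N X , my)))) (schurMonomials-ssyt N κ₂)) (Σℤ-map (weight N) (ssyt N κ₂))))))

coeff-s : ∀ {N} κ₁ κ₂ (u v : Vec ℕ N) → coeff (s N (κ₁ , κ₂)) (u , v) ≡ kostka u κ₁ ℤ.* kostka v κ₂
coeff-s {N} κ₁ κ₂ u v = trans (coeff-Σℤ (u , v) (s N (κ₁ , κ₂))) (trans (Σℤ-s κ₁ κ₂) (trans (Σℤ-cong (ssyt N κ₁) λ {X} _ →
  trans (Σℤ-cong (ssyt N κ₂) λ {Z} _ → ind-∧ [ weight N X ≟ u ] [ weight N Z ≟ v ]) (Σℤ-*ˡ (ssyt N κ₂) (ind [ weight N X ≟ u ]))) (Σℤ-*ʳ (ssyt N κ₁) (kostka v κ₂))))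

-- The empty shape contributes the monomial 1 in the second variables, so the factor `kostka v β₂`
-- splits off and the rest is the Littlewood-Richardson rule in the first variables.
coeff-s-⊗-s : ∀ {N α β₁ β₂} → IsPartition α → IsPartition β₁ → (u v : Vec ℕ N) →
  coeff (s N (α , []) ⊗ s N (β₁ , β₂)) (u , v) ≡ Σℤ (products β₁ α) (λ p → coeff (s N (proj₁ p , β₂)) (u , v))
coeff-s-⊗-s {N} {α} {β₁} {β₂} A B u v = trans (coeff-⊗ (u , v) (s N (α , [])) (s N (β₁ , β₂))) (trans (Σℤ-s α []) (trans (Σℤ-cong (ssyt N α) λ {X} _ → row-sum X)
  (trans (Σℤ-*ʳ (ssyt N α) (kostka v β₂)) (trans (cong (ℤ._* kostka v β₂) (trans (Σℤ-swap (ssyt N α) (ssyt N β₁)) (sym (LittlewoodRichardson.littlewood-richardson u A B))))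
  (trans (sym (Σℤ-*ʳ (products β₁ α) (kostka v β₂))) (Σℤ-cong (products β₁ α) λ {p} _ → sym (coeff-s (proj₁ p) β₂ u v)))))))
  where
  zero-weight : ∀ n (x : Vec ℕ n) → Vec.zipWith _+_ (tabulate {n = n} (λ _ → 0)) x ≡ x
  zero-weight zero [] = refl
  zero-weight (suc n) (y ∷ x) = cong (y ∷_) (zero-weight n x)
  opaque
    unfolding ssyt
    ssyt-∅ : ssyt N [] ≡ [] ∷ []
    ssyt-∅ = refl
  row-sum : ∀ X → Σℤ (ssyt N []) (λ E → Σℤ (s N (β₁ , β₂)) (product-term (u , v) (ℤ.+ 1 , (weight N X , weight N E))))
    ≡ Σℤ (ssyt N β₁) (λ Y → ind [ weight N X ⊞ weight N Y ≟ u ]) ℤ.* kostka v β₂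
  row-sum X = trans (cong (λ z → Σℤ z (λ E → Σℤ (s N (β₁ , β₂)) (product-term (u , v) (ℤ.+ 1 , (weight N X , weight N E))))) ssyt-∅)
    (trans (ℤₚ.+-identityʳ _) (trans (Σℤ-s β₁ β₂) (trans (Σℤ-cong (ssyt N β₁) λ {Y} _ →
      trans (Σℤ-cong (ssyt N β₂) λ {Z} _ → trans (cong (λ z → ind ([ weight N X ⊞ weight N Y ≟ u ] ∧ [ z ≟ v ])) (zero-weight N (weight N Z)))
        (ind-∧ [ weight N X ⊞ weight N Y ≟ u ] [ weight N Z ≟ v ])) (Σℤ-*ˡ (ssyt N β₂) (ind [ weight N X ⊞ weight N Y ≟ u ])))
      (Σℤ-*ʳ (ssyt N β₁) (kostka v β₂)))))

Σℤ-filterB-if : {A : Set} (p : A → Bool) (xs : List A) {f : A → ℤ} → Σℤ (filterB p xs) f ≡ Σℤ xs (λ x → if p x then f x else ℤ.+ 0)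
Σℤ-filterB-if p [] = refl
Σℤ-filterB-if p (x ∷ xs) {f} with p x
... | true = cong (λ z → f x ℤ.+ z) (Σℤ-filterB-if p xs)
... | false = trans (Σℤ-filterB-if p xs) (sym (ℤₚ.+-identityˡ _))

concatMap-cong-∈ : {A B : Set} {f g : A → List B} (xs : List A) → (∀ {x} → x ∈ xs → f x ≡ g x) → concatMap f xs ≡ concatMap g xs
concatMap-cong-∈ [] h = refl
concatMap-cong-∈ (x ∷ xs) h = cong₂ _++_ (h (here refl)) (concatMap-cong-∈ xs (h ∘ there))

eqListℕ-refl : ∀ xs → eqListℕ xs xs ≡ true
eqListℕ-refl xs with Listₚ.≡-dec ℕₚ._≟_ xs xs
... | yes _ = refl
... | no n = ⊥-elim (n refl)

eqListℕ-≡ : ∀ {xs ys} → eqListℕ xs ys ≡ true → xs ≡ ys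
eqListℕ-≡ {xs} {ys} e with Listₚ.≡-dec ℕₚ._≟_ xs ys
eqListℕ-≡ e | yes p = p
eqListℕ-≡ () | no _

length-0 : {A : Set} (xs : List A) → length xs ≡ 0 → xs ≡ []
length-0 [] _ = refl

-- The identity arrow

module _ {a₁ a₂ : Partition} (A₁ : IsPartition a₁) (A₂ : IsPartition a₂) where

  private
    identity : Arrow
    identity = a₁ , a₂ , []

    proper : Partition → Partition → Bool
    proper b₁ b₂ = not (eqListℕ a₁ b₁ ∧ eqListℕ a₂ b₂)

    identity-Tab : Tab a₁ a₁ a₂ a₂ []
    identity-Tab = record
      { cells = sym (rl-⊆ {a₂})
      ; pic = record { ordered = [] ; convex = λ () ; desc = λ () }
      ; std = mkStd [] (λ ()) λ (p , n) → ⊥-elim (n p) }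

    identity-arrow : IsArrow a₁ a₂ identity
    identity-arrow = record { small = A₂ ; below = ⊆ₚ-refl ; isRW = IsRW⁺ A₁ ⊆ₚ-refl identity-Tab }

    empty : ∀ {b₁ b₂ t} → IsArrow a₁ a₂ (b₁ , b₂ , t) → rl a₂ b₂ ≡ [] → t ≡ []
    empty {t = t} p e = length-0 t (trans (annotated-length (IsArrow.isRW p)) (cong length e))

    identity-only : ∀ {b₁ b₂ t} → IsArrow a₁ a₂ (b₁ , b₂ , t) → rl a₂ b₂ ≡ [] → b₁ ≡ a₁ × b₂ ≡ a₂ × t ≡ []
    identity-only {b₁} {b₂} {t} p e = IsRW-outer-unique (IsArrow.isRW p) (IsArrow.isRW identity-arrow) refl (empty p e)
      , rl-inner-unique (IsArrow.small p) A₂ (IsArrow.below p) ⊆ₚ-refl (trans e (sym (rl-⊆ {a₂}))) , empty p e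

    proper-irr : proper a₁ a₂ ≡ false
    proper-irr rewrite eqListℕ-refl a₁ | eqListℕ-refl a₂ = refl

    improper : ∀ {b₁ b₂} → proper b₁ b₂ ≡ false → b₁ ≡ a₁ × b₂ ≡ a₂
    improper {b₁} {b₂} h with eqListℕ a₁ b₁ in e₁ | eqListℕ a₂ b₂ in e₂
    improper h | true | true = sym (eqListℕ-≡ e₁) , sym (eqListℕ-≡ e₂)

  -- If the sizes of `b₂` and `a₂` agreed, the arrow would carry no labels and would be the
  -- identity, which `arrowsFrom` excludes. The strict decrease drives all inductions on the second
  -- partition.
  arrowsFrom⁻ : ∀ {b₁ b₂ t} → (b₁ , b₂ , t) ∈ arrowsFrom (a₁ , a₂) → IsArrow a₁ a₂ (b₁ , b₂ , t) × size b₂ < size a₂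
  arrowsFrom⁻ {b₁} {b₂} {t} i = proj₁ h , ℕₚ.≤∧≢⇒< (size-⊆ {b₂} {a₂} (IsArrow.below (proj₁ h))) λ e → contradict (identity-only (proj₁ h) (no-cells e))
    where
    h : IsArrow a₁ a₂ (b₁ , b₂ , t) × proper b₁ b₂ ≡ true
    h = ∈-arrowsBy⁻ proper A₁ A₂ (subst ((b₁ , b₂ , t) ∈_) (arrowsFrom-arrowsBy a₁ a₂) i)
    no-cells : size b₂ ≡ size a₂ → rl a₂ b₂ ≡ []
    no-cells e = length-0 (rl a₂ b₂) (ℕₚ.+-cancelʳ-≡ (size b₂) _ 0 (trans (length-rl (IsArrow.below (proj₁ h))) (sym e)))
    contradict : ¬ (b₁ ≡ a₁ × b₂ ≡ a₂ × t ≡ [])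
    contradict (refl , refl , _) with trans (sym proper-irr) (proj₂ h)
    ... | ()

  arrows⁺-↭ : arrows⁺ (a₁ , a₂) ↭ identity ∷ arrowsFrom (a₁ , a₂)
  arrows⁺-↭ = set⇒↭ (arrows⁺-unique (a₁ , a₂))
    (All.tabulate (λ i e → not-identity (subst (_∈ arrowsFrom (a₁ , a₂)) (sym e) i)) ∷ subst Unique (sym (arrowsFrom-arrowsBy a₁ a₂)) (arrowsBy-unique proper a₁ a₂))
    (λ {a} → forth {a}) (λ {a} → back {a})
    where
    not-identity : identity ∉ arrowsFrom (a₁ , a₂)
    not-identity i = ℕₚ.<-irrefl refl (proj₂ (arrowsFrom⁻ i))
    forth : ∀ {a} → a ∈ arrows⁺ (a₁ , a₂) → a ∈ identity ∷ arrowsFrom (a₁ , a₂)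
    forth {b₁ , b₂ , t} i = go (proper b₁ b₂) refl
      where
      p : IsArrow a₁ a₂ (b₁ , b₂ , t)
      p = ∈-arrows⁺⁻ A₁ A₂ i
      at-identity : b₁ ≡ a₁ × b₂ ≡ a₂ → (b₁ , b₂ , t) ∈ identity ∷ arrowsFrom (a₁ , a₂)
      at-identity (refl , refl) = here (cong (λ z → b₁ , b₂ , z) (empty p (rl-⊆ {b₂})))
      go : ∀ x → proper b₁ b₂ ≡ x → (b₁ , b₂ , t) ∈ identity ∷ arrowsFrom (a₁ , a₂)
      go true e = there (subst ((b₁ , b₂ , t) ∈_) (sym (arrowsFrom-arrowsBy a₁ a₂)) (∈-arrowsBy⁺ proper p e))
      go false e = at-identity (improper e)
    back : ∀ {a} → a ∈ identity ∷ arrowsFrom (a₁ , a₂) → a ∈ arrows⁺ (a₁ , a₂)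
    back (here refl) = ∈-arrows⁺⁺ identity-arrow
    back {b₁ , b₂ , t} (there i) = ∈-arrows⁺⁺ (proj₁ (arrowsFrom⁻ i))

  -- Applied to the row rule alone and to its conjunction with the reverse rule of the slid tableau;
  -- the identity has no labels and satisfies both vacuously.
  Σℤ-identity : ∀ (p : Arrow → Bool) {f : Arrow → ℤ} → p identity ≡ true →
    Σℤ (filterB p (arrows⁺ (a₁ , a₂))) f ≡ f identity ℤ.+ Σℤ (filterB p (arrowsFrom (a₁ , a₂))) f
  Σℤ-identity p {f} e = trans (Σℤ-filterB-if p (arrows⁺ (a₁ , a₂))) (trans (Σℤ-↭ arrows⁺-↭)
    (cong₂ ℤ._+_ (cong (λ b → if b then f identity else ℤ.+ 0) e) (sym (Σℤ-filterB-if p (arrowsFrom (a₁ , a₂))))))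

rowRuleB-identity : ∀ r κ t → rowRuleB r κ κ t ≡ true
rowRuleB-identity r κ t rewrite rl-⊆ {κ} = refl

revRowRuleB-identity : ∀ r κ t → revRowRuleB r κ κ t ≡ true
revRowRuleB-identity r κ t rewrite rl-⊆ {κ} = refl

-- The basis τ

module _ (N r : ℕ) where

  proper-sat : Partition → Partition → List Arrow
  proper-sat a₁ a₂ = filterB (satRowRule r (a₁ , a₂)) (arrowsFrom (a₁ , a₂))

  ∈-proper-sat : ∀ {a₁ a₂ b₁ b₂ t} → IsPartition a₁ → IsPartition a₂ → (b₁ , b₂ , t) ∈ proper-sat a₁ a₂ → IsPartition b₁ × IsPartition b₂ × size b₂ < size a₂
  ∈-proper-sat {a₁} {a₂} {b₁} {b₂} {t} A₁ A₂ i = IsRW.outer (IsArrow.isRW (proj₁ p)) , IsArrow.small (proj₁ p) , proj₂ p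
    where
    p : IsArrow a₁ a₂ (b₁ , b₂ , t) × size b₂ < size a₂
    p = arrowsFrom⁻ A₁ A₂ (proj₁ (∈-filterB⁻ {p = satRowRule r (a₁ , a₂)} (arrowsFrom (a₁ , a₂)) i))

  τFuel-irrelevant : ∀ f g {a₁ a₂} → IsPartition a₁ → IsPartition a₂ → size a₂ < f → size a₂ < g → τFuel N r f (a₁ , a₂) ≡ τFuel N r g (a₁ , a₂)
  τFuel-irrelevant (suc f) (suc g) {a₁} {a₂} A₁ A₂ p q = cong (λ z → s N (a₁ , a₂) ⊕ (⊖ z)) (concatMap-cong-∈ (proper-sat a₁ a₂) (λ {a} → step {a}))
    where
    step : ∀ {a} → a ∈ proper-sat a₁ a₂ → τFuel N r f (target a) ≡ τFuel N r g (target a)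
    step {b₁ , b₂ , t} i = let (B₁ , B₂ , l) = ∈-proper-sat A₁ A₂ i in τFuel-irrelevant f g B₁ B₂ (ℕₚ.<-≤-trans l (ℕₚ.≤-pred p)) (ℕₚ.<-≤-trans l (ℕₚ.≤-pred q))

  τ-unfold : ∀ {a₁ a₂} → IsPartition a₁ → IsPartition a₂ → τ N r (a₁ , a₂) ≡ s N (a₁ , a₂) ⊕ (⊖ (concatMap (τ N r ∘ target) (proper-sat a₁ a₂)))
  τ-unfold {a₁} {a₂} A₁ A₂ = cong (λ z → s N (a₁ , a₂) ⊕ (⊖ z)) (concatMap-cong-∈ (proper-sat a₁ a₂) (λ {a} → step {a}))
    where
    step : ∀ {a} → a ∈ proper-sat a₁ a₂ → τFuel N r (size a₂) (target a) ≡ τ N r (target a)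
    step {b₁ , b₂ , t} i = let (B₁ , B₂ , l) = ∈-proper-sat A₁ A₂ i in τFuel-irrelevant (size a₂) (suc (size b₂)) B₁ B₂ l ℕₚ.≤-refl

  τ-∅ : ∀ {α} → IsPartition α → τ N r (α , []) ≡ s N (α , [])
  τ-∅ {α} A = trans (τ-unfold A ∅-partition) (trans (cong (λ z → s N (α , []) ⊕ (⊖ (concatMap (τ N r ∘ target) z))) (none (proper-sat α []) λ {a} → no-member {a})) (Listₚ.++-identityʳ (s N (α , []))))
    where
    no-member : ∀ {a} → a ∉ proper-sat α []
    no-member {b₁ , b₂ , t} i = ℕₚ.n≮0 (proj₂ (proj₂ (∈-proper-sat A ∅-partition i)))
    none : ∀ {A : Set} (xs : List A) → (∀ {x} → x ∉ xs) → xs ≡ []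
    none [] h = refl
    none (x ∷ xs) h = ⊥-elim (h (here refl))

  module Coefficients (m : Monomial N) where

    τ̂ : Pair → ℤ
    τ̂ p = coeff (τ N r p) m

    τ̂-unfold : ∀ {a₁ a₂} → IsPartition a₁ → IsPartition a₂ → τ̂ (a₁ , a₂) ≡ coeff (s N (a₁ , a₂)) m ℤ.- Σℤ (proper-sat a₁ a₂) (τ̂ ∘ target)
    τ̂-unfold {a₁} {a₂} A₁ A₂ = trans (cong (λ P → coeff P m) (τ-unfold A₁ A₂)) (trans (coeff-++ m (s N (a₁ , a₂)))
      (cong (λ z → coeff (s N (a₁ , a₂)) m ℤ.+ z) (trans (coeff-⊖ m (concatMap (τ N r ∘ target) (proper-sat a₁ a₂))) (cong ℤ.-_ (coeff-concatMap m (τ N r ∘ target) (proper-sat a₁ a₂))))))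

    -- The recursion for `τ` with the sum brought to the other side; `τ̂ (a₁ , a₂)` itself becomes
    -- the term of the identity arrow.
    s-expand : ∀ {a₁ a₂} → IsPartition a₁ → IsPartition a₂ → coeff (s N (a₁ , a₂)) m ≡ Σℤ (satArrows r a₁ a₂) (τ̂ ∘ target)
    s-expand {a₁} {a₂} A₁ A₂ = trans (sym (minus-plus (coeff (s N (a₁ , a₂)) m) (Σℤ (proper-sat a₁ a₂) (τ̂ ∘ target))))
      (trans (cong (ℤ._+ Σℤ (proper-sat a₁ a₂) (τ̂ ∘ target)) (sym (τ̂-unfold A₁ A₂)))
        (sym (Σℤ-identity A₁ A₂ (satRowRule r (a₁ , a₂)) {τ̂ ∘ target} (rowRuleB-identity r a₂ []))))
      where
      minus-plus : ∀ a b → (a ℤ.- b) ℤ.+ b ≡ a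
      minus-plus a b = trans (ℤₚ.+-assoc a (ℤ.- b) b) (trans (cong (λ z → a ℤ.+ z) (ℤₚ.+-inverseˡ b)) (ℤₚ.+-identityʳ a))

    module _ {α : Partition} (A : IsPartition α) where

      -- The coefficient of the right side of the theorem, with the leading `τ` of each summand
      -- absorbed as the term of the identity arrow.
      rhs : Partition → Partition → ℤ
      rhs β₁ β₂ = Σℤ (products β₁ α) (λ p → Σℤ (revArrows r (proj₁ p) β₂ (proj₂ p)) (τ̂ ∘ target))

      -- After expanding every Schur function, `exchange` regroups the terms by their first arrow
      -- out of `(β₁ , β₂)`. The identity yields `rhs β₁ β₂`; the proper arrows yield the terms that
      -- the recursion for `τ` subtracts.
      rhs-sum : ∀ {β₁ β₂} → IsPartition β₁ → IsPartition β₂ → coeff (s N (α , []) ⊗ s N (β₁ , β₂)) m ≡ rhs β₁ β₂ ℤ.+ Σℤ (proper-sat β₁ β₂) (λ a → rhs (proj₁ a) (proj₁ (proj₂ a)))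
      rhs-sum {β₁} {β₂} B₁ B₂ = trans (coeff-s-⊗-s {N} {α} {β₁} {β₂} A B₁ (proj₁ m) (proj₂ m))
        (trans (Σℤ-cong (products β₁ α) λ {p} i → s-expand (IsRW.outer (∈-products⁻ B₁ A i)) B₂)
        (trans (sym Ex.Σℤ-lefts) (trans (Ex.exchange τ̂) (trans Ex.Σℤ-rights
        (Σℤ-identity B₁ B₂ (satRowRule r (β₁ , β₂)) {λ a → rhs (proj₁ a) (proj₁ (proj₂ a))} (rowRuleB-identity r β₂ []))))))
        where module Ex = Exchange r B₁ A B₂

      -- By induction the products with the subtracted `τ` are values of `rhs` at the targets, and
      -- these cancel the sum in `rhs-sum`.
      product-τ : ∀ n {β₁ β₂} → IsPartition β₁ → IsPartition β₂ → size β₂ < n → coeff (s N (α , []) ⊗ τ N r (β₁ , β₂)) m ≡ rhs β₁ β₂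
      product-τ (suc n) {β₁} {β₂} B₁ B₂ (s≤s l) = trans (cong (λ P → coeff (s N (α , []) ⊗ P) m) (τ-unfold B₁ B₂))
        (trans (coeff-⊗-++ m (s N (α , [])) (s N (β₁ , β₂)) (⊖ (concatMap (τ N r ∘ target) (proper-sat β₁ β₂))))
        (trans (cong₂ ℤ._+_ (rhs-sum B₁ B₂) (trans (coeff-⊗-⊖ m (s N (α , [])) (concatMap (τ N r ∘ target) (proper-sat β₁ β₂)))
          (cong ℤ.-_ (trans (coeff-⊗-concatMap m (s N (α , [])) (τ N r ∘ target) (proper-sat β₁ β₂)) (Σℤ-cong (proper-sat β₁ β₂) (λ {a} → step {a}))))))
        (plus-minus (rhs β₁ β₂) (Σℤ (proper-sat β₁ β₂) (λ a → rhs (proj₁ a) (proj₁ (proj₂ a)))))))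
        where
        plus-minus : ∀ a b → (a ℤ.+ b) ℤ.+ ℤ.- b ≡ a
        plus-minus a b = trans (ℤₚ.+-assoc a b (ℤ.- b)) (trans (cong (λ z → a ℤ.+ z) (ℤₚ.+-inverseʳ b)) (ℤₚ.+-identityʳ a))
        step : ∀ {a} → a ∈ proper-sat β₁ β₂ → coeff (s N (α , []) ⊗ τ N r (target a)) m ≡ rhs (proj₁ a) (proj₁ (proj₂ a))
        step {b₁ , b₂ , t} i = let (C₁ , C₂ , k) = ∈-proper-sat B₁ B₂ i in product-τ n C₁ C₂ (ℕₚ.<-≤-trans k l)

      statement-rhs : ∀ {β₁ β₂} → IsPartition β₁ → IsPartition β₂ →
        coeff (Σ[ extensions β₁ α ] (λ l → Σ[ RW l β₁ α [] ] (λ t₁ → τ N r (l , β₂)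
          ⊕ Σ[ filterB (λ a → satRowRule r (l , β₂) a ∧ slideRevRowRule r β₂ t₁ a) (arrowsFrom (l , β₂)) ] (λ a → τ N r (target a))))) m ≡ rhs β₁ β₂
      statement-rhs {β₁} {β₂} B₁ B₂ = trans (coeff-concatMap m _ (extensions β₁ α)) (trans (Σℤ-cong (extensions β₁ α) λ {l} _ → coeff-concatMap m _ (RW l β₁ α []))
        (trans (sym (Σℤ-products β₁ α)) (Σℤ-cong (products β₁ α) (λ {p} → summand {p}))))
        where
        summand : ∀ {p} → p ∈ products β₁ α → coeff (τ N r (proj₁ p , β₂) ⊕ Σ[ filterB (λ a → satRowRule r (proj₁ p , β₂) a ∧ slideRevRowRule r β₂ (proj₂ p) a) (arrowsFrom (proj₁ p , β₂)) ] (λ a → τ N r (target a))) m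
          ≡ Σℤ (revArrows r (proj₁ p) β₂ (proj₂ p)) (τ̂ ∘ target)
        summand {l , t₁} i = trans (coeff-++ m (τ N r (l , β₂))) (trans (cong (λ z → τ̂ (l , β₂) ℤ.+ z) (coeff-concatMap m (τ N r ∘ target) rev-proper))
          (sym (Σℤ-identity (IsRW.outer (∈-products⁻ B₁ A i)) B₂ (λ a → satRowRule r (l , β₂) a ∧ slideRevRowRule r β₂ t₁ a) {τ̂ ∘ target}
            (∧-intro (rowRuleB-identity r β₂ []) (revRowRuleB-identity r β₂ (Slide t₁ []))))))
          where
          rev-proper : List Arrow
          rev-proper = filterB (λ a → satRowRule r (l , β₂) a ∧ slideRevRowRule r β₂ t₁ a) (arrowsFrom (l , β₂))

mainTheorem2 : (r : ℕ) → 0 < r → (α β₁ β₂ : List ℕ) →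
    IsPartition α → IsPartition β₁ → IsPartition β₂ → (N : ℕ) →
    τ N r (α , []) ⊗ τ N r (β₁ , β₂)
    ≋ Σ[ filterB (λ l → containedB β₁ l) (partitionsOf (size β₁ + size α)) ] (λ l →
    Σ[ RW l β₁ α [] ] (λ t₁ →
    τ N r (l , β₂)
    ⊕ Σ[ filterB (λ a → satRowRule r (l , β₂) a ∧ slideRevRowRule r β₂ t₁ a)
    (arrowsFrom (l , β₂)) ] (λ a → τ N r (target a))))
mainTheorem2 r _ α β₁ β₂ A B₁ B₂ N m = trans (cong (λ P → coeff (P ⊗ τ N r (β₁ , β₂)) m) (τ-∅ N r A))
  (trans (product-τ A (suc (size β₂)) B₁ B₂ ℕₚ.≤-refl) (sym (statement-rhs A B₁ B₂)))
  where open Coefficients N r m
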